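{- As $F\to\infty$, $\Xi_S\to\Xi$ uniformly in probability; that is, for every $\epsilon>0$, \[ \lim_{F\to\infty}\mathbb{P}_{\mathrm{Frob},F}\Big[\sup_{0\le\alpha\le 1}|\Xi_S(\alpha)-\Xi(\alpha)|>\epsilon\Big]=0. \]
   Context: A numerical semigroup $S$ is a subset of $\mathbb{N}_0=\{0,1,2,\dots\}$ that contains $0$, is closed under addition, and has finite complement in $\mathbb{N}_0$. Its Frobenius number $F(S)$ is the largest element of $\mathbb{N}_0\setminus S$. For a positive integer $F$, $\mathcal{S}_{\mathrm{Frob}}(F)$ is the (finite) set of numerical semigroups with Frobenius number $F$, and $\mathbb{P}_{\mathrm{Frob},F}$ is the uniform probability distribution on it. $a_k(S)$ denotes the $k$-th smallest nonzero element of $S$ ($k\ge1$). For $0\le\alpha\le1$, let $t=1+\lfloor\alpha(F(S)-1)\rfloor$ and define $\Xi_S(\alpha)=\frac{a_t(S)}{F(S)}$. Define $\Xi:[0,1]\to[0,2]$ by $\Xi(\alpha)=\frac12+2\alpha$ if $0\le\alpha\le\frac14$ and $\Xi(\alpha)=\frac34+\alpha$ if $\frac14\le\alpha\le1$. -}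

module Defs where

open import Data.Bool.Base using (Bool; true; false; T; if_then_else_)
open import Data.Bool.Properties using (T?)
open import Data.Empty using (⊥-elim)
open import Data.Fin.Base using (Fin; toℕ; fromℕ<)
import Data.Fin.Base as Fin
import Data.Fin.Properties as Fin
open import Data.Integer.Base using (+_)
import Data.Integer.Base as ℤ
import Data.Integer.Properties as ℤ
open import Data.List.Base using (List; []; _∷_; [_]; length; filter; map; _++_; upTo; cartesianProductWith)
open import Data.List.Membership.Propositional using (_∈_)
open import Data.List.Membership.Propositional.Properties
  using (∈-cartesianProductWith⁺; ∈-upTo⁺; ∈-upTo⁻; ∈-map⁺; ∈-map⁻; ∈-++⁺ˡ; ∈-++⁺ʳ; ∈-++⁻)
import Data.List.Membership.Setoid as SetoidMembership
open import Data.List.Relation.Unary.All using (All; []; _∷_)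
import Data.List.Relation.Unary.All as All
open import Data.List.Relation.Unary.AllPairs using ([]; _∷_)
open import Data.List.Relation.Unary.Any using (here; there)
open import Data.List.Relation.Unary.Unique.Propositional using (Unique)
open import Data.List.Relation.Unary.Unique.Propositional.Properties using (cartesianProductWith⁺)
import Data.List.Relation.Unary.Unique.Setoid as SetoidUnique
open import Data.Nat.Base using (ℕ; zero; suc; NonZero)
import Data.Nat.Base as ℕ
import Data.Nat.Properties as ℕ
open import Data.Product.Base using (Σ; ∃; ∃-syntax; _×_; _,_; proj₁; proj₂)
open import Data.Rational.Base using (ℚ; 0ℚ; 1ℚ; ½; _/_; _+_; _*_; _-_; -_)
import Data.Rational.Base as ℚ
import Data.Rational.Properties as ℚ
open import Data.Rational.Solver using (module +-*-Solver)
import Data.Rational.Unnormalised.Base as ℚᵘ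
import Data.Rational.Unnormalised.Properties as ℚᵘ
open import Data.Sum.Base using (_⊎_; inj₁; inj₂)
open import Data.Unit.Base using (tt)
open import Data.Vec.Base using (Vec; []; _∷_; lookup; tabulate)
import Data.Vec.Properties as Vec
open import Function.Base using (_∘_; const; id)
open import Level using (0ℓ)
open import Relation.Binary.Bundles using (DecTotalOrder; Setoid)
open import Relation.Binary.PropositionalEquality hiding ([_])
open import Relation.Nullary using (¬_; Dec; yes; no; contradiction)
open import Relation.Nullary.Decidable using (⌊_⌋; _×-dec_; _⊎-dec_; _→-dec_; ¬?; toWitness; fromWitness)
open import Relation.Unary using (Pred; Decidable; _⊆_)

open import Data.List.Extrema (DecTotalOrder.totalOrder ℚ.≤-decTotalOrder)
  using (argmax; argmax-all; f[xs]≤f[argmax])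
open +-*-Solver using (solve; _:=_; _:+_; _:-_; _:*_; :-_; con)

comb : ∀ {x y p q} → p ℚ.≤ q → x + q ≡ y + p → x ℚ.≤ y
comb {x} {y} {p} {q} p≤q e = begin
  x              ≡⟨ solve 2 (λ x q → x := (x :+ q) :- q) refl x q ⟩
  (x + q) - q    ≡⟨ cong (_- q) e ⟩
  (y + p) - q    ≤⟨ ℚ.+-monoˡ-≤ (- q) (ℚ.+-monoʳ-≤ y p≤q) ⟩
  (y + q) - q    ≡⟨ solve 2 (λ y q → (y :+ q) :- q := y) refl y q ⟩
  y              ∎
  where open ℚ.≤-Reasoning

_⊕_ : ∀ {p q r s} → p ℚ.≤ q → r ℚ.≤ s → p + r ℚ.≤ q + s
_⊕_ = ℚ.+-mono-≤

infixl 6 _⊕_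

½-pos : ∀ {η} → 0ℚ ℚ.< η → 0ℚ ℚ.< ½ * η
½-pos {η} 0<η = subst (ℚ._< ½ * η) (ℚ.*-zeroʳ ½) (ℚ.*-monoʳ-<-pos ½ 0<η)

∣∣-bound : ∀ {x b} → x ℚ.≤ b → - x ℚ.≤ b → ℚ.∣ x ∣ ℚ.≤ b
∣∣-bound {x} x≤b -x≤b with ℚ.∣p∣≡p∨∣p∣≡-p x
... | inj₁ e = subst (ℚ._≤ _) (sym e) x≤b
... | inj₂ e = subst (ℚ._≤ _) (sym e) -x≤b

x≤∣x∣ : ∀ x → x ℚ.≤ ℚ.∣ x ∣
x≤∣x∣ x with ℚ.≤-total 0ℚ x
... | inj₁ 0≤x = ℚ.≤-reflexive (sym (ℚ.0≤p⇒∣p∣≡p 0≤x))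
... | inj₂ x≤0 = ℚ.≤-trans x≤0 (ℚ.0≤∣p∣ x)

-x≤∣x∣ : ∀ x → - x ℚ.≤ ℚ.∣ x ∣
-x≤∣x∣ x = subst (- x ℚ.≤_) (ℚ.∣-p∣≡∣p∣ x) (x≤∣x∣ (- x))

∣-∣⇒≤ : ∀ {p q η} → ℚ.∣ p - q ∣ ℚ.≤ η → p ℚ.≤ q + η
∣-∣⇒≤ {p} {q} {η} h = comb (ℚ.≤-trans (x≤∣x∣ (p - q)) h)
  (solve 3 (λ p q η → p :+ η := (q :+ η) :+ (p :- q)) refl p q η)

≤⇒∣-∣ : ∀ {p q η} → p ℚ.≤ q + η → q ℚ.≤ p + η → ℚ.∣ p - q ∣ ℚ.≤ η
≤⇒∣-∣ {p} {q} {η} h k = ∣∣-bound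
  (comb h (solve 3 (λ p q η → (p :- q) :+ (q :+ η) := η :+ p) refl p q η))
  (comb k (solve 3 (λ p q η → (:- (p :- q)) :+ (p :+ η) := η :+ q) refl p q η))

0<q-p : ∀ {p q} → p ℚ.< q → 0ℚ ℚ.< q - p
0<q-p {p} {q} p<q = subst (ℚ._< q - p) (ℚ.+-inverseʳ p) (ℚ.+-monoˡ-< (- p) p<q)

fromℕ : ℕ → ℚ
fromℕ n = + n / 1

fromℕ≃ : ∀ n → ℚ.toℚᵘ (fromℕ n) ℚᵘ.≃ ℚᵘ.mkℚᵘ (+ n) 0
fromℕ≃ n = ℚ.toℚᵘ-fromℚᵘ (ℚᵘ.mkℚᵘ (+ n) 0)

fromℕ-mono : ∀ {m n} → m ℕ.≤ n → fromℕ m ℚ.≤ fromℕ n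
fromℕ-mono {m} {n} m≤n = ℚ.toℚᵘ-cancel-≤
  (ℚᵘ.≤-respˡ-≃ (ℚᵘ.≃-sym (fromℕ≃ m)) (ℚᵘ.≤-respʳ-≃ (ℚᵘ.≃-sym (fromℕ≃ n))
    (ℚᵘ.*≤* (ℤ.*-monoʳ-≤-nonNeg (+ 1) (ℤ.+≤+ m≤n)))))

fromℕ-reflect : ∀ {m n} → fromℕ m ℚ.≤ fromℕ n → m ℕ.≤ n
fromℕ-reflect {m} {n} h with
  ℚᵘ.≤-respˡ-≃ (fromℕ≃ m) (ℚᵘ.≤-respʳ-≃ (fromℕ≃ n) (ℚ.toℚᵘ-mono-≤ h))
... | ℚᵘ.*≤* k = ℤ.drop‿+≤+ (ℤ.*-cancelʳ-≤-pos (+ m) (+ n) (+ 1) k)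

fromℕ-suc : ∀ n → fromℕ (suc n) ≡ fromℕ n + 1ℚ
fromℕ-suc n = ℚ.toℚᵘ-injective (begin
  ℚ.toℚᵘ (fromℕ (suc n))                  ≈⟨ fromℕ≃ (suc n) ⟩
  ℚᵘ.mkℚᵘ (+ suc n) 0                     ≈⟨ ℚᵘ.*≡* (cong (ℤ._* + 1) eq) ⟩
  ℚᵘ.mkℚᵘ (+ n) 0 ℚᵘ.+ ℚᵘ.1ℚᵘ             ≈⟨ ℚᵘ.+-congˡ ℚᵘ.1ℚᵘ (fromℕ≃ n) ⟨
  ℚ.toℚᵘ (fromℕ n) ℚᵘ.+ ℚ.toℚᵘ 1ℚ         ≈⟨ ℚ.toℚᵘ-homo-+ (fromℕ n) 1ℚ ⟨
  ℚ.toℚᵘ (fromℕ n + 1ℚ)                   ∎)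
  where
  open ℚᵘ.≃-Reasoning
  eq : + suc n ≡ + n ℤ.* + 1 ℤ.+ + 1
  eq = trans (cong +_ (ℕ.+-comm 1 n)) (cong (ℤ._+ + 1) (sym (ℤ.*-identityʳ (+ n))))

*-/ : ∀ k n → fromℕ (suc k) * (+ n / suc k) ≡ fromℕ n
*-/ k n = ℚ.toℚᵘ-injective (begin
  ℚ.toℚᵘ (fromℕ (suc k) * (+ n / suc k))            ≈⟨ ℚ.toℚᵘ-homo-* (fromℕ (suc k)) (+ n / suc k) ⟩
  ℚ.toℚᵘ (fromℕ (suc k)) ℚᵘ.* ℚ.toℚᵘ (+ n / suc k)  ≈⟨ ℚᵘ.*-cong (fromℕ≃ (suc k)) (ℚ.toℚᵘ-fromℚᵘ (ℚᵘ.mkℚᵘ (+ n) k)) ⟩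
  ℚᵘ.mkℚᵘ (+ suc k) 0 ℚᵘ.* ℚᵘ.mkℚᵘ (+ n) k          ≈⟨ ℚᵘ.*≡* eq ⟩
  ℚᵘ.mkℚᵘ (+ n) 0                                   ≈⟨ fromℕ≃ n ⟨
  ℚ.toℚᵘ (fromℕ n)                                  ∎)
  where
  open ℚᵘ.≃-Reasoning
  eq : (+ suc k ℤ.* + n) ℤ.* + 1 ≡ + n ℤ.* + suc (k ℕ.+ 0)
  eq = trans (ℤ.*-identityʳ _) (trans (ℤ.*-comm (+ suc k) (+ n))
         (cong (λ j → + n ℤ.* + suc j) (sym (ℕ.+-identityʳ k))))

fromℕ-pos : ∀ k → ℚ.Positive (fromℕ (suc k))
fromℕ-pos k = ℚ.normalize-pos (suc k) 1

fromℕ-nonNeg : ∀ k → ℚ.NonNegative (fromℕ k)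
fromℕ-nonNeg k = ℚ.normalize-nonNeg k 1

shrink : ℕ → ℚ → ℚ
shrink k η = η * (+ 1 / suc k)

shrink-pos : ∀ k {η} → 0ℚ ℚ.< η → 0ℚ ℚ.< shrink k η
shrink-pos k {η} 0<η = subst (ℚ._< shrink k η) (ℚ.*-zeroˡ (+ 1 / suc k))
  (ℚ.*-monoˡ-<-pos (+ 1 / suc k) {{ℚ.normalize-pos 1 (suc k)}} 0<η)

shrink-≡ : ∀ k η → fromℕ (suc k) * shrink k η ≡ η
shrink-≡ k η = begin
  fromℕ (suc k) * (η * (+ 1 / suc k))  ≡⟨ solve 3 (λ a b c → a :* (b :* c) := b :* (a :* c)) refl (fromℕ (suc k)) η (+ 1 / suc k) ⟩
  η * (fromℕ (suc k) * (+ 1 / suc k))  ≡⟨ cong (η *_) (*-/ k 1) ⟩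
  η * 1ℚ                               ≡⟨ ℚ.*-identityʳ η ⟩
  η                                    ∎
  where open ≡-Reasoning

shrink-≤ : ∀ k {η} → 0ℚ ℚ.< η → fromℕ k * shrink k η ℚ.≤ η
shrink-≤ k {η} 0<η = subst (fromℕ k * shrink k η ℚ.≤_) (shrink-≡ k η)
  (ℚ.*-monoʳ-≤-nonNeg (shrink k η) {{ℚ.nonNegative (ℚ.<⇒≤ (shrink-pos k 0<η))}}
    (fromℕ-mono (ℕ.n≤1+n k)))

scale-≤ : ∀ k {p q η} → 0ℚ ℚ.< η → p ℚ.≤ q + shrink k η → fromℕ k * p ℚ.≤ fromℕ k * q + η
scale-≤ k {p} {q} {η} 0<η h = comb
  (ℚ.*-monoˡ-≤-nonNeg (fromℕ k) {{fromℕ-nonNeg k}} h ⊕ shrink-≤ k 0<η)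
  (solve 5 (λ K p q η s → K :* p :+ (K :* (q :+ s) :+ η) := (K :* q :+ η) :+ (K :* p :+ K :* s))
    refl (fromℕ k) p q η (shrink k η))

record ℝ : Set where
  field
    seq    : ℕ → ℚ
    cauchy : ∀ η → 0ℚ ℚ.< η →
             ∃[ N ] ∀ m n → N ℕ.≤ m → N ℕ.≤ n → ℚ.∣ seq m - seq n ∣ ℚ.≤ η

open ℝ

infix 4 _≤_ _<_

_≤_ : ℝ → ℝ → Set
x ≤ y = ∀ η → 0ℚ ℚ.< η → ∃[ N ] ∀ n → N ℕ.≤ n → seq x n ℚ.≤ seq y n + η

_<_ : ℝ → ℝ → Set
x < y = ∃[ η ] 0ℚ ℚ.< η × ∃[ N ] ∀ n → N ℕ.≤ n → seq x n + η ℚ.≤ seq y n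

fromℚ : ℚ → ℝ
fromℚ p = record
  { seq    = const p
  ; cauchy = λ η 0<η → 0 , λ _ _ _ _ →
      subst (ℚ._≤ η) (sym (cong ℚ.∣_∣ (ℚ.+-inverseʳ p))) (ℚ.<⇒≤ 0<η)
  }

0ℝ 1ℝ : ℝ
0ℝ = fromℚ 0ℚ
1ℝ = fromℚ 1ℚ

fromOneSided : (f : ℕ → ℚ) →
  (∀ η → 0ℚ ℚ.< η → ∃[ N ] ∀ m n → N ℕ.≤ m → N ℕ.≤ n → f m ℚ.≤ f n + η) → ℝ
fromOneSided f h = record
  { seq    = f
  ; cauchy = λ η 0<η → let N , k = h η 0<η in
      N , λ m n N≤m N≤n → ≤⇒∣-∣ (k m n N≤m N≤n) (k n m N≤n N≤m)
  }

oneSided : (x : ℝ) → ∀ η → 0ℚ ℚ.< η →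
  ∃[ N ] ∀ m n → N ℕ.≤ m → N ℕ.≤ n → seq x m ℚ.≤ seq x n + η
oneSided x η 0<η = let N , k = cauchy x η 0<η in
  N , λ m n N≤m N≤n → ∣-∣⇒≤ (k m n N≤m N≤n)

⊔ˡ : ∀ {M N n} → M ℕ.⊔ N ℕ.≤ n → M ℕ.≤ n
⊔ˡ {M} {N} = ℕ.m⊔n≤o⇒m≤o M N

⊔ʳ : ∀ {M N n} → M ℕ.⊔ N ℕ.≤ n → N ℕ.≤ n
⊔ʳ {M} {N} = ℕ.m⊔n≤o⇒n≤o M N

halves : ∀ η → ½ * η + ½ * η ≡ η
halves = solve 1 (λ η → con ½ :* η :+ con ½ :* η := η) refl

infixl 6 _-ℝ_
infixl 7 _·_

_-ℝ_ : ℝ → ℝ → ℝ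
x -ℝ y = fromOneSided (λ n → seq x n - seq y n) λ η 0<η →
  let M , h = oneSided x (½ * η) (½-pos 0<η)
      N , k = oneSided y (½ * η) (½-pos 0<η)
  in M ℕ.⊔ N , λ m n ≤m ≤n →
    comb (h m n (⊔ˡ ≤m) (⊔ˡ ≤n) ⊕ k n m (⊔ʳ {M} ≤n) (⊔ʳ {M} ≤m))
      (solve 5 (λ a b c d η → (a :- b) :+ ((c :+ con ½ :* η) :+ (b :+ con ½ :* η))
                           := ((c :- d) :+ η) :+ (a :+ d))
        refl (seq x m) (seq y m) (seq x n) (seq y n) η)

∣_∣ : ℝ → ℝ
∣ x ∣ = fromOneSided (λ n → ℚ.∣ seq x n ∣) λ η 0<η →
  let N , h = oneSided x η 0<η
  in N , λ m n ≤m ≤n → ∣∣-bound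
    (ℚ.≤-trans (h m n ≤m ≤n) (ℚ.+-monoˡ-≤ η (x≤∣x∣ (seq x n))))
    (comb (h n m ≤n ≤m ⊕ -x≤∣x∣ (seq x n))
      (solve 4 (λ a b c η → (:- a) :+ ((a :+ η) :+ c) := (c :+ η) :+ (b :+ (:- b)))
        refl (seq x m) (seq x n) ℚ.∣ seq x n ∣ η))

_·_ : ℕ → ℝ → ℝ
k · x = fromOneSided (λ n → fromℕ k * seq x n) λ η 0<η →
  let N , h = oneSided x (shrink k η) (shrink-pos k 0<η)
  in N , λ m n ≤m ≤n → scale-≤ k 0<η (h m n ≤m ≤n)

≤-trans : ∀ {x y z} → x ≤ y → y ≤ z → x ≤ z
≤-trans {x} {y} {z} h k η 0<η =
  let M , h′ = h (½ * η) (½-pos 0<η)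
      N , k′ = k (½ * η) (½-pos 0<η)
  in M ℕ.⊔ N , λ n ≤n → comb (h′ n (⊔ˡ ≤n) ⊕ k′ n (⊔ʳ {M} ≤n))
    (solve 4 (λ a b c η → a :+ ((b :+ con ½ :* η) :+ (c :+ con ½ :* η)) := (c :+ η) :+ (a :+ b))
      refl (seq x n) (seq y n) (seq z n) η)

<⇒≤ : ∀ {x y} → x < y → x ≤ y
<⇒≤ {x} {y} (μ , 0<μ , N , h) η 0<η = N , λ n ≤n → comb (h n ≤n ⊕ (ℚ.<⇒≤ 0<μ ⊕ ℚ.<⇒≤ 0<η))
  (solve 4 (λ a b μ η → a :+ (b :+ (μ :+ η)) := (b :+ η) :+ ((a :+ μ) :+ (con 0ℚ :+ con 0ℚ)))
    refl (seq x n) (seq y n) μ η)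

fromℚ-≤ : ∀ {p q} → p ℚ.≤ q → fromℚ p ≤ fromℚ q
fromℚ-≤ {p} {q} h η 0<η = 0 , λ _ _ → comb (h ⊕ ℚ.<⇒≤ 0<η)
  (solve 3 (λ p q η → p :+ (q :+ η) := (q :+ η) :+ (p :+ con 0ℚ)) refl p q η)

fromℚ-< : ∀ {p q} → p ℚ.< q → fromℚ p < fromℚ q
fromℚ-< {p} {q} h = q - p , 0<q-p h , 0 , λ _ _ →
  ℚ.≤-reflexive (solve 2 (λ p q → p :+ (q :- p) := q) refl p q)

fromℚ-reflect : ∀ {p q} → fromℚ p ≤ fromℚ q → p ℚ.≤ q
fromℚ-reflect {p} {q} h with p ℚ.≤? q
... | yes p≤q = p≤q
... | no p≰q =
  let N , k = h (½ * (p - q)) (½-pos (0<q-p (ℚ.≰⇒> p≰q)))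
      l     = k N ℕ.≤-refl
  in comb (l ⊕ l)
    (solve 2 (λ p q → p :+ ((q :+ con ½ :* (p :- q)) :+ (q :+ con ½ :* (p :- q))) := q :+ (p :+ p))
      refl p q)

·-mono : ∀ k {x y} → x ≤ y → k · x ≤ k · y
·-mono k h η 0<η =
  let N , l = h (shrink k η) (shrink-pos k 0<η)
  in N , λ n ≤n → scale-≤ k 0<η (l n ≤n)

·-cancel : ∀ k {x y} → suc k · x ≤ suc k · y → x ≤ y
·-cancel k {x} {y} h η 0<η =
  let N , l = h (fromℕ (suc k) * η)
                (subst (ℚ._< fromℕ (suc k) * η) (ℚ.*-zeroʳ (fromℕ (suc k)))
                  (ℚ.*-monoʳ-<-pos (fromℕ (suc k)) {{fromℕ-pos k}} 0<η))
  in N , λ n ≤n → ℚ.*-cancelˡ-≤-pos (fromℕ (suc k)) {{fromℕ-pos k}}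
    (subst (fromℕ (suc k) * seq x n ℚ.≤_)
      (sym (ℚ.*-distribˡ-+ (fromℕ (suc k)) (seq y n) η)) (l n ≤n))

-- Constructively a real need not have a floor, hence a relation.
IsFloor : ℝ → ℕ → Set
IsFloor x n = fromℚ (fromℕ n) ≤ x × x < fromℚ (fromℕ (suc n))

IsSupremum : {I : Set} → (I → ℝ) → ℝ → Set
IsSupremum f s = (∀ i → f i ≤ s) × (∀ r → r < s → ∃[ i ] r < f i)

ξ : ℚ → ℚ
ξ p = if ⌊ p ℚ.≤? + 1 / 4 ⌋ then ½ + + 2 / 1 * p else + 3 / 4 + p

ξ-≤ : ∀ p q η → 0ℚ ℚ.≤ η → p ℚ.≤ q + η → ξ p ℚ.≤ ξ q + (η + η)
ξ-≤ p q η 0≤η h with p ℚ.≤? + 1 / 4 | q ℚ.≤? + 1 / 4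
... | yes a | yes b = comb (h ⊕ h)
  (solve 3 (λ p q η → (con ½ :+ con (+ 2 / 1) :* p) :+ ((q :+ η) :+ (q :+ η))
     := ((con ½ :+ con (+ 2 / 1) :* q) :+ (η :+ η)) :+ (p :+ p)) refl p q η)
... | yes a | no b = comb (a ⊕ h ⊕ 0≤η)
  (solve 3 (λ p q η → (con ½ :+ con (+ 2 / 1) :* p) :+ ((con (+ 1 / 4) :+ (q :+ η)) :+ η)
     := ((con (+ 3 / 4) :+ q) :+ (η :+ η)) :+ ((p :+ p) :+ con 0ℚ)) refl p q η)
... | no a | yes b = comb (ℚ.<⇒≤ (ℚ.≰⇒> a) ⊕ h ⊕ h)
  (solve 3 (λ p q η → (con (+ 3 / 4) :+ p) :+ ((p :+ (q :+ η)) :+ (q :+ η))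
     := ((con ½ :+ con (+ 2 / 1) :* q) :+ (η :+ η)) :+ ((con (+ 1 / 4) :+ p) :+ p)) refl p q η)
... | no a | no b = comb (h ⊕ 0≤η)
  (solve 3 (λ p q η → (con (+ 3 / 4) :+ p) :+ ((q :+ η) :+ η)
     := ((con (+ 3 / 4) :+ q) :+ (η :+ η)) :+ (p :+ con 0ℚ)) refl p q η)

-- ξ is Lipschitz, so applying it termwise extends it continuously to ℝ.
Ξ : ℝ → ℝ
Ξ x = fromOneSided (ξ ∘ seq x) λ η 0<η →
  let N , h = oneSided x (½ * η) (½-pos 0<η)
  in N , λ m n ≤m ≤n → subst (λ t → ξ (seq x m) ℚ.≤ ξ (seq x n) + t) (halves η)
       (ξ-≤ (seq x m) (seq x n) (½ * η) (ℚ.<⇒≤ (½-pos 0<η)) (h m n ≤m ≤n))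

record NumericalSemigroup : Set where
  field
    member      : ℕ → Bool
    0∈          : T (member 0)
    +-closed    : ∀ m n → T (member m) → T (member n) → T (member (m ℕ.+ n))
    finite-gaps : ∃[ gaps ] ∀ n → ¬ T (member n) → n ∈ gaps

open NumericalSemigroup

IsFrobenius : NumericalSemigroup → ℕ → Set
IsFrobenius S F = ¬ T (member S F) × (∀ n → ¬ T (member S n) → n ℕ.≤ F)

record 𝒮 (F : ℕ) : Set where
  field
    semigroup   : NumericalSemigroup
    isFrobenius : IsFrobenius semigroup F

  _∋_ : ℕ → Bool
  _∋_ = member semigroup

open 𝒮 using (semigroup; isFrobenius; _∋_)

𝒮-setoid : ℕ → Setoid 0ℓ 0ℓ
𝒮-setoid F = record
  { Carrier       = 𝒮 F
  ; _≈_           = λ S S′ → ∀ n → (S ∋ n) ≡ (S′ ∋ n)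
  ; isEquivalence = record
    { refl  = λ _ → refl
    ; sym   = λ e n → sym (e n)
    ; trans = λ e e′ n → trans (e n) (e′ n)
    }
  }

private
  big : ∀ {F} (S : 𝒮 F) n → F ℕ.< n → T (S ∋ n)
  big S n F<n with T? (S ∋ n)
  ... | yes n∈S = n∈S
  ... | no n∉S  = contradiction (proj₂ (isFrobenius S) n n∉S) (ℕ.<⇒≱ F<n)

-- search S b n is the least element of {n, …, n + b - 1} in S, or n + b if
-- there is none.
search : ∀ {F} → 𝒮 F → ℕ → ℕ → ℕ
search S zero    n = n
search S (suc b) n = if S ∋ n then n else search S b (suc n)

-- a S k is the k-th smallest nonzero element of S (k ≥ 1), with a S 0 = 0.
a : ∀ {F} → 𝒮 F → ℕ → ℕ
a     S zero    = 0
a {F} S (suc k) = search S F (suc (a S k))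

private
  search-∈ : ∀ {F} (S : 𝒮 F) b n → F ℕ.< n ℕ.+ b → T (S ∋ search S b n)
  search-∈ {F} S zero    n h = big S n (subst (F ℕ.<_) (ℕ.+-identityʳ n) h)
  search-∈ {F} S (suc b) n h with S ∋ n in eq
  ... | true  = subst T (sym eq) tt
  ... | false = search-∈ S b (suc n) (subst (F ℕ.<_) (ℕ.+-suc n b) h)

  search-≥ : ∀ {F} (S : 𝒮 F) b n → n ℕ.≤ search S b n
  search-≥ S zero    n = ℕ.≤-refl
  search-≥ S (suc b) n with S ∋ n
  ... | true  = ℕ.≤-refl
  ... | false = ℕ.≤-trans (ℕ.n≤1+n n) (search-≥ S b (suc n))

  search-least : ∀ {F} (S : 𝒮 F) b n m → n ℕ.≤ m → T (S ∋ m) → search S b n ℕ.≤ m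
  search-least S zero    n m n≤m m∈S = n≤m
  search-least S (suc b) n m n≤m m∈S with S ∋ n in eq
  ... | true  = n≤m
  ... | false with ℕ.m≤n⇒m<n∨m≡n n≤m
  ...   | inj₁ n<m  = search-least S b (suc n) m n<m m∈S
  ...   | inj₂ refl = ⊥-elim (subst T eq m∈S)

a-∈ : ∀ {F} (S : 𝒮 F) k → T (S ∋ a S k)
a-∈     S zero    = 0∈ (semigroup S)
a-∈ {F} S (suc k) = search-∈ S F (suc (a S k)) (ℕ.s≤s (ℕ.m≤n+m F (a S k)))

a-increasing : ∀ {F} (S : 𝒮 F) k → a S k ℕ.< a S (suc k)
a-increasing {F} S k = search-≥ S F (suc (a S k))

a-consecutive : ∀ {F} (S : 𝒮 F) k m → T (S ∋ m) → a S k ℕ.< m → a S (suc k) ℕ.≤ m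
a-consecutive {F} S k m m∈S h = search-least S F (suc (a S k)) m h m∈S

private
  mem : ∀ {F} → Vec Bool (suc F) → ℕ → Bool
  mem {F} v n with n ℕ.<? suc F
  ... | yes n<  = lookup v (fromℕ< n<)
  ... | no  _   = true

  mem-big : ∀ {F} (v : Vec Bool (suc F)) {n} → F ℕ.< n → T (mem v n)
  mem-big {F} v {n} F<n with n ℕ.<? suc F
  ... | yes n< = contradiction F<n (ℕ.≤⇒≯ (ℕ.s≤s⁻¹ n<))
  ... | no  _  = tt

  mem-toℕ : ∀ {F} (v : Vec Bool (suc F)) i → mem v (toℕ i) ≡ lookup v i
  mem-toℕ {F} v i with toℕ i ℕ.<? suc F
  ... | yes i< = cong (lookup v) (Fin.fromℕ<-toℕ i i<)
  ... | no  i≮ = contradiction (Fin.toℕ<n i) i≮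

  mem-tabulate : ∀ {F} (S : 𝒮 F) n → mem (tabulate {n = suc F} (λ i → S ∋ toℕ i)) n ≡ (S ∋ n)
  mem-tabulate {F} S n with n ℕ.<? suc F
  ... | yes n< = trans (Vec.lookup∘tabulate (λ i → S ∋ toℕ i) (fromℕ< n<))
                       (cong (S ∋_) (Fin.toℕ-fromℕ< n<))
  ... | no  n≮ with S ∋ n | big S n (ℕ.≮⇒≥ n≮)
  ...   | true | _ = refl

  Good : ∀ {F} → Vec Bool (suc F) → Set
  Good {F} v = T (mem v 0) × ¬ T (mem v F)
    × (∀ (i j : Fin (suc F)) → T (mem v (toℕ i)) → T (mem v (toℕ j)) → T (mem v (toℕ i ℕ.+ toℕ j)))

  Good? : ∀ {F} (v : Vec Bool (suc F)) → Dec (Good v)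
  Good? {F} v = T? (mem v 0) ×-dec ¬? (T? (mem v F))
    ×-dec Fin.all? (λ i → Fin.all? (λ j →
      T? (mem v (toℕ i)) →-dec (T? (mem v (toℕ j)) →-dec T? (mem v (toℕ i ℕ.+ toℕ j)))))

  closed : ∀ {F} (v : Vec Bool (suc F)) → Good v →
           ∀ m n → T (mem v m) → T (mem v n) → T (mem v (m ℕ.+ n))
  closed {F} v (_ , _ , g) m n m∈ n∈ with F ℕ.<? m | F ℕ.<? n
  ... | yes F<m | _       = mem-big v {m ℕ.+ n} (ℕ.<-≤-trans F<m (ℕ.m≤m+n m n))
  ... | no  _   | yes F<n = mem-big v {m ℕ.+ n} (ℕ.<-≤-trans F<n (ℕ.m≤n+m n m))
  ... | no  F≮m | no F≮n  =
    subst₂ (λ i j → T (mem v (i ℕ.+ j))) (Fin.toℕ-fromℕ< m<) (Fin.toℕ-fromℕ< n<)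
      (g (fromℕ< m<) (fromℕ< n<)
        (subst (T ∘ mem v) (sym (Fin.toℕ-fromℕ< m<)) m∈)
        (subst (T ∘ mem v) (sym (Fin.toℕ-fromℕ< n<)) n∈))
    where
    m< = ℕ.s≤s (ℕ.≮⇒≥ F≮m)
    n< = ℕ.s≤s (ℕ.≮⇒≥ F≮n)

  gap-≤ : ∀ {F} (v : Vec Bool (suc F)) n → ¬ T (mem v n) → n ℕ.≤ F
  gap-≤ v n n∉ = ℕ.≮⇒≥ (λ F<n → n∉ (mem-big v {n} F<n))

  build : ∀ {F} (v : Vec Bool (suc F)) → Good v → 𝒮 F
  build {F} v g = record
    { semigroup = record
      { member      = mem v
      ; 0∈          = proj₁ g
      ; +-closed    = closed v g
      ; finite-gaps = upTo (suc F) , λ n n∉ → ∈-upTo⁺ (ℕ.s≤s (gap-≤ v n n∉))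
      }
    ; isFrobenius = proj₁ (proj₂ g) , gap-≤ v
    }

  collect : ∀ {F} → List (Vec Bool (suc F)) → List (𝒮 F)
  collect []       = []
  collect (v ∷ vs) with Good? v
  ... | yes g = build v g ∷ collect vs
  ... | no  _ = collect vs

  bits : List Bool
  bits = true ∷ false ∷ []

  allVecs : ∀ n → List (Vec Bool n)
  allVecs zero    = [ [] ]
  allVecs (suc n) = cartesianProductWith _∷_ bits (allVecs n)

  ∈-allVecs : ∀ {n} (v : Vec Bool n) → v ∈ allVecs n
  ∈-allVecs []          = here refl
  ∈-allVecs (true  ∷ v) = ∈-cartesianProductWith⁺ _∷_ {xs = bits} {ys = allVecs _} (here refl) (∈-allVecs v)
  ∈-allVecs (false ∷ v) = ∈-cartesianProductWith⁺ _∷_ {xs = bits} {ys = allVecs _} (there (here refl)) (∈-allVecs v)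

  allVecs-unique : ∀ n → Unique (allVecs n)
  allVecs-unique zero    = [] ∷ []
  allVecs-unique (suc n) = cartesianProductWith⁺ _∷_ Vec.∷-injective
    (((λ ()) ∷ []) ∷ [] ∷ []) (allVecs-unique n)

Ω : (F : ℕ) → List (𝒮 F)
Ω F = collect (allVecs (suc F))

module _ (F : ℕ) where
  open Setoid (𝒮-setoid F) using (_≈_)
  open SetoidMembership (𝒮-setoid F) using () renaming (_∈_ to _∈ₛ_)
  open SetoidUnique (𝒮-setoid F) using () renaming (Unique to Uniqueₛ)

  private
    good : ∀ (S : 𝒮 F) (v : Vec Bool (suc F)) → (∀ n → mem v n ≡ (S ∋ n)) → Good v
    good S v e =
        subst T (sym (e 0)) (0∈ (semigroup S))
      , (λ F∈ → proj₁ (isFrobenius S) (subst T {mem v F} (e F) F∈))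
      , λ i j i∈ j∈ → subst T (sym (e (toℕ i ℕ.+ toℕ j)))
          (+-closed (semigroup S) (toℕ i) (toℕ j)
            (subst T {mem v (toℕ i)} (e (toℕ i)) i∈) (subst T {mem v (toℕ j)} (e (toℕ j)) j∈))

    collect-complete : ∀ (S : 𝒮 F) (v : Vec Bool (suc F)) vs → (∀ n → mem v n ≡ (S ∋ n)) → v ∈ vs → S ∈ₛ collect vs
    collect-complete S v (w ∷ vs) e v∈ with Good? w
    collect-complete S v (.v ∷ vs) e (here refl) | yes g = here (λ n → sym (e n))
    collect-complete S v (w ∷ vs)  e (there v∈)  | yes g = there (collect-complete S v vs e v∈)
    collect-complete S v (.v ∷ vs) e (here refl) | no ¬g = contradiction (good S v e) ¬g
    collect-complete S v (w ∷ vs)  e (there v∈)  | no ¬g = collect-complete S v vs e v∈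

    mem-injective : ∀ {v w : Vec Bool (suc F)} → (∀ n → mem v n ≡ mem w n) → v ≡ w
    mem-injective {v} {w} e = begin
      v                     ≡⟨ Vec.tabulate∘lookup v ⟨
      tabulate (lookup v)   ≡⟨ Vec.tabulate-cong (λ i →
                                 trans (sym (mem-toℕ v i)) (trans (e (toℕ i)) (mem-toℕ w i))) ⟩
      tabulate (lookup w)   ≡⟨ Vec.tabulate∘lookup w ⟩
      w                     ∎
      where open ≡-Reasoning

    collect-≉ : ∀ v (g : Good v) ws → All (λ w → ¬ v ≡ w) ws →
                All (λ S → ¬ build v g ≈ S) (collect ws)
    collect-≉ v g []       []         = []
    collect-≉ v g (w ∷ ws) (v≢w ∷ v≢) with Good? w
    ... | yes _ = (v≢w ∘ mem-injective) ∷ collect-≉ v g ws v≢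
    ... | no  _ = collect-≉ v g ws v≢

    collect-unique : ∀ vs → Unique vs → Uniqueₛ (collect vs)
    collect-unique []       []       = []
    collect-unique (v ∷ vs) (v≢ ∷ u) with Good? v
    ... | yes g = collect-≉ v g vs v≢ ∷ collect-unique vs u
    ... | no  _ = collect-unique vs u

  Ω-complete : (S : 𝒮 F) → S ∈ₛ Ω F
  Ω-complete S = collect-complete S _ (allVecs (suc F)) (mem-tabulate S) (∈-allVecs _)

  Ω-unique : Uniqueₛ (Ω F)
  Ω-unique = collect-unique (allVecs (suc F)) (allVecs-unique (suc F))

-- {0} ∪ {F + 1, F + 2, …}
ordinary : (F : ℕ) .{{_ : NonZero F}} → 𝒮 F
ordinary F = record
  { semigroup = record
    { member      = λ n → ⌊ in? n ⌋
    ; 0∈          = tt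
    ; +-closed    = λ m n m∈ n∈ → fromWitness (sum m n (toWitness m∈) (toWitness n∈))
    ; finite-gaps = upTo (suc F) , λ n n∉ → ∈-upTo⁺ (ℕ.s≤s (gap n n∉))
    }
  ; isFrobenius = (λ F∈ → notIn (toWitness F∈)) , gap
  }
  where
  In : ℕ → Set
  In n = n ≡ 0 ⊎ F ℕ.< n
  in? : ∀ n → Dec (In n)
  in? n = (n ℕ.≟ 0) ⊎-dec (F ℕ.<? n)
  sum : ∀ m n → In m → In n → In (m ℕ.+ n)
  sum m n (inj₁ refl) n∈ = n∈
  sum m n (inj₂ F<m)  _  = inj₂ (ℕ.<-≤-trans F<m (ℕ.m≤m+n m n))
  notIn : ¬ In F
  notIn (inj₁ e) = ℕ.≢-nonZero⁻¹ F e
  notIn (inj₂ h) = ℕ.<-irrefl refl h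
  gap : ∀ n → ¬ T ⌊ in? n ⌋ → n ℕ.≤ F
  gap n n∉ = ℕ.≮⇒≥ (λ F<n → n∉ (fromWitness (inj₂ F<n)))

Ω-nonEmpty : (F : ℕ) .{{_ : NonZero F}} → NonZero (length (Ω F))
Ω-nonEmpty F with Ω F | Ω-complete F (ordinary F)
... | _ ∷ _ | _ = _

-- A real α ∈ [0,1] for which ⌊ α (F - 1) ⌋ is known.
record Argument (F : ℕ) : Set where
  field
    α       : ℝ
    0≤α     : 0ℝ ≤ α
    α≤1     : α ≤ 1ℝ
    floor   : ℕ
    isFloor : IsFloor ((F ℕ.∸ 1) · α) floor

open Argument

-- i ranges over α ∈ [0,1]; with t = 1 + ⌊ α (F - 1) ⌋, the value is a_t(S) / F.
Ξₛ : ∀ {F} .{{_ : NonZero F}} → 𝒮 F → Argument F → ℝ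
Ξₛ {F} S i = fromℚ (+ a S (1 ℕ.+ floor i) / F)

-- On {α : ⌊ α (F - 1) ⌋ = n} the function Ξ_S is constant and Ξ is monotone,
-- so the supremum of ∣ Ξ_S - Ξ ∣ is the largest ∣ a_{n+1} / F - Ξ(β) ∣ over the
-- end points β of these intervals, here listed as pairs (n , β).
lowerEnd upperEnd : ℕ → ℕ → ℕ × ℚ
lowerEnd k n = n , + n / suc k
upperEnd k n = n , + suc n / suc k

endPoints : ℕ → List (ℕ × ℚ)
endPoints zero    = (0 , 0ℚ) ∷ (0 , 1ℚ) ∷ []
endPoints (suc k) = map (lowerEnd k) (upTo (suc (suc k))) ++ map (upperEnd k) (upTo (suc k))

private
  lowerEnds-∈ : ∀ k n → n ℕ.≤ suc k → (n , + n / suc k) ∈ endPoints (suc k)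
  lowerEnds-∈ k n n≤ = ∈-++⁺ˡ {xs = map (lowerEnd k) (upTo (suc (suc k)))}
    (∈-map⁺ (lowerEnd k) {x = n} {xs = upTo (suc (suc k))} (∈-upTo⁺ (ℕ.s≤s n≤)))

  upperEnds-∈ : ∀ k n → n ℕ.< suc k → (n , + suc n / suc k) ∈ endPoints (suc k)
  upperEnds-∈ k n n< = ∈-++⁺ʳ (map (lowerEnd k) (upTo (suc (suc k))))
    (∈-map⁺ (upperEnd k) {x = n} {xs = upTo (suc k)} (∈-upTo⁺ n<))

  Between : ℕ → ℝ → ℕ → Set
  Between K x n = ∃[ lo ] ∃[ hi ] (n , lo) ∈ endPoints K × (n , hi) ∈ endPoints K
                × fromℚ lo ≤ x × x ≤ fromℚ hi

  between : ∀ K x n → 0ℝ ≤ x → x ≤ 1ℝ → IsFloor (K · x) n → Between K x n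
  between K x n 0≤x x≤1 (n≤ , <n) = go K n n≤K n≤ <n
    where
    n≤K : n ℕ.≤ K
    n≤K = fromℕ-reflect {n} {K} (subst (fromℕ n ℚ.≤_) (ℚ.*-identityʳ (fromℕ K))
      (fromℚ-reflect {fromℕ n} {fromℕ K * 1ℚ} (≤-trans {fromℚ (fromℕ n)} {K · x} {K · 1ℝ} n≤ (·-mono K {x} {1ℝ} x≤1))))

    go : ∀ K n → n ℕ.≤ K → fromℚ (fromℕ n) ≤ K · x → K · x < fromℚ (fromℕ (suc n)) → Between K x n
    go zero    .zero ℕ.z≤n _ _ = 0ℚ , 1ℚ , here refl , there (here refl) , 0≤x , x≤1
    go (suc k) n n≤K n≤ <n with ℕ.m≤n⇒m<n∨m≡n n≤K
    ... | inj₁ n<K = + n / suc k , + suc n / suc k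
        , lowerEnds-∈ k n n≤K
        , upperEnds-∈ k n n<K
        , lower , ·-cancel k {x} {fromℚ (+ suc n / suc k)}
            (≤-trans {suc k · x} {fromℚ (fromℕ (suc n))} {suc k · fromℚ (+ suc n / suc k)}
              (<⇒≤ {suc k · x} {fromℚ (fromℕ (suc n))} <n)
              (fromℚ-≤ (ℚ.≤-reflexive (sym (*-/ k (suc n))))))
      where
      lower = ·-cancel k {fromℚ (+ n / suc k)} {x}
        (≤-trans {suc k · fromℚ (+ n / suc k)} {fromℚ (fromℕ n)} {suc k · x}
          (fromℚ-≤ (ℚ.≤-reflexive (*-/ k n))) n≤)
    ... | inj₂ refl = + n / n , + n / n , mid , mid
        , ·-cancel k {fromℚ (+ n / n)} {x}
            (≤-trans {n · fromℚ (+ n / n)} {fromℚ (fromℕ n)} {n · x}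
              (fromℚ-≤ (ℚ.≤-reflexive (*-/ k n))) n≤)
        , ≤-trans {x} {1ℝ} {fromℚ (+ n / n)} x≤1
            (·-cancel k {1ℝ} {fromℚ (+ n / n)}
              (fromℚ-≤ (ℚ.≤-reflexive (trans (ℚ.*-identityʳ (fromℕ n)) (sym (*-/ k n))))))
      where
      mid = lowerEnds-∈ k n ℕ.≤-refl

  Limit : ℕ → ℕ × ℚ → Set
  Limit K (n , β) = ∀ η → 0ℚ ℚ.< η → ∃[ p ] 0ℚ ℚ.≤ p × p ℚ.≤ 1ℚ
    × fromℕ n ℚ.≤ fromℕ K * p × fromℕ K * p ℚ.< fromℕ (suc n)
    × p ℚ.≤ β + η × β ℚ.≤ p + η

  fromℕ-< : ∀ n → fromℕ n ℚ.< fromℕ (suc n)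
  fromℕ-< n = ℚ.≰⇒> (λ h → ℕ.1+n≰n (fromℕ-reflect {suc n} {n} h))

  ≤+ : ∀ p {η} → 0ℚ ℚ.< η → p ℚ.≤ p + η
  ≤+ p {η} 0<η = subst (ℚ._≤ p + η) (ℚ.+-identityʳ p) (ℚ.+-monoʳ-≤ p (ℚ.<⇒≤ 0<η))

  unit : ∀ k n p → n ℕ.≤ suc k → fromℕ n ℚ.≤ fromℕ (suc k) * p →
         fromℕ (suc k) * p ℚ.≤ fromℕ (suc k) → 0ℚ ℚ.≤ p × p ℚ.≤ 1ℚ
  unit k n p n≤ h h′ =
      ℚ.*-cancelˡ-≤-pos (fromℕ (suc k)) {{fromℕ-pos k}}
        (subst (ℚ._≤ fromℕ (suc k) * p) (sym (ℚ.*-zeroʳ (fromℕ (suc k))))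
          (ℚ.≤-trans (fromℕ-mono {0} {n} ℕ.z≤n) h))
    , ℚ.*-cancelˡ-≤-pos (fromℕ (suc k)) {{fromℕ-pos k}}
        (subst (fromℕ (suc k) * p ℚ.≤_) (sym (ℚ.*-identityʳ (fromℕ (suc k)))) h′)

  ⊓-pos : ∀ p q → 0ℚ ℚ.< p → 0ℚ ℚ.< q → 0ℚ ℚ.< p ℚ.⊓ q
  ⊓-pos p q 0<p 0<q with ℚ.⊓-sel p q
  ... | inj₁ e = subst (0ℚ ℚ.<_) (sym e) 0<p
  ... | inj₂ e = subst (0ℚ ℚ.<_) (sym e) 0<q

  left-limit : ∀ k n → n ℕ.≤ suc k → Limit (suc k) (n , + n / suc k)
  left-limit k n n≤ η 0<η =
    let e     = *-/ k n
        h     = ℚ.≤-reflexive (sym e)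
        0≤ , ≤1 = unit k n (+ n / suc k) n≤ h (subst (ℚ._≤ fromℕ (suc k)) (sym e) (fromℕ-mono {n} {suc k} n≤))
    in + n / suc k , 0≤ , ≤1 , h
     , subst (ℚ._< fromℕ (suc n)) (sym e) (fromℕ-< n)
     , ≤+ (+ n / suc k) 0<η , ≤+ (+ n / suc k) 0<η

  right-limit : ∀ k n → n ℕ.< suc k → Limit (suc k) (n , + suc n / suc k)
  right-limit k n n< η 0<η = p , proj₁ 0≤p≤1 , proj₂ 0≤p≤1 , n≤Kp , Kp<n+1
    , comb (ℚ.<⇒≤ 0<μ ⊕ ℚ.<⇒≤ 0<η)
        (solve 3 (λ β μ η → (β :- μ) :+ (μ :+ η) := (β :+ η) :+ (con 0ℚ :+ con 0ℚ)) refl β μ η)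
    , comb (ℚ.p⊓q≤p η w)
        (solve 3 (λ β μ η → β :+ η := ((β :- μ) :+ η) :+ μ) refl β μ η)
    where
    K = fromℕ (suc k)
    β = + suc n / suc k
    w = + 1 / suc k
    μ = η ℚ.⊓ w
    p = β - μ
    instance
      K-pos : ℚ.Positive K
      K-pos = fromℕ-pos k
      K-nonNeg : ℚ.NonNegative K
      K-nonNeg = fromℕ-nonNeg (suc k)
    0<μ : 0ℚ ℚ.< μ
    0<μ = ⊓-pos η w 0<η (ℚ.positive⁻¹ w {{ℚ.normalize-pos 1 (suc k)}})
    Kμ≤1 : K * μ ℚ.≤ 1ℚ
    Kμ≤1 = subst (K * μ ℚ.≤_) (*-/ k 1) (ℚ.*-monoˡ-≤-nonNeg K (ℚ.p⊓q≤q η w))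
    Kp : K * p ≡ fromℕ (suc n) - K * μ
    Kp = trans (solve 3 (λ K β μ → K :* (β :- μ) := K :* β :- K :* μ) refl K β μ)
               (cong (_- K * μ) (*-/ k (suc n)))
    n≤Kp : fromℕ n ℚ.≤ K * p
    n≤Kp = subst (fromℕ n ℚ.≤_) (sym Kp) (comb Kμ≤1
      (trans (sym (fromℕ-suc n))
        (solve 2 (λ a b → a := (a :- b) :+ b) refl (fromℕ (suc n)) (K * μ))))
    Kp<n+1 : K * p ℚ.< fromℕ (suc n)
    Kp<n+1 = subst₂ ℚ._<_ (sym Kp) (ℚ.+-identityʳ (fromℕ (suc n)))
      (ℚ.+-monoʳ-< (fromℕ (suc n)) (ℚ.neg-antimono-<
        (subst (ℚ._< K * μ) (ℚ.*-zeroʳ K) (ℚ.*-monoʳ-<-pos K 0<μ))))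
    0≤p≤1 : 0ℚ ℚ.≤ p × p ℚ.≤ 1ℚ
    0≤p≤1 = unit k n p (ℕ.<⇒≤ n<) n≤Kp
      (ℚ.≤-trans (ℚ.<⇒≤ Kp<n+1) (fromℕ-mono {suc n} {suc k} n<))

  limit₀ : ∀ β → 0ℚ ℚ.≤ β → β ℚ.≤ 1ℚ → Limit 0 (0 , β)
  limit₀ β 0≤β β≤1 η 0<η = β , 0≤β , β≤1
    , ℚ.≤-reflexive (sym (ℚ.*-zeroˡ β))
    , subst (ℚ._< 1ℚ) (sym (ℚ.*-zeroˡ β)) (fromℕ-< 0)
    , ≤+ β 0<η , ≤+ β 0<η

  limits : ∀ K nβ → nβ ∈ endPoints K → Limit K nβ
  limits zero _ (here refl) = limit₀ 0ℚ ℚ.≤-refl (ℚ.<⇒≤ (fromℕ-< 0))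
  limits zero _ (there (here refl)) = limit₀ 1ℚ (ℚ.<⇒≤ (fromℕ-< 0)) ℚ.≤-refl
  limits (suc k) nβ ∈e with ∈-++⁻ (map (lowerEnd k) (upTo (suc (suc k)))) ∈e
  ... | inj₁ h with ∈-map⁻ (lowerEnd k) h
  ...   | n , n∈ , refl = left-limit k n (ℕ.s≤s⁻¹ (∈-upTo⁻ n∈))
  limits (suc k) nβ ∈e | inj₂ h with ∈-map⁻ (upperEnd k) h
  ...   | n , n∈ , refl = right-limit k n (∈-upTo⁻ n∈)

  endPoint₀ : ∀ K → (0 , 0ℚ) ∈ endPoints K
  endPoint₀ zero    = here refl
  endPoint₀ (suc k) = here (cong (0 ,_) (sym (ℚ.0/n≡0 (suc k))))

  ξ-dist : ∀ c lo hi p s η → 0ℚ ℚ.≤ η → lo ℚ.≤ p + η → p ℚ.≤ hi + η →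
           ℚ.∣ c - ξ lo ∣ ℚ.≤ s → ℚ.∣ c - ξ hi ∣ ℚ.≤ s → ℚ.∣ c - ξ p ∣ ℚ.≤ s + (η + η)
  ξ-dist c lo hi p s η 0≤η lo≤ ≤hi ≤lo hi≤ = ∣∣-bound
    (comb (ℚ.≤-trans (x≤∣x∣ _) ≤lo ⊕ ξ-≤ lo p η 0≤η lo≤)
      (solve 5 (λ c x y s η → (c :- y) :+ (s :+ (y :+ (η :+ η))) := (s :+ (η :+ η)) :+ ((c :- x) :+ x))
        refl c (ξ lo) (ξ p) s η))
    (comb (ℚ.≤-trans (-x≤∣x∣ _) hi≤ ⊕ ξ-≤ p hi η 0≤η ≤hi)
      (solve 5 (λ c x y s η → (:- (c :- y)) :+ (s :+ (x :+ (η :+ η))) := (s :+ (η :+ η)) :+ ((:- (c :- x)) :+ y))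
        refl c (ξ hi) (ξ p) s η))

module _ {F : ℕ} .{{_ : NonZero F}} (S : 𝒮 F) where

  private
    distance : ℕ × ℚ → ℚ
    distance (n , β) = ℚ.∣ + a S (1 ℕ.+ n) / F - ξ β ∣

    best : ℕ × ℚ
    best = argmax distance (0 , 0ℚ) (endPoints (F ℕ.∸ 1))

    best-∈ : best ∈ endPoints (F ℕ.∸ 1)
    best-∈ = argmax-all distance {P = _∈ endPoints (F ℕ.∸ 1)} (endPoint₀ (F ℕ.∸ 1)) (All.tabulate id)

    ≤best : ∀ nβ → nβ ∈ endPoints (F ℕ.∸ 1) → distance nβ ℚ.≤ distance best
    ≤best nβ = All.lookup {P = λ x → distance x ℚ.≤ distance best} (f[xs]≤f[argmax] (0 , 0ℚ) (endPoints (F ℕ.∸ 1)))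

  sup∣Ξₛ-Ξ∣ : ℝ
  sup∣Ξₛ-Ξ∣ = fromℚ (distance best)

  sup∣Ξₛ-Ξ∣-isSupremum : IsSupremum (λ i → ∣ Ξₛ S i -ℝ Ξ (α i) ∣) sup∣Ξₛ-Ξ∣
  sup∣Ξₛ-Ξ∣-isSupremum = upper , approached
    where
    upper : ∀ i → ∣ Ξₛ S i -ℝ Ξ (α i) ∣ ≤ sup∣Ξₛ-Ξ∣
    upper i η 0<η =
      let lo , hi , lo∈ , hi∈ , lo≤ , ≤hi =
            between (F ℕ.∸ 1) (α i) (floor i) (0≤α i) (α≤1 i) (isFloor i)
          M , h = lo≤ (½ * η) (½-pos 0<η)
          N , k = ≤hi (½ * η) (½-pos 0<η)
      in M ℕ.⊔ N , λ n ≤n →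
        subst (λ t → ℚ.∣ + a S (1 ℕ.+ floor i) / F - ξ (seq (α i) n) ∣ ℚ.≤ distance best + t) (halves η)
          (ξ-dist (+ a S (1 ℕ.+ floor i) / F) lo hi (seq (α i) n) (distance best) (½ * η)
            (ℚ.<⇒≤ (½-pos 0<η)) (h n (⊔ˡ ≤n)) (k n (⊔ʳ {M} ≤n)) (≤best (_ , lo) lo∈) (≤best (_ , hi) hi∈))

    approached : ∀ r → r < sup∣Ξₛ-Ξ∣ → ∃[ i ] r < ∣ Ξₛ S i -ℝ Ξ (α i) ∣
    approached r (η , 0<η , N , h) =
      let n , β = best
          μ     = ½ * (½ * η)
          0<μ   = ½-pos (½-pos 0<η)
          p , 0≤p , p≤1 , n≤ , <n , p≤β , β≤p = limits (F ℕ.∸ 1) best best-∈ μ 0<μ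
          cₙ    = + a S (1 ℕ.+ n) / F
          i     = record
            { α = fromℚ p ; 0≤α = fromℚ-≤ 0≤p ; α≤1 = fromℚ-≤ p≤1
            ; floor = n ; isFloor = fromℚ-≤ n≤ , fromℚ-< <n }
          d     = ξ-dist cₙ p p β (ℚ.∣ cₙ - ξ p ∣) μ (ℚ.<⇒≤ 0<μ) p≤β β≤p ℚ.≤-refl ℚ.≤-refl
      in i , ½ * η , ½-pos 0<η , N , λ m ≤m →
        comb (h m ≤m ⊕ d)
          (solve 4 (λ r s v η → (r :+ con ½ :* η) :+ (s :+ (v :+ (con ½ :* (con ½ :* η) :+ con ½ :* (con ½ :* η))))
             := v :+ ((r :+ η) :+ s)) refl (seq r m) (distance best) (ℚ.∣ cₙ - ξ p ∣) η)

ℙ : ∀ {F} .{{_ : NonZero F}} {E : Pred (𝒮 F) 0ℓ} → Decidable E → ℚ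
ℙ {F} E? = _/_ (+ length (filter E? (Ω F))) (length (Ω F)) {{Ω-nonEmpty F}}

-- An event defined by a strict inequality between reals is not decidable, so
-- its probability is bounded through decidable events containing it; for a
-- decidable event E this says ℙ E < δ.
ℙ[_]<_ : ∀ {F} .{{_ : NonZero F}} → Pred (𝒮 F) 0ℓ → ℝ → Set₁
ℙ[_]<_ {F} E δ = Σ (Pred (𝒮 F) 0ℓ) λ D → Σ (Decidable D) λ D? →
                 E ⊆ D × fromℚ (ℙ D?) < δ

{-# OPTIONS --safe #-}
module Submission where

-- All subsets of (F / 2, F) extend to members of 𝒮 F, so ∣ 𝒮 F ∣ is at least
-- about 2 ^ (F / 2), and an event is negligible once it contains at most
-- q ^ F 2 ^ (F / 2) semigroups for some q < 1, up to a polynomial factor.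
--
-- Let m be the least positive element of S.  As S is closed under + m and
-- misses F, each class r modulo m meets [0, F] in a final segment, and the
-- segments of r and F - r together take at most 2 ^ L values, where L is the
-- number of elements of a class; so at most about 2 ^ (F / 2) semigroups
-- contain m.  Exponentially fewer do if L ≥ 4 for many classes.  If
-- L = 3 a second element n = m + d gains a factor by tying the class r to the
-- class r + d.  This leaves the semigroups whose elements below F / 2 lie in
-- two short windows, one at m and one at F / 2; they are negligible unless
-- m is close to F / 2, because S is closed under + m above F / 2 as well.
-- In the remaining case S has few possible parts below F / 2, and by a
-- Chernoff bound it contains about half of each interval [F / 2, x] with x ≤ F,
-- except in exponentially few cases.  Such an S has its j-th element near
-- min (F / 2 + 2 j , 3 F / 4 + j) = F Ξ(j / F).

-- A pair of classes of `L` members admits `(L + 1) (L + 2) / 2` patterns, and this is at most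
-- `2 ^ L` only from `L = 4` on: for `L = 3` it is 10 against 8, for `L = 2` it is 6 against 4. In
-- these two cases the bound depends on `m` being the least positive element, which leaves the
-- bottom of every class empty. For `L ≥ 4` any element will do, so an element too small to give an
-- exponential saving can be doubled until it is of order `F`.
--
-- All savings are measured in one unit: a factor `(k / (k + 1)) ^ w` on the square of a count, with
-- `w` proportional to `F`. Squares avoid half-integral powers of 2. The other savings, such as 15
-- in 16, are weakened to this unit, whence `15 ≤ k`. A window whose width is a fixed multiple of
-- `w` can be left entirely free, provided that some other saving pays for its bits.

module _ where

  open import Data.Bool.Base using (Bool; true; false; T; not; _∧_; _∨_)
  open import Data.Bool.Properties using (T?; T-∧)
  open import Data.Empty using (⊥-elim)
  open import Data.Fin.Base using (Fin; zero; suc; combine; join; splitAt; inject≤)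
  import Data.Fin.Properties as Fin
  open import Data.List.Base as List using (List; []; _∷_; _++_; length; map; filter; cartesianProductWith)
  open import Data.List.Membership.Propositional using (_∈_)
  open import Data.List.Membership.Propositional.Properties using (∈-filter⁺; ∈-cartesianProductWith⁺)
  open import Data.List.Properties using (map-++)
  open import Data.List.Relation.Unary.Any as Any using (here; there)
  open import Data.List.Relation.Unary.Any.Properties using (lookup-index)
  open import Data.Nat.Base hiding (_/_; _%_)
  open import Data.Nat.DivMod using (_/_; _%_; m%n<n; m≡m%n+[m/n]*n; /-monoˡ-≤; m*n/n≡m)
  open import Data.Nat.ListAction using (sum)
  open import Data.Nat.ListAction.Properties using (sum-++)
  open import Data.Nat.Properties
  open import Data.Nat.Tactic.RingSolver using (solve)
  open import Data.Product.Base using (∃-syntax; _×_; _,_; proj₁; proj₂)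
  open import Data.Sum.Base using (_⊎_; inj₁; inj₂)
  open import Data.Unit.Base using (tt)
  open import Data.Vec.Base as Vec using (Vec)
  import Data.Vec.Membership.Propositional as Vec
  import Data.Vec.Membership.Propositional.Properties as Vec
  open import Data.Vec.Properties using (∷-injective)
  import Data.Vec.Relation.Unary.Any as VecAny
  open import Function.Base using (_∘_; id)
  open import Function.Bundles using (Equivalence)
  open import Level using (0ℓ)
  open import Relation.Binary.Definitions using (tri<; tri≈; tri>)
  open import Relation.Binary.PropositionalEquality hiding (J)
  open import Relation.Nullary using (¬_; Dec; yes; no; contradiction; _×-dec_)
  open import Relation.Unary using (Pred; Decidable; _⊆_; _∪_)

  -- Injective numberings of restrictions

  Subset : Set
  Subset = ℕ → Bool

  -- At most k restrictions to D of subsets satisfying P, in the form of an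
  -- injective numbering.
  record Code (D : Pred ℕ 0ℓ) (P : Pred Subset 0ℓ) (k : ℕ) : Set where
    field
      code      : ∀ {s} → P s → Fin k
      injective : ∀ {s s′} (p : P s) (p′ : P s′) → code p ≡ code p′ → ∀ {x} → D x → s x ≡ s′ x

  open Code

  Code-mono : ∀ {D D′ P P′ k k′} → D′ ⊆ D → P′ ⊆ P → k ≤ k′ → Code D P k → Code D′ P′ k′
  Code-mono D′⊆D P′⊆P k≤k′ c = record
    { code      = λ p → inject≤ (code c (P′⊆P p)) k≤k′
    ; injective = λ p p′ e d →
        injective c (P′⊆P p) (P′⊆P p′) (Fin.inject≤-injective k≤k′ k≤k′ _ _ e) (D′⊆D d)
    }

  Code-⊆ : ∀ {D D′ P k} → D′ ⊆ D → Code D P k → Code D′ P k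
  Code-⊆ D′⊆D = Code-mono D′⊆D id ≤-refl

  Code-≤ : ∀ {D P k k′} → k ≤ k′ → Code D P k → Code D P k′
  Code-≤ = Code-mono id id

  Code-P : ∀ {D P P′ k} → P′ ⊆ P → Code D P k → Code D P′ k
  Code-P P′⊆P = Code-mono id P′⊆P ≤-refl

  Code-known : ∀ {D P} → (∀ {s s′} → P s → P s′ → ∀ {x} → D x → s x ≡ s′ x) → Code D P 1
  Code-known h = record { code = λ _ → zero ; injective = λ p p′ _ → h p p′ }

  T⇒≡ : ∀ {a b} → T a → T b → a ≡ b
  T⇒≡ {true} {true} _ _ = refl

  ¬T⇒≡ : ∀ {a b} → ¬ T a → ¬ T b → a ≡ b
  ¬T⇒≡ {false} {false} _ _ = refl
  ¬T⇒≡ {true}          ¬a _  = ⊥-elim (¬a tt)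
  ¬T⇒≡ {false} {true}  _ ¬b  = ⊥-elim (¬b tt)

  Code-full : ∀ {D P} → (∀ {s} → P s → ∀ {x} → D x → T (s x)) → Code D P 1
  Code-full h = Code-known (λ p p′ d → T⇒≡ (h p d) (h p′ d))

  Code-empty : ∀ {D P} → (∀ {s} → P s → ∀ {x} → D x → ¬ T (s x)) → Code D P 1
  Code-empty h = Code-known (λ p p′ d → ¬T⇒≡ (h p d) (h p′ d))

  Code-× : ∀ {D E P k l} → Code D P k → Code E P l → Code (D ∪ E) P (k * l)
  Code-× {D} {E} {P} c c′ = record
    { code      = λ p → combine (code c p) (code c′ p)
    ; injective = agree
    }
    where
    agree : ∀ {s s′} (p : P s) (p′ : P s′) →
            combine (code c p) (code c′ p) ≡ combine (code c p′) (code c′ p′) →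
            ∀ {x} → (D ∪ E) x → s x ≡ s′ x
    agree p p′ e (inj₁ d) = injective c  p p′ (Fin.combine-injectiveˡ _ (code c′ p) _ (code c′ p′) e) d
    agree p p′ e (inj₂ d) = injective c′ p p′ (Fin.combine-injectiveʳ (code c p) _ (code c p′) _ e) d

  -- The number is read off from the given proof and not from the subset, so neither predicate has
  -- to be decidable. A subset satisfying both may receive two numbers, which does no harm: only
  -- equal numbers have to force equal restrictions.
  Code-⊎ : ∀ {D P Q k l} → Code D P k → Code D Q l → Code D (P ∪ Q) (k + l)
  Code-⊎ {D} {P} {Q} {k} {l} c c′ = record
    { code      = λ p → join k l (choose p)
    ; injective = λ p p′ e → agree p p′
        (trans (sym (Fin.splitAt-join k l (choose p)))
          (trans (cong (splitAt k) e) (Fin.splitAt-join k l (choose p′))))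
    }
    where
    choose : ∀ {s} → (P ∪ Q) s → Fin k ⊎ Fin l
    choose (inj₁ p) = inj₁ (code c p)
    choose (inj₂ q) = inj₂ (code c′ q)
    inj₁⁻ : {i j : Fin k} → inj₁ {B = Fin l} i ≡ inj₁ j → i ≡ j
    inj₁⁻ refl = refl
    inj₂⁻ : {i j : Fin l} → inj₂ {A = Fin k} i ≡ inj₂ j → i ≡ j
    inj₂⁻ refl = refl
    agree : ∀ {s s′} (p : (P ∪ Q) s) (p′ : (P ∪ Q) s′) → choose p ≡ choose p′ →
            ∀ {x} → D x → s x ≡ s′ x
    agree (inj₁ p) (inj₁ p′) e = injective c  p p′ (inj₁⁻ e)
    agree (inj₂ q) (inj₂ q′) e = injective c′ q q′ (inj₂⁻ e)

  Code-if : ∀ {D P k l} x → Code D (λ s → P s × T (s x)) k → Code D (λ s → P s × ¬ T (s x)) l →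
            Code D P (k + l)
  Code-if {P = P} x c c′ = Code-P decide (Code-⊎ c c′)
    where
    decide : P ⊆ (λ s → P s × T (s x)) ∪ (λ s → P s × ¬ T (s x))
    decide {s} p with T? (s x)
    ... | yes t = inj₁ (p , t)
    ... | no ¬t = inj₂ (p , ¬t)

  ⋃ : ℕ → (ℕ → Pred ℕ 0ℓ) → Pred ℕ 0ℓ
  ⋃ n D x = ∃[ i ] i < n × D i x

  Code-^ : ∀ {D : ℕ → Pred ℕ 0ℓ} {P k} n → (∀ i → i < n → Code (D i) P k) → Code (⋃ n D) P (k ^ n)
  Code-^ zero    c = Code-known (λ _ _ ())
  Code-^ {D} (suc n) c =
    Code-⊆ split (Code-× (c 0 (s≤s z≤n)) (Code-^ n (λ i i<n → c (suc i) (s≤s i<n))))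
    where
    split : ⋃ (suc n) D ⊆ D 0 ∪ ⋃ n (D ∘ suc)
    split (zero  , _       , d) = inj₁ d
    split (suc i , s≤s i<n , d) = inj₂ (i , i<n , d)

  Code-free : ∀ {P} x → Code (_≡ x) P 2
  Code-free x = Code-if x (Code-full (λ where (_ , t) refl → t)) (Code-empty (λ where (_ , ¬t) refl → ¬t))

  Interval : ℕ → ℕ → Pred ℕ 0ℓ
  Interval a n = ⋃ n (λ i x → x ≡ a + i)

  ∈-Interval : ∀ {a n x} → a ≤ x → x < a + n → Interval a n x
  ∈-Interval {a} {n} {x} a≤x x< = x ∸ a
    , +-cancelˡ-< a (x ∸ a) n (subst (_< a + n) (sym (m+[n∸m]≡n a≤x)) x<)
    , sym (m+[n∸m]≡n a≤x)

  Code-interval : ∀ {P} a n → Code (Interval a n) P (2 ^ n)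
  Code-interval a n = Code-^ n (λ i _ → Code-free (a + i))

  Code-table : ∀ {P n} (xs : Vec ℕ n) (table : List (Vec Bool n)) →
               (∀ {s} → P s → Vec.map s xs ∈ table) → Code (Vec._∈ xs) P (length table)
  Code-table {P} xs table h = record
    { code      = λ p → Any.index (h p)
    ; injective = λ p p′ e → same xs
        (trans (lookup-index (h p)) (trans (cong (List.lookup table) e) (sym (lookup-index (h p′)))))
    }
    where
    same : ∀ {s s′ : Subset} {m} (ys : Vec ℕ m) → Vec.map s ys ≡ Vec.map s′ ys → ∀ {x} → x Vec.∈ ys → s x ≡ s′ x
    same (y Vec.∷ ys) e (VecAny.here refl) = proj₁ (∷-injective e)
    same (y Vec.∷ ys) e (VecAny.there x∈)  = same ys (proj₂ (∷-injective e)) x∈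

  words : ∀ n → List (Vec Bool n)
  words zero    = Vec.[] ∷ []
  words (suc n) = cartesianProductWith Vec._∷_ (true ∷ false ∷ []) (words n)

  ∈-words : ∀ {n} (v : Vec Bool n) → v ∈ words n
  ∈-words Vec.[]          = here refl
  ∈-words (true  Vec.∷ v) =
    ∈-cartesianProductWith⁺ Vec._∷_ {xs = true ∷ false ∷ []} {ys = words _} (here refl) (∈-words v)
  ∈-words (false Vec.∷ v) =
    ∈-cartesianProductWith⁺ Vec._∷_ {xs = true ∷ false ∷ []} {ys = words _} (there (here refl)) (∈-words v)

  -- For a fixed `n` and a concrete `ok` the length of the filtered list evaluates, so that the
  -- counts 8 and 58 below are obtained by computation.
  Code-filter : ∀ {P n} (xs : Vec ℕ n) (ok : Vec Bool n → Bool) → (∀ {s} → P s → T (ok (Vec.map s xs))) →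
                Code (Vec._∈ xs) P (length (filter (T? ∘ ok) (words n)))
  Code-filter xs ok h = Code-table xs (filter (T? ∘ ok) (words _))
    (λ {s} p → ∈-filter⁺ (T? ∘ ok) (∈-words (Vec.map s xs)) (h p))

  -- Classes modulo an element m, paired by x ↦ F - x

  -- Linear arithmetic: x ≤ y follows from hypotheses adding up to p ≤ q once
  -- x + q + k ≡ y + p, which is left to the ring solver.
  linear : ∀ {p q x y} k → p ≤ q → x + q + k ≡ y + p → x ≤ y
  linear {p} {q} {x} {y} k p≤q e = +-cancelʳ-≤ p x y
    (≤-trans (+-monoʳ-≤ x p≤q) (≤-trans (m≤m+n (x + q) k) (≤-reflexive e)))

  infixl 6 _⊞_
  _⊞_ : ∀ {p q r s} → p ≤ q → r ≤ s → p + r ≤ q + s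
  _⊞_ = +-mono-≤

  scale : ∀ c {a b} → a ≤ b → c * a ≤ c * b
  scale c = *-monoʳ-≤ c

  record Semigroup (F : ℕ) (s : Subset) : Set where
    field
      0∈     : T (s 0)
      closed : ∀ x y → T (s x) → T (s y) → T (s (x + y))
      F∉     : ¬ T (s F)

    multiples : ∀ i m → T (s m) → T (s (i * m))
    multiples zero    m m∈ = 0∈
    multiples (suc i) m m∈ = closed m (i * m) m∈ (multiples i m m∈)

    shift : ∀ i m {x} → T (s m) → T (s x) → T (s (x + i * m))
    shift i m m∈ x∈ = closed _ _ x∈ (multiples i m m∈)

    exclude : ∀ x y → x + y ≡ F → T (s x) → ¬ T (s y)
    exclude x y e x∈ y∈ = F∉ (subst (T ∘ s) e (closed x y x∈ y∈))

  open Semigroup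

  Chain : ℕ → ℕ → ℕ → Pred ℕ 0ℓ
  Chain m r L = ⋃ L (λ i x → x ≡ r + i * m)

  Chains : ℕ → ℕ → ℕ → ℕ → Pred ℕ 0ℓ
  Chains m r r′ L = Chain m r L ∪ Chain m r′ L

  Chain-split : ∀ {m r L} → Chain m r (suc L) ⊆ (_≡ r) ∪ Chain m (r + m) L
  Chain-split {m} {r} (zero  , _ , refl)     = inj₁ (+-identityʳ r)
  Chain-split {m} {r} (suc i , s≤s i< , refl) = inj₂ (i , i< , sym (+-assoc r m (i * m)))

  -- pairCount L = (L + 1) (L + 2) / 2
  pairCount : ℕ → ℕ
  pairCount zero    = 1
  pairCount (suc L) = 1 + (pairCount L + suc L)

  module _ {F m : ℕ} {P : Pred Subset 0ℓ} (P-semigroup : P ⊆ Semigroup F) (P-m : ∀ {s} → P s → T (s m)) where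

    -- Since adding `m` does not leave the semigroup, it meets a chain in a final segment, and this
    -- is determined by its length, between 0 and `L`.
    Code-chain : ∀ {Q} L r → Q ⊆ P → Code (Chain m r L) Q (suc L)
    Code-chain zero    r Q⊆P = Code-known λ where _ _ (_ , () , _)
    Code-chain (suc L) r Q⊆P = Code-≤ (≤-reflexive (cong suc (*-identityˡ (suc L))))
      (Code-if r
        (Code-full λ where (q , r∈) (i , _ , refl) → shift (P-semigroup (Q⊆P q)) i m (P-m (Q⊆P q)) r∈)
        (Code-⊆ Chain-split
          (Code-× (Code-empty λ where (_ , r∉) refl → r∉)
                  (Code-chain L (r + m) (Q⊆P ∘ proj₁)))))

    -- The chain of r′ consists of the numbers F - x for x in the chain of r.
    Code-chains : ∀ {Q} L r r′ → Q ⊆ P → r + r′ + L * m ≡ F + m → Code (Chains m r r′ L) Q (pairCount L)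
    Code-chains zero    r r′ Q⊆P e = Code-known λ where
      _ _ (inj₁ (_ , () , _))
      _ _ (inj₂ (_ , () , _))
    Code-chains {Q} (suc L) r r′ Q⊆P e = Code-≤ (≤-reflexive (cong suc (cong₂ _+_ (*-identityˡ _) (*-identityˡ (suc L)))))
      (Code-if r
        (Code-known (λ p p′ → λ where
          (inj₁ d) → T⇒≡ (chain p d) (chain p′ d)
          (inj₂ d) → ¬T⇒≡ (chain′ p d) (chain′ p′ d)))
        -- `r′ + L * m` is `F - r`, the top of the second chain. If it is present, one number is
        -- settled at either end and a shorter pair of chains remains; if it is absent, so is the
        -- whole second chain, and the first one is left without constraint from it.
        (Code-if (r′ + L * m)
          (Code-⊆ grow
            (Code-× (Code-known λ where
                      ((_ , r∉) , t) ((_ , r∉′) , t′) (inj₁ refl) → ¬T⇒≡ r∉ r∉′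
                      ((_ , r∉) , t) ((_ , r∉′) , t′) (inj₂ refl) → T⇒≡ t t′)
                    (Code-chains L (r + m) r′ (Q⊆P ∘ proj₁ ∘ proj₁) e′)))
          (Code-⊆ grow′
            (Code-× (Code-empty λ where
                      ((_ , r∉) , t) (inj₁ refl) → r∉
                      ((q , _) , t) (inj₂ (i , s≤s i≤L , refl)) r′∈ → t (reach q i≤L r′∈))
                    (Code-chain L (r + m) (Q⊆P ∘ proj₁ ∘ proj₁))))))
      where
      e₀ : r + r′ + L * m ≡ F
      e₀ = +-cancelʳ-≡ m _ F (trans (trans (+-assoc (r + r′) (L * m) m) (cong (r + r′ +_) (+-comm (L * m) m))) e)
      e′ : r + m + r′ + L * m ≡ F + m
      e′ = trans (trans (cong (_+ L * m) (trans (+-assoc r m r′) (trans (cong (r +_) (+-comm m r′)) (sym (+-assoc r r′ m)))))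
             (+-assoc (r + r′) m (L * m))) e
      fill : ∀ i L → i ≤ L → ∀ x → x + i * m + (L ∸ i) * m ≡ x + L * m
      fill i L i≤L x = trans (+-assoc x _ _) (cong (x +_) (trans (sym (*-distribʳ-+ m i (L ∸ i))) (cong (_* m) (m+[n∸m]≡n i≤L))))
      chain : ∀ {s} → Q s × T (s r) → ∀ {x} → Chain m r (suc L) x → T (s x)
      chain (q , r∈) (i , _ , refl) = shift (P-semigroup (Q⊆P q)) i m (P-m (Q⊆P q)) r∈
      chain′ : ∀ {s} → Q s × T (s r) → ∀ {x} → Chain m r′ (suc L) x → ¬ T (s x)
      chain′ p@(q , r∈) (i , s≤s i≤L , refl) =
        exclude (P-semigroup (Q⊆P q)) (r + (L ∸ i) * m) (r′ + i * m)
          (trans (trans (trans (+-assoc r _ _) (cong (r +_) (trans (+-comm ((L ∸ i) * m) _) (fill i L i≤L r′)))) (sym (+-assoc r r′ _))) e₀)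
          (chain p (L ∸ i , s≤s (m∸n≤m L i) , refl))
      reach : ∀ {s i} → Q s → i ≤ L → T (s (r′ + i * m)) → T (s (r′ + L * m))
      reach {s} {i} q i≤L r′∈ =
        subst (T ∘ s) (fill i L i≤L r′) (shift (P-semigroup (Q⊆P q)) (L ∸ i) m (P-m (Q⊆P q)) r′∈)
      grow : Chains m r r′ (suc L) ⊆ ((_≡ r) ∪ (_≡ r′ + L * m)) ∪ Chains m (r + m) r′ L
      grow (inj₁ d) with Chain-split d
      ... | inj₁ e = inj₁ (inj₁ e)
      ... | inj₂ d = inj₂ (inj₁ d)
      grow (inj₂ (i , s≤s i≤L , e)) with m≤n⇒m<n∨m≡n i≤L
      ... | inj₁ i<L  = inj₂ (inj₂ (i , i<L , e))
      ... | inj₂ refl = inj₁ (inj₂ e)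
      grow′ : Chains m r r′ (suc L) ⊆ ((_≡ r) ∪ Chain m r′ (suc L)) ∪ Chain m (r + m) L
      grow′ (inj₁ d) with Chain-split d
      ... | inj₁ e = inj₁ (inj₁ e)
      ... | inj₂ d = inj₂ d
      grow′ (inj₂ d) = inj₁ (inj₂ d)

  half : ∀ {b c u} → u < ⌊ c ∸ b /2⌋ → suc u + (b + suc u) ≤ c
  half {b} {c} {u} u< = begin
    suc u + (b + suc u)   ≡⟨ solve (u ∷ b ∷ []) ⟩
    b + (suc u + suc u)   ≤⟨ +-monoʳ-≤ b (+-mono-≤ u< (≤-trans u< (⌊n/2⌋≤⌈n/2⌉ (c ∸ b)))) ⟩
    b + (⌊ c ∸ b /2⌋ + ⌈ c ∸ b /2⌉)  ≡⟨ cong (b +_) (⌊n/2⌋+⌈n/2⌉≡n (c ∸ b)) ⟩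
    b + (c ∸ b)           ≡⟨ m+[n∸m]≡n (<⇒≤ b<c) ⟩
    c ∎
    where
    open ≤-Reasoning
    b<c : b < c
    b<c = ≰⇒> λ c≤b → n≮0 (subst (λ k → u < ⌊ k /2⌋) (m≤n⇒m∸n≡0 c≤b) u<)

  -- The pairs of classes {r , r′} with b < r ≤ r′ < c and r + r′ = b + c.
  Pair : (m L b c u : ℕ) → Pred ℕ 0ℓ
  Pair m L b c u = Chains m (b + suc u) (c ∸ suc u) L

  -- If `c ∸ b` is even, the last pair is the middle class taken twice.
  Half : (m L b c : ℕ) → Pred ℕ 0ℓ
  Half m L b c = ⋃ ⌊ c ∸ b /2⌋ (Pair m L b c)

  ≤⌊+/2⌋ : ∀ {e g} → e ≤ g → e ≤ ⌊ e + g /2⌋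
  ≤⌊+/2⌋ {e} e≤g = ≤-trans (≤-reflexive (n≡⌊n+n/2⌋ e)) (⌊n/2⌋-mono (+-monoʳ-≤ e e≤g))

  ∈-Half : ∀ {m L b c r i} → i < L → b < r → r < c → Half m L b c (r + i * m)
  ∈-Half {m} {L} {b} {c} {r} {i} i<L b<r r<c with m≤n⇒∃[o]m+o≡n b<r | m≤n⇒∃[o]m+o≡n r<c
  ... | e , refl | g , refl with ≤-total e g
  ...   | inj₁ e≤g = e , subst (λ k → e < ⌊ k /2⌋) (sym size) (s≤s (≤⌊+/2⌋ e≤g))
        , inj₁ (i , i<L , cong (_+ i * m) (sym (+-suc b e)))
    where
    size : suc (suc b + e) + g ∸ b ≡ 2 + (e + g)
    size = trans (cong (_∸ b) total) (m+n∸n≡m (2 + (e + g)) b)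
      where
      total : suc (suc b + e) + g ≡ 2 + (e + g) + b
      total = solve (b ∷ e ∷ g ∷ [])
  ...   | inj₂ g≤e = g , subst (λ k → g < ⌊ k /2⌋) (sym size) (s≤s (≤⌊+/2⌋ g≤e))
        , inj₂ (i , i<L , cong (_+ i * m) (sym (trans (cong (_∸ suc g) (sym (+-suc (suc b + e) g))) (m+n∸n≡m (suc b + e) (suc g)))))
    where
    size : suc (suc b + e) + g ∸ b ≡ 2 + (g + e)
    size = trans (cong (_∸ b) total) (m+n∸n≡m (2 + (g + e)) b)
      where
      total : suc (suc b + e) + g ≡ 2 + (g + e) + b
      total = solve (b ∷ e ∷ g ∷ [])

  module _ {F m : ℕ} {P : Pred Subset 0ℓ} (P-semigroup : P ⊆ Semigroup F) (P-m : ∀ {s} → P s → T (s m)) where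

    -- The class of 0 lies inside the semigroup, and the class of `f` outside, as its members below
    -- `F` are `F` minus multiples of `m`. Under `x ↦ F - x` the classes `0 < r < f`, with `L + 1`
    -- members up to `F`, are paired by `r + r′ = f`, and the classes `f < r < m`, with `L` members,
    -- by `r + r′ = f + m`.
    Code-classes : ∀ {L f K K′} → F ≡ f + L * m → f < m →
                   Code (Half m (suc L) 0 f) P K → Code (Half m L f m) P K′ → Code (_< F) P (K * K′)
    Code-classes {L} {f} {K} {K′} refl f<m c c′ = Code-≤ (≤-reflexive (*-identityˡ (K * K′)))
      (Code-⊆ classify (Code-× (Code-known known) (Code-× c c′)))
      where
      Known : Pred ℕ 0ℓ
      Known = (λ x → ∃[ i ] x ≡ i * m) ∪ (λ x → ∃[ i ] i ≤ L × x ≡ f + i * m)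
      known : ∀ {s s′} → P s → P s′ → ∀ {x} → Known x → s x ≡ s′ x
      known p p′ (inj₁ (i , refl)) = T⇒≡ (multiples (P-semigroup p) i m (P-m p)) (multiples (P-semigroup p′) i m (P-m p′))
      known {s} {s′} p p′ (inj₂ (i , i≤L , refl)) = ¬T⇒≡ (out p) (out p′)
        where
        out : ∀ {s} → P s → ¬ T (s (f + i * m))
        out {s} p = exclude (P-semigroup p) ((L ∸ i) * m) (f + i * m)
          (trans (trans (+-comm ((L ∸ i) * m) (f + i * m)) (+-assoc f (i * m) ((L ∸ i) * m)))
            (cong (f +_) (trans (sym (*-distribʳ-+ m i (L ∸ i))) (cong (_* m) (m+[n∸m]≡n i≤L)))))
          (multiples (P-semigroup p) (L ∸ i) m (P-m p))
      below : ∀ {r k} → r + k * m < f + L * m → k ≤ L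
      below {r} {k} h with k ≤? L
      ... | yes k≤L = k≤L
      ... | no  k≰L = contradiction h (≤⇒≯ (begin
        f + L * m   ≤⟨ +-monoˡ-≤ (L * m) (<⇒≤ f<m) ⟩
        suc L * m   ≤⟨ *-monoˡ-≤ m (≰⇒> k≰L) ⟩
        k * m       ≤⟨ m≤n+m (k * m) r ⟩
        r + k * m   ∎))
        where open ≤-Reasoning
      classify : (_< F) ⊆ Known ∪ (Half m (suc L) 0 f ∪ Half m L f m)
      classify {x} x<F = subst (Known ∪ (Half m (suc L) 0 f ∪ Half m L f m)) (sym x≡)
        (go r k (m%n<n x m) (subst (_< F) x≡ x<F))
        where
        instance _ = >-nonZero (≤-<-trans z≤n f<m)
        r = x % m
        k = x / m
        x≡ : x ≡ r + k * m
        x≡ = m≡m%n+[m/n]*n x m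
        go : ∀ r k → r < m → r + k * m < F → (Known ∪ (Half m (suc L) 0 f ∪ Half m L f m)) (r + k * m)
        go zero    k _   _ = inj₁ (inj₁ (k , refl))
        go r@(suc _) k r<m h with <-cmp r f
        ... | tri< r<f _ _  = inj₂ (inj₁ (∈-Half {i = k} (s≤s (below {r} h)) (s≤s z≤n) r<f))
        ... | tri≈ _ refl _ = inj₁ (inj₂ (k , below {r} h , refl))
        ... | tri> _ _ f<r  = inj₂ (inj₂ (∈-Half {i = k} (≤∧≢⇒< (below {r} h) λ where
                refl → <-asym f<r (+-cancelʳ-< (k * m) r f h)) f<r r<m))

  _⇒_ : Bool → Bool → Bool
  a ⇒ b = not a ∨ b

  infixr 5 _⇒_

  ⇒⁺ : ∀ {a b} → (T a → T b) → T (a ⇒ b)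
  ⇒⁺ {true}  h = h tt
  ⇒⁺ {false} h = tt

  not⁺ : ∀ {a} → ¬ T a → T (not a)
  not⁺ {true}  h = contradiction tt h
  not⁺ {false} h = tt

  infixr 4 _∧⁺_
  _∧⁺_ : ∀ {a b} → T a → T b → T (a ∧ b)
  x ∧⁺ y = Equivalence.from T-∧ (x , y)

  ⋃-split : ∀ {D} a n → ⋃ n D ⊆ ⋃ a D ∪ ⋃ (n ∸ a) (λ i → D (a + i))
  ⋃-split {D} a n {x} (u , u<n , d) with u <? a
  ... | yes u<a = inj₁ (u , u<a , d)
  ... | no  u≮a = inj₂ (u ∸ a , ∸-monoˡ-< u<n (≮⇒≥ u≮a) , subst (λ v → D v x) (sym (m+[n∸m]≡n (≮⇒≥ u≮a))) d)

  -- Membership of p, q, p + m, q + m, where p + q = F, in a semigroup containing m.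
  linked : Bool → Bool → Bool → Bool → Bool
  linked p q p′ q′ = (p ⇒ p′) ∧ (q ⇒ q′) ∧ (p ⇒ not q)

  module _ {F m b c : ℕ} {P : Pred Subset 0ℓ} (P-semigroup : P ⊆ Semigroup F) (P-m : ∀ {s} → P s → T (s m))
           (P-least : ∀ {s x} → P s → 0 < x → x < m → ¬ T (s x))
           (b+c≡ : b + c + 2 * m ≡ F) (c≤m : c ≤ m) where

    private
      block : ∀ u → Vec ℕ 4
      block u = b + suc u + 1 * m Vec.∷ c ∸ suc u + 1 * m Vec.∷ b + suc u + 2 * m Vec.∷ c ∸ suc u + 2 * m Vec.∷ Vec.[]

      low : ℕ → Pred ℕ 0ℓ
      low u = (_≡ b + suc u) ∪ (_≡ c ∸ suc u)

      H = ⌊ c ∸ b /2⌋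

      low-∉ : ∀ {u s} → u < H → P s → ∀ {x} → low u x → ¬ T (s x)
      low-∉ {u} u< p (inj₁ refl) = P-least p (≤-trans (s≤s z≤n) (m≤n+m (suc u) b))
        (≤-trans (≤-trans (+-monoˡ-≤ (b + suc u) (s≤s (z≤n {u}))) (half {b} {c} {u} u<)) c≤m)
      low-∉ {u} u< p (inj₂ refl) = P-least p (m<n⇒0<n∸m (≤-trans h (half {b} {c} u<)))
        (≤-trans (∸-monoʳ-< {c} (s≤s z≤n) (≤-trans (<⇒≤ h) (half {b} {c} u<))) c≤m)
        where
        h : suc u < suc u + (b + suc u)
        h = m<m+n (suc u) (≤-trans (s≤s z≤n) (m≤n+m (suc u) b))

      opposite : ∀ {u} → u < H → b + suc u + 1 * m + (c ∸ suc u + 1 * m) ≡ F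
      opposite {u} u< = begin
        b + suc u + 1 * m + (c ∸ suc u + 1 * m)  ≡⟨ reorder (c ∸ suc u) ⟩
        b + (suc u + (c ∸ suc u)) + 2 * m
          ≡⟨ cong (λ k → b + k + 2 * m) (m+[n∸m]≡n (≤-trans (m≤m+n (suc u) (b + suc u)) (half {b} {c} u<))) ⟩
        b + c + 2 * m                            ≡⟨ b+c≡ ⟩
        F                                        ∎
        where
        open ≡-Reasoning
        reorder : ∀ e → b + suc u + 1 * m + (e + 1 * m) ≡ b + (suc u + e) + 2 * m
        reorder e = solve (b ∷ u ∷ m ∷ e ∷ [])

      up : ∀ {s} r → P s → T (s (r + 1 * m)) → T (s (r + 2 * m))
      up {s} r p h = subst (T ∘ s) e (closed (P-semigroup p) _ _ h (P-m p))
        where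
        e : r + 1 * m + m ≡ r + 2 * m
        e = solve (r ∷ m ∷ [])

      block-linked : ∀ {s u} → u < H → P s →
        T (linked (s (b + suc u + 1 * m)) (s (c ∸ suc u + 1 * m)) (s (b + suc u + 2 * m)) (s (c ∸ suc u + 2 * m)))
      block-linked {u = u} u< p = ⇒⁺ (up (b + suc u) p) ∧⁺ ⇒⁺ (up (c ∸ suc u) p)
        ∧⁺ ⇒⁺ (λ h → not⁺ (exclude (P-semigroup p) _ _ (opposite u<) h))

      Pair⊆ : ∀ u → Pair m 3 b c u ⊆ low u ∪ (Vec._∈ block u)
      Pair⊆ u (inj₁ (0 , _ , refl)) = inj₁ (inj₁ (+-identityʳ _))
      Pair⊆ u (inj₁ (1 , _ , refl)) = inj₂ (VecAny.here refl)
      Pair⊆ u (inj₁ (2 , _ , refl)) = inj₂ (VecAny.there (VecAny.there (VecAny.here refl)))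
      Pair⊆ u (inj₁ (suc (suc (suc _)) , s≤s (s≤s (s≤s ())) , _))
      Pair⊆ u (inj₂ (0 , _ , refl)) = inj₁ (inj₂ (+-identityʳ _))
      Pair⊆ u (inj₂ (1 , _ , refl)) = inj₂ (VecAny.there (VecAny.here refl))
      Pair⊆ u (inj₂ (2 , _ , refl)) = inj₂ (VecAny.there (VecAny.there (VecAny.there (VecAny.here refl))))
      Pair⊆ u (inj₂ (suc (suc (suc _)) , s≤s (s≤s (s≤s ())) , _))

    -- Leastness of `m` empties the bottom of both classes and thereby reduces the 10 patterns of
    -- `Code-chains` to 8. Only the middle members are then opposite to each other. The hypothesis
    -- on `b + c` covers two uses: `b = f`, `c = m` when `F = f + 3 m`, and `b = 0`, `c = f` when
    -- `F = f + 2 m`.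
    Code-pair₃ : ∀ {u} → u < H → Code (Pair m 3 b c u) P 8
    Code-pair₃ {u} u< = Code-⊆ (Pair⊆ u) (Code-× (Code-empty (low-∉ u<))
      (Code-filter (block u) (λ where (p Vec.∷ q Vec.∷ p′ Vec.∷ q′ Vec.∷ Vec.[]) → linked p q p′ q′) (block-linked u<)))

    Code-half₃ : Code (Half m 3 b c) P (8 ^ H)
    Code-half₃ = Code-^ H (λ _ → Code-pair₃)

    module _ {d : ℕ} (P-n : ∀ {s} → P s → T (s (m + d))) where

      private
        across : ∀ {s} u → P s → T (s (b + suc u + 1 * m)) → T (s (b + suc (d + u) + 2 * m))
        across {s} u p h = subst (T ∘ s) e (closed (P-semigroup p) _ _ h (P-n p))
          where
          e : b + suc u + 1 * m + (m + d) ≡ b + suc (d + u) + 2 * m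
          e = solve (b ∷ u ∷ m ∷ d ∷ [])

      -- The implication from u to d + u rules out 6 of the 8 · 8 combinations.
      Code-pairs₃ : ∀ {u} → d + u < H → Code (Pair m 3 b c u ∪ Pair m 3 b c (d + u)) P 58
      Code-pairs₃ {u} d+u< = Code-⊆ split
        (Code-× (Code-empty λ where
            p (inj₁ l) → low-∉ u< p l
            p (inj₂ l) → low-∉ d+u< p l)
          (Code-filter (block u Vec.++ block (d + u))
            (λ where (p Vec.∷ q Vec.∷ p′ Vec.∷ q′ Vec.∷ r Vec.∷ t Vec.∷ r′ Vec.∷ t′ Vec.∷ Vec.[]) →
                       linked p q p′ q′ ∧ linked r t r′ t′ ∧ (p ⇒ r′))
            (λ p → block-linked u< p ∧⁺ block-linked d+u< p ∧⁺ ⇒⁺ (across u p))))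
        where
        u< : u < H
        u< = ≤-<-trans (m≤n+m u d) d+u<
        split : Pair m 3 b c u ∪ Pair m 3 b c (d + u) ⊆ (low u ∪ low (d + u)) ∪ (Vec._∈ block u Vec.++ block (d + u))
        split (inj₁ x∈) with Pair⊆ u x∈
        ... | inj₁ l = inj₁ (inj₁ l)
        ... | inj₂ k = inj₂ (Vec.∈-++⁺ˡ k)
        split (inj₂ x∈) with Pair⊆ (d + u) x∈
        ... | inj₁ l = inj₁ (inj₂ l)
        ... | inj₂ k = inj₂ (Vec.∈-++⁺ʳ (block u) k)

      -- The pairs `u` and `d + u` are tied together for `u < w`. The condition `w ≤ d` makes the
      -- two blocks of indices disjoint, and `d + w ≤ H` keeps the second one in range; the indices
      -- between and after them count 8 each.
      Code-doubled : ∀ {w} → w ≤ d → d + w ≤ H →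
                     Code (Half m 3 b c) P (58 ^ w * (8 ^ (d ∸ w) * 8 ^ (H ∸ d ∸ w)))
      Code-doubled {w} w≤d d+w≤ = Code-⊆ split
        (Code-× (Code-^ w (λ u u<w → Code-pairs₃ (<-≤-trans (+-monoʳ-< d u<w) d+w≤)))
          (Code-× (Code-^ (d ∸ w) (λ u u< → Code-pair₃ (≤-trans (+-monoʳ-< w u<) (≤-trans (≤-reflexive (m+[n∸m]≡n w≤d))
                     (≤-trans (m≤m+n d w) d+w≤)))))
                  (Code-^ (H ∸ d ∸ w) (λ u u< → Code-pair₃ (<-≤-trans (+-monoʳ-< d (+-monoʳ-< w u<))
                     (≤-reflexive (trans (cong (d +_) (m+[n∸m]≡n w≤)) (m+[n∸m]≡n d≤))))))))
        where
        d≤ : d ≤ H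
        d≤ = ≤-trans (m≤m+n d w) d+w≤
        w≤ : w ≤ H ∸ d
        w≤ = ≤-trans (≤-reflexive (sym (m+n∸m≡n d w))) (∸-monoˡ-≤ d d+w≤)
        split : Half m 3 b c ⊆ ⋃ w (λ u → Pair m 3 b c u ∪ Pair m 3 b c (d + u))
                  ∪ (⋃ (d ∸ w) (λ u → Pair m 3 b c (w + u)) ∪ ⋃ (H ∸ d ∸ w) (λ u → Pair m 3 b c (d + (w + u))))
        split x∈ with ⋃-split {Pair m 3 b c} d H x∈
        split _ | inj₁ x∈ with ⋃-split {Pair m 3 b c} w d x∈
        ... | inj₁ (u , u< , e) = inj₁ (u , u< , inj₁ e)
        ... | inj₂ e            = inj₂ (inj₁ e)
        split _ | inj₂ x∈ with ⋃-split {λ u → Pair m 3 b c (d + u)} w (H ∸ d) x∈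
        ... | inj₁ (u , u< , e) = inj₁ (u , u< , inj₂ e)
        ... | inj₂ e            = inj₂ (inj₂ e)

  -- Square-root bounds

  ^-distribʳ-* : ∀ n x y → (x * y) ^ n ≡ x ^ n * y ^ n
  ^-distribʳ-* zero    x y = refl
  ^-distribʳ-* (suc n) x y = trans (cong (x * y *_) (^-distribʳ-* n x y)) (*-interchange x y (x ^ n) (y ^ n))
    where
    *-interchange : ∀ a b c d → a * b * (c * d) ≡ a * c * (b * d)
    *-interchange a b c d = solve (a ∷ b ∷ c ∷ d ∷ [])

  sq-^ : ∀ x n → x ^ n * x ^ n ≡ (x * x) ^ n
  sq-^ x n = sym (^-distribʳ-* n x x)

  ⌊/2⌋+⌊/2⌋≤ : ∀ n → ⌊ n /2⌋ + ⌊ n /2⌋ ≤ n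
  ⌊/2⌋+⌊/2⌋≤ n = ≤-trans (+-monoʳ-≤ ⌊ n /2⌋ (⌊n/2⌋≤⌈n/2⌉ n)) (≤-reflexive (⌊n/2⌋+⌈n/2⌉≡n n))

  *-cancelˡ-≤′ : ∀ {a b} c → 0 < c → c * a ≤ c * b → a ≤ b
  *-cancelˡ-≤′ c 0<c = *-cancelˡ-≤ c {{>-nonZero 0<c}}

  ^-pos : ∀ x n → 0 < suc x ^ n
  ^-pos x n = ≤-trans (≤-reflexive (sym (^-zeroˡ n))) (^-monoˡ-≤ n (s≤s (z≤n {x})))

  module _ (k : ℕ) where

    -- M ≤ 2 ^ (n / 2), with a further factor (k / (k + 1)) ^ (e / 2).
    record Gain (e M n : ℕ) : Set where
      constructor gain
      field bound : suc k ^ e * (M * M) ≤ k ^ e * 2 ^ n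

    private
      *-swap : ∀ a b c d → a * b * (c * d) ≡ a * c * (b * d)
      *-swap a b c d = solve (a ∷ b ∷ c ∷ d ∷ [])

    Gain-* : ∀ {e e′ M M′ n n′} → Gain e M n → Gain e′ M′ n′ → Gain (e + e′) (M * M′) (n + n′)
    Gain-* {e} {e′} {M} {M′} {n} {n′} (gain g) (gain g′) = gain (begin
      suc k ^ (e + e′) * (M * M′ * (M * M′))              ≡⟨ cong₂ _*_ (^-distribˡ-+-* (suc k) e e′) (*-swap M M′ M M′) ⟩
      suc k ^ e * suc k ^ e′ * (M * M * (M′ * M′))        ≡⟨ *-swap (suc k ^ e) _ _ _ ⟩
      suc k ^ e * (M * M) * (suc k ^ e′ * (M′ * M′))      ≤⟨ *-mono-≤ g g′ ⟩
      k ^ e * 2 ^ n * (k ^ e′ * 2 ^ n′)                   ≡⟨ *-swap (k ^ e) _ _ _ ⟩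
      k ^ e * k ^ e′ * (2 ^ n * 2 ^ n′)                   ≡⟨ sym (cong₂ _*_ (^-distribˡ-+-* k e e′) (^-distribˡ-+-* 2 n n′)) ⟩
      k ^ (e + e′) * 2 ^ (n + n′)                         ∎)
      where open ≤-Reasoning

    Gain-mono : ∀ {e M M′ n n′} → M ≤ M′ → n′ ≤ n → Gain e M′ n′ → Gain e M n
    Gain-mono {e} M≤ n≤ (gain g) = gain (≤-trans (*-monoʳ-≤ (suc k ^ e) (*-mono-≤ M≤ M≤))
      (≤-trans g (*-monoʳ-≤ (k ^ e) (^-monoʳ-≤ 2 n≤))))

    Gain-e : ∀ {e w M n} → w ≤ e → Gain e M n → Gain w M n
    Gain-e {e} {w} {M} {n} w≤e (gain g) with m≤n⇒∃[o]m+o≡n w≤e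
    ... | o , refl = gain (*-cancelˡ-≤′ (suc k ^ o) (^-pos k o) (begin
      suc k ^ o * (suc k ^ w * (M * M))  ≡⟨ sym (*-assoc (suc k ^ o) _ _) ⟩
      suc k ^ o * suc k ^ w * (M * M)    ≡⟨ cong (_* (M * M)) (trans (*-comm (suc k ^ o) _) (sym (^-distribˡ-+-* (suc k) w o))) ⟩
      suc k ^ (w + o) * (M * M)          ≤⟨ g ⟩
      k ^ (w + o) * 2 ^ n                ≡⟨ cong (_* 2 ^ n) (trans (^-distribˡ-+-* k w o) (*-comm (k ^ w) _)) ⟩
      k ^ o * k ^ w * 2 ^ n              ≡⟨ *-assoc (k ^ o) _ _ ⟩
      k ^ o * (k ^ w * 2 ^ n)            ≤⟨ *-monoˡ-≤ _ (^-monoˡ-≤ o (n≤1+n k)) ⟩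
      suc k ^ o * (k ^ w * 2 ^ n)        ∎))
      where open ≤-Reasoning

    Gain-^ : ∀ x L e → suc k * (x * x) ≤ k * 2 ^ L → Gain e (x ^ e) (L * e)
    Gain-^ x L e h = gain (begin
      suc k ^ e * (x ^ e * x ^ e)  ≡⟨ cong (suc k ^ e *_) (sq-^ x e) ⟩
      suc k ^ e * (x * x) ^ e      ≡⟨ sym (^-distribʳ-* e (suc k) (x * x)) ⟩
      (suc k * (x * x)) ^ e        ≤⟨ ^-monoˡ-≤ e h ⟩
      (k * 2 ^ L) ^ e              ≡⟨ ^-distribʳ-* e k (2 ^ L) ⟩
      k ^ e * (2 ^ L) ^ e          ≡⟨ cong (k ^ e *_) (^-*-assoc 2 L e) ⟩
      k ^ e * 2 ^ (L * e)          ∎)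
      where open ≤-Reasoning

    -- Here `e` classes form `⌊ e /2⌋` pairs. Squaring the count gives back at most `e` factors, so
    -- that `x` is compared with `2 ^ L` to the first power.
    Gain-^⌊/2⌋ : ∀ x L e → 0 < x → suc k * x ≤ k * 2 ^ L → Gain e (x ^ ⌊ e /2⌋) (L * e)
    Gain-^⌊/2⌋ x@(suc y) L e _ h = gain (begin
      suc k ^ e * (x ^ ⌊ e /2⌋ * x ^ ⌊ e /2⌋)  ≡⟨ cong (suc k ^ e *_) (sym (^-distribˡ-+-* x ⌊ e /2⌋ ⌊ e /2⌋)) ⟩
      suc k ^ e * x ^ (⌊ e /2⌋ + ⌊ e /2⌋)      ≤⟨ *-monoʳ-≤ (suc k ^ e) (^-monoʳ-≤ x (⌊/2⌋+⌊/2⌋≤ e)) ⟩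
      suc k ^ e * x ^ e                        ≡⟨ sym (^-distribʳ-* e (suc k) x) ⟩
      (suc k * x) ^ e                          ≤⟨ ^-monoˡ-≤ e h ⟩
      (k * 2 ^ L) ^ e                          ≡⟨ ^-distribʳ-* e k (2 ^ L) ⟩
      k ^ e * (2 ^ L) ^ e                      ≡⟨ cong (k ^ e *_) (^-*-assoc 2 L e) ⟩
      k ^ e * 2 ^ (L * e)                      ∎)
      where open ≤-Reasoning

    Gain-2^ : ∀ n → Gain 0 (2 ^ n) (2 * n)
    Gain-2^ n = gain (≤-reflexive (cong (1 *_) (trans (sym (^-distribˡ-+-* 2 n n))
      (cong (λ i → 2 ^ (n + i)) (sym (+-identityʳ n))))))

    Gain₀-^ : ∀ L e → Gain 0 ((2 ^ L) ^ e) (2 * (L * e))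
    Gain₀-^ L e = Gain-mono (≤-reflexive (^-*-assoc 2 L e)) ≤-refl (Gain-2^ (L * e))

    Gain₀-^⌊/2⌋ : ∀ L e → Gain 0 ((2 ^ L) ^ ⌊ e /2⌋) (L * e)
    Gain₀-^⌊/2⌋ L e = Gain-mono ≤-refl (≤-trans (≤-reflexive (double ⌊ e /2⌋)) (*-monoʳ-≤ L (⌊/2⌋+⌊/2⌋≤ e))) (Gain₀-^ L ⌊ e /2⌋)
      where
      double : ∀ h → 2 * (L * h) ≡ L * (h + h)
      double h = solve (L ∷ h ∷ [])

  -- A saving of `a` in `a + 1` is stronger than one of `k` in `k + 1` when `a ≤ k`; this brings all
  -- savings to the common `k`.
  ratio : ∀ a .{{_ : NonZero a}} {k x y} → a ≤ k → suc a * x ≤ a * y → suc k * x ≤ k * y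
  ratio a {x = x} {y} a≤k h with m≤n⇒∃[o]m+o≡n a≤k
  ... | o , refl = begin
    (suc a + o) * x      ≡⟨ *-distribʳ-+ x (suc a) o ⟩
    suc a * x + o * x    ≤⟨ +-mono-≤ h (*-monoʳ-≤ o x≤y) ⟩
    a * y + o * y        ≡⟨ sym (*-distribʳ-+ y a o) ⟩
    (a + o) * y          ∎
    where
    open ≤-Reasoning
    x≤y : x ≤ y
    x≤y = *-cancelˡ-≤ a (≤-trans (m≤n+m (a * x) x) h)

  0<pairCount : ∀ L → 0 < pairCount L
  0<pairCount zero    = s≤s z≤n
  0<pairCount (suc L) = s≤s z≤n

  -- The ratio 15 to 16 at `L = 4` persists because the step adds `L + 2`, which is at most
  -- `pairCount L`, so that the count at most doubles. Hence the induction also carries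
  -- `2 + L ≤ pairCount L`.
  pairCount-bound : ∀ {L} → 4 ≤ L → 16 * pairCount L ≤ 15 * 2 ^ L
  pairCount-bound 4≤L = proj₁ (go (≤⇒≤′ 4≤L))
    where
    base : 16 * pairCount 4 ≤ 15 * 2 ^ 4
    base = ≤-refl {240}
    step : ∀ p q L → 16 * p ≤ 15 * q → 2 + L ≤ p → 16 * (1 + (p + suc L)) ≤ 15 * (2 * q)
    step p q L h h′ = linear 0 (h ⊞ h ⊞ scale 16 h′) (solve (p ∷ q ∷ L ∷ []))
    go : ∀ {L} → 4 ≤′ L → 16 * pairCount L ≤ 15 * 2 ^ L × 2 + L ≤ pairCount L
    go ≤′-refl               = base , m≤m+n 6 9
    go {suc L} (≤′-step 4≤L) with go 4≤L
    ... | h , h′ = step (pairCount L) (2 ^ L) L h h′ , s≤s (≤-trans h′ (m≤m+n (pairCount L) (suc L)))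

  -- Semigroups with a small element, or with two elements below F / 2

  -- M ≤ c (k / (k + 1)) ^ (w / 2) 2 ^ (F / 2)
  record Rare (k w F : ℕ) (P : Pred Subset 0ℓ) (c : ℕ) : Set where
    field
      {M}    : ℕ
      coding : Code (_< F) P M
      small  : suc k ^ w * (M * M) ≤ c * c * (k ^ w * 2 ^ F)

  Rare-gain : ∀ {k w F P M} → Code (_< F) P M → Gain k w M (suc F) → Rare k w F P 2
  Rare-gain {k} {w} {F} c (gain g) = record
    { coding = c
    ; small  = ≤-trans g (≤-trans (m≤m*n _ 2) (≤-reflexive (double (k ^ w) (2 ^ F))))
    }
    where
    double : ∀ a b → a * (2 * b) * 2 ≡ 2 * 2 * (a * b)
    double a b = solve (a ∷ b ∷ [])

  module _ {k w F m : ℕ} (15≤k : 15 ≤ k) where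

    -- Every class has at least four members, so all `m` residues contribute a saving: `f` of them
    -- with `L + 1` members and `m ∸ f` with `L`. Leastness of `m` is not assumed, which allows `m`
    -- to be replaced by a multiple.
    Rare-small : 4 * m ≤ F → 0 < m → w ≤ m → Rare k w F (λ s → Semigroup F s × T (s m)) 2
    Rare-small 4m≤F 0<m w≤m = Rare-gain
      (Code-classes proj₁ proj₂ F≡ f<m
        (Code-^ ⌊ f /2⌋ (λ u u< → Code-chains proj₁ proj₂ (suc L) (suc u) (f ∸ suc u) id (sum₀ u<)))
        (Code-^ ⌊ m ∸ f /2⌋ (λ u u< → Code-chains proj₁ proj₂ L (f + suc u) (m ∸ suc u) id (sum₁ u<))))
      (Gain-e k (≤-trans w≤m (≤-reflexive (sym (m+[n∸m]≡n (<⇒≤ f<m)))))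
        (Gain-mono k ≤-refl (≤-trans (≤-reflexive total) (n≤1+n F))
          (Gain-* k
            (Gain-^⌊/2⌋ k (pairCount (suc L)) (suc L) f (0<pairCount (suc L)) (ratio 15 15≤k (pairCount-bound (m≤n⇒m≤1+n 4≤L))))
            (Gain-^⌊/2⌋ k (pairCount L) L (m ∸ f) (0<pairCount L) (ratio 15 15≤k (pairCount-bound 4≤L))))))
      where
      instance _ = >-nonZero 0<m
      L = F / m
      f = F % m
      f<m : f < m
      f<m = m%n<n F m
      F≡ : F ≡ f + L * m
      F≡ = m≡m%n+[m/n]*n F m
      4≤L : 4 ≤ L
      4≤L = ≤-trans (≤-reflexive (sym (m*n/n≡m 4 m))) (/-monoˡ-≤ m 4m≤F)
      sum₀ : ∀ {u} → u < ⌊ f /2⌋ → suc u + (f ∸ suc u) + suc L * m ≡ F + m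
      sum₀ {u} u< = trans (cong (_+ suc L * m) (m+[n∸m]≡n (≤-trans u< (⌊n/2⌋≤n f))))
        (trans (cong (f +_) (+-comm m (L * m))) (trans (sym (+-assoc f (L * m) m)) (cong (_+ m) (sym F≡))))
      sum₁ : ∀ {u} → u < ⌊ m ∸ f /2⌋ → f + suc u + (m ∸ suc u) + L * m ≡ F + m
      sum₁ {u} u< = trans (cong (_+ L * m) (trans (+-assoc f (suc u) (m ∸ suc u)) (cong (f +_)
          (m+[n∸m]≡n (≤-trans u< (≤-trans (⌊n/2⌋≤n (m ∸ f)) (m∸n≤m m f)))))))
        (trans (+-assoc f m (L * m)) (trans (cong (f +_) (+-comm m (L * m))) (trans (sym (+-assoc f (L * m) m)) (cong (_+ m) (sym F≡)))))
      total : suc L * f + L * (m ∸ f) ≡ F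
      total = trans (+-assoc f (L * f) _) (trans (cong (f +_) (trans (sym (*-distribˡ-+ L f (m ∸ f)))
        (cong (L *_) (m+[n∸m]≡n (<⇒≤ f<m))))) (sym F≡))

  record Least (F m : ℕ) (s : Subset) : Set where
    field
      semigroup : Semigroup F s
      m∈        : T (s m)
      least     : ∀ {x} → 0 < x → x < m → ¬ T (s x)

  open Least

  Gain₀-8 : ∀ k σ → Gain k 0 (8 ^ ⌊ σ /2⌋) (3 * σ)
  Gain₀-8 k σ = Gain₀-^⌊/2⌋ k 3 σ

  module _ {k w F m : ℕ} (15≤k : 15 ≤ k) where

    -- Two tied pairs are four classes of three members, hence the exponent 12 for the square of
    -- their count.
    58-bound : suc k * (58 * 58) ≤ k * 2 ^ 12
    58-bound = ratio 15 {k} {58 * 58} {2 ^ 12} 15≤k (≤ᵇ⇒≤ (16 * (58 * 58)) (15 * 2 ^ 12) _)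

    Gain-doubled : ∀ d σ → w ≤ d → d + w ≤ ⌊ σ /2⌋ →
                   Gain k w (58 ^ w * (8 ^ (d ∸ w) * 8 ^ (⌊ σ /2⌋ ∸ d ∸ w))) (3 * σ)
    Gain-doubled d σ w≤d d+w≤ = Gain-e k (m≤m+n w (0 + 0)) (Gain-mono k ≤-refl (begin
        12 * w + (2 * (3 * (d ∸ w)) + 2 * (3 * (h ∸ d ∸ w)))  ≡⟨ collect (d ∸ w) (h ∸ d ∸ w) ⟩
        6 * (w + (d ∸ w) + (w + (h ∸ d ∸ w)))                 ≡⟨ cong (6 *_) (cong₂ _+_ (m+[n∸m]≡n w≤d) (m+[n∸m]≡n w≤h∸d)) ⟩
        6 * (d + (h ∸ d))                                     ≡⟨ cong (6 *_) (m+[n∸m]≡n (≤-trans (m≤m+n d w) d+w≤)) ⟩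
        6 * h                                                 ≡⟨ *-assoc 3 2 h ⟩
        3 * (h + (h + 0))                                     ≡⟨ cong (λ n → 3 * (h + n)) (+-identityʳ h) ⟩
        3 * (h + h)                                           ≤⟨ *-monoʳ-≤ 3 (⌊/2⌋+⌊/2⌋≤ σ) ⟩
        3 * σ                                                 ∎)
      (Gain-* k (Gain-^ k 58 12 w 58-bound) (Gain-* k (Gain₀-^ k 3 (d ∸ w)) (Gain₀-^ k 3 (h ∸ d ∸ w)))))
      where
      open ≤-Reasoning
      h = ⌊ σ /2⌋
      w≤h∸d : w ≤ h ∸ d
      w≤h∸d = ≤-trans (≤-reflexive (sym (m+n∸m≡n d w))) (∸-monoˡ-≤ d d+w≤)
      collect : ∀ x y → 12 * w + (2 * (3 * x) + 2 * (3 * y)) ≡ 6 * (w + x + (w + y))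
      collect x y = solve (w ∷ x ∷ y ∷ [])

    private
      pairs₄ : ∀ {f P} → P ⊆ Least F m → F ≡ f + 3 * m → Code (Half m 4 0 f) P (15 ^ ⌊ f /2⌋)
      pairs₄ {f} P⊆ F≡ = Code-^ ⌊ f /2⌋ (λ u u< →
        Code-chains {P = Least F m} semigroup m∈ 4 (suc u) (f ∸ suc u) P⊆
          (trans (cong (_+ 4 * m) (m+[n∸m]≡n (≤-trans u< (⌊n/2⌋≤n f)))) (trans (reorder f) (cong (_+ m) (sym F≡)))))
        where
        reorder : ∀ f → f + 4 * m ≡ f + 3 * m + m
        reorder f = solve (f ∷ m ∷ [])

      gain₄ : ∀ f → Gain k f (15 ^ ⌊ f /2⌋) (4 * f)
      gain₄ f = Gain-^⌊/2⌋ k 15 4 f (s≤s z≤n) (ratio 15 15≤k (pairCount-bound {4} ≤-refl))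

      swap₃ : ∀ {f} → F ≡ f + 3 * m → f + m + 2 * m ≡ F
      swap₃ {f} F≡ = trans e (sym F≡)
        where
        e : f + m + 2 * m ≡ f + 3 * m
        e = solve (f ∷ m ∷ [])

      total₃ : ∀ {f} → F ≡ f + 3 * m → f < m → 4 * f + 3 * (m ∸ f) ≡ F
      total₃ {f} F≡ f<m = trans (reorder (m ∸ f)) (trans (cong (λ n → f + 3 * n) (m+[n∸m]≡n (<⇒≤ f<m))) (sym F≡))
        where
        reorder : ∀ g → 4 * f + 3 * g ≡ f + 3 * (f + g)
        reorder g = solve (f ∷ g ∷ [])

    -- The `f` residues below `f` have four members each and save 15 in 16; the others count exactly
    -- 8 for a pair. For `m` between `F / 4` and `F / 3` this leaves only `f < w`, that is, `m`
    -- close to `F / 3`.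
    Rare-third : ∀ {f} → F ≡ f + 3 * m → f < m → w ≤ f → Rare k w F (Least F m) 2
    Rare-third {f} F≡ f<m w≤f = Rare-gain
      (Code-classes semigroup m∈ F≡ f<m (pairs₄ {f} id F≡)
        (Code-half₃ semigroup m∈ (λ p → least p) (swap₃ {f} F≡) ≤-refl))
      (Gain-e k (≤-trans w≤f (m≤m+n f 0))
        (Gain-mono k ≤-refl (≤-trans (≤-reflexive (total₃ {f} F≡ f<m)) (n≤1+n F))
          (Gain-* k (gain₄ f) (Gain₀-8 k (m ∸ f)))))

    module _ {d : ℕ} where

      private
        P : Pred Subset 0ℓ
        P s = Least F m s × T (s (m + d))

      Rare-two₃ : ∀ {f} → F ≡ f + 3 * m → f < m → w ≤ d → d + w ≤ ⌊ m ∸ f /2⌋ → Rare k w F P 2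
      Rare-two₃ {f} F≡ f<m w≤d d+w≤ = Rare-gain
        (Code-classes (semigroup ∘ proj₁) (m∈ ∘ proj₁) F≡ f<m (pairs₄ {f} proj₁ F≡)
          (Code-doubled {b = f} {m} (semigroup ∘ proj₁) (m∈ ∘ proj₁) (λ p → least (proj₁ p)) (swap₃ {f} F≡) ≤-refl proj₂ w≤d d+w≤))
        (Gain-e k (m≤n+m w f)
          (Gain-mono k ≤-refl (≤-trans (≤-reflexive (total₃ {f} F≡ f<m)) (n≤1+n F))
            (Gain-* k (gain₄ f) (Gain-doubled d (m ∸ f) w≤d d+w≤))))

      -- Now the classes below `f` have three members and can be tied together by the second
      -- element. Those above `f` have two, the lower of which is excluded by leastness; a pair of
      -- them counts `4 = 2 ^ 2` and neither gains nor loses.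
      Rare-two₂ : ∀ {f} → F ≡ f + 2 * m → f < m → w ≤ d → d + w ≤ ⌊ f /2⌋ → Rare k w F P 2
      Rare-two₂ {f} F≡ f<m w≤d d+w≤ = Rare-gain
        (Code-classes (semigroup ∘ proj₁) (m∈ ∘ proj₁) F≡ f<m
          (Code-doubled {b = 0} {f} (semigroup ∘ proj₁) (m∈ ∘ proj₁) (λ p → least (proj₁ p)) (sym F≡) (<⇒≤ f<m) proj₂ w≤d d+w≤)
          (Code-^ ⌊ m ∸ f /2⌋ pair₂))
        (Gain-e k (m≤m+n w 0)
          (Gain-mono k ≤-refl (≤-trans (≤-reflexive total) (n≤1+n F))
            (Gain-* k (Gain-doubled d f w≤d d+w≤) (Gain₀-^⌊/2⌋ k 2 (m ∸ f)))))
        where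
        total : 3 * f + 2 * (m ∸ f) ≡ F
        total = trans (reorder (m ∸ f)) (trans (cong (λ n → f + 2 * n) (m+[n∸m]≡n (<⇒≤ f<m))) (sym F≡))
          where
          reorder : ∀ g → 3 * f + 2 * g ≡ f + 2 * (f + g)
          reorder g = solve (f ∷ g ∷ [])
        pair₂ : ∀ u → u < ⌊ m ∸ f /2⌋ → Code (Pair m 2 f m u) P 4
        pair₂ u u< = Code-⊆ split (Code-× (Code-empty low) (Code-× (Code-free _) (Code-free _)))
          where
          Low : Pred ℕ 0ℓ
          Low x = 0 < x × x < m
          low : ∀ {s} → P s → ∀ {x} → Low x → ¬ T (s x)
          low (p , _) (0<x , x<m) = least p 0<x x<m
          h : suc u + (f + suc u) ≤ m
          h = half {f} {m} u<
          split : Pair m 2 f m u ⊆ Low ∪ ((_≡ f + suc u + 1 * m) ∪ (_≡ m ∸ suc u + 1 * m))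
          split (inj₁ (0 , _ , refl)) = inj₁
            ( ≤-trans (s≤s z≤n) (≤-trans (m≤n+m (suc u) f) (m≤m+n _ _))
            , ≤-trans (s≤s (≤-trans (≤-reflexive (+-identityʳ _)) (m≤n+m _ u))) h)
          split (inj₁ (1 , _ , refl)) = inj₂ (inj₁ refl)
          split (inj₁ (suc (suc _) , s≤s (s≤s ()) , _))
          split (inj₂ (0 , _ , refl)) = inj₁
            ( ≤-trans (m<n⇒0<n∸m (≤-trans (m<m+n (suc u) (≤-trans (s≤s z≤n) (m≤n+m (suc u) f))) h)) (m≤m+n _ _)
            , ≤-trans (s≤s (≤-reflexive (+-identityʳ _))) (∸-monoʳ-< {m} (s≤s z≤n) (≤-trans (m≤m+n (suc u) _) h)))
          split (inj₂ (1 , _ , refl)) = inj₂ (inj₂ refl)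
          split (inj₂ (suc (suc _) , s≤s (s≤s ()) , _))

  -- Semigroups whose elements below F / 2 are confined

  F∸h≤ : ∀ {F h} → F ≤ suc (h + h) → h + h ≤ F → 2 * (F ∸ h) ≤ suc F
  F∸h≤ {F} {h} F≤ ≤F = +-cancelʳ-≤ (h + h) _ _ (begin
    2 * (F ∸ h) + (h + h)       ≡⟨ reorder (F ∸ h) ⟩
    (h + (F ∸ h)) + (h + (F ∸ h))  ≡⟨ cong (λ n → n + n) (m+[n∸m]≡n (≤-trans (m≤m+n h h) ≤F)) ⟩
    F + F                       ≤⟨ +-monoʳ-≤ F F≤ ⟩
    F + suc (h + h)             ≡⟨ +-suc F (h + h) ⟩
    suc F + (h + h)             ∎)
    where
    open ≤-Reasoning
    reorder : ∀ g → 2 * g + (h + h) ≡ (h + g) + (h + g)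
    reorder g = solve (g ∷ h ∷ [])

  -- The open windows are the `w` numbers from `m` on and about `2 w` numbers just below `F / 2`.
  -- The margin `4 * w` turns an element `m + d` violating `gap` into the room for `d + w` that
  -- `Rare-two₃` and `Rare-two₂` require.
  record Confined (F w m : ℕ) (s : Subset) : Set where
    field
      isLeast : Least F m s
      gap     : ∀ {x} → m + w ≤ x → 2 * x + 4 * w ≤ F → ¬ T (s x)

  open Confined

  module _ {k w F m h : ℕ} (h+h≤F : h + h ≤ F) (F≤h+h : F ≤ suc (h + h)) where

    private
      W = 10 * w
      rest = F ∸ (h + m + W)

    -- The windows have `3 w` free bits. Each of the `10 w` pairs `h + i`, `h + i + m` takes three
    -- values instead of four, and `3 ^ 5 < 2 ^ 8`, so together they save `4 w` bits; the net saving
    -- is `w` bits. This is the origin of the factor 10 in `W`. The pairs are disjoint because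
    -- `W ≤ m`, and they stay below `F` because `m + W ≤ h`.
    Rare-confined : 0 < k → W ≤ m → m + W ≤ h → Rare k w F (Confined F w m) 2
    Rare-confined 0<k W≤m m+W≤h = Rare-gain
      (Code-⊆ classify (Code-× (Code-known known) (Code-× (Code-interval m w)
        (Code-× (Code-interval (h ∸ 2 * w) (2 * w)) (Code-× (Code-^ W linkedPair)
          (Code-× (Code-interval (h + W) (m ∸ W)) (Code-interval (h + m + W) rest)))))))
      (gain (begin
        suc k ^ w * (M * M)                  ≤⟨ *-monoʳ-≤ (suc k ^ w) (*-mono-≤ M≤ M≤) ⟩
        suc k ^ w * (2 ^ (F ∸ h ∸ w) * 2 ^ (F ∸ h ∸ w))  ≤⟨ *-monoˡ-≤ _ (^-monoˡ-≤ w (suc≤2* 0<k)) ⟩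
        (k * 2) ^ w * (2 ^ (F ∸ h ∸ w) * 2 ^ (F ∸ h ∸ w))
          ≡⟨ cong₂ _*_ (^-distribʳ-* w k 2) (sym (^-distribˡ-+-* 2 (F ∸ h ∸ w) (F ∸ h ∸ w))) ⟩
        k ^ w * 2 ^ w * 2 ^ (F ∸ h ∸ w + (F ∸ h ∸ w))
          ≡⟨ trans (*-assoc (k ^ w) _ _) (cong (k ^ w *_) (sym (^-distribˡ-+-* 2 w _))) ⟩
        k ^ w * 2 ^ (w + (F ∸ h ∸ w + (F ∸ h ∸ w)))      ≤⟨ *-monoʳ-≤ (k ^ w) (^-monoʳ-≤ 2 exponent) ⟩
        k ^ w * 2 ^ suc F                                ∎))
      where
      open ≤-Reasoning
      suc≤2* : ∀ {k} → 0 < k → suc k ≤ k * 2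
      suc≤2* {k} 0<k = ≤-trans (+-monoˡ-≤ k 0<k) (≤-trans (≤-reflexive (cong (k +_) (sym (+-identityʳ k)))) (≤-reflexive (*-comm 2 k)))
      M = 1 * (2 ^ w * (2 ^ (2 * w) * (3 ^ W * (2 ^ (m ∸ W) * 2 ^ rest))))
      h+m+W≤F : h + m + W ≤ F
      h+m+W≤F = ≤-trans (≤-reflexive (+-assoc h m W)) (≤-trans (+-monoʳ-≤ h m+W≤h) h+h≤F)
      W≡ : W ≡ 5 * (2 * w)
      W≡ = *-assoc 5 2 w
      3^≤2^ : 3 ^ W ≤ 2 ^ (16 * w)
      3^≤2^ = begin
        3 ^ W                ≡⟨ cong (3 ^_) W≡ ⟩
        3 ^ (5 * (2 * w))    ≡⟨ sym (^-*-assoc 3 5 (2 * w)) ⟩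
        243 ^ (2 * w)        ≤⟨ ^-monoˡ-≤ (2 * w) (≤ᵇ⇒≤ 243 256 _) ⟩
        256 ^ (2 * w)        ≡⟨ ^-*-assoc 2 8 (2 * w) ⟩
        2 ^ (8 * (2 * w))    ≡⟨ cong (2 ^_) (sym (*-assoc 8 2 w)) ⟩
        2 ^ (16 * w)         ∎
      w≤F∸h : w ≤ F ∸ h
      w≤F∸h = ≤-trans (≤-trans (m≤m+n w (9 * w)) W≤m) (≤-trans (≤-trans (m≤m+n m W) m+W≤h) (≤-trans (≤-reflexive (sym (m+n∸n≡m h h))) (∸-monoˡ-≤ h h+h≤F)))
      total : w + (2 * w + (16 * w + (m ∸ W + rest))) ≡ F ∸ h ∸ w
      total = sym (trans (cong (_∸ w) (trans (cong (_∸ h) (trans (sym (m+[n∸m]≡n h+m+W≤F))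
          (trans (cong (λ n → h + n + W + rest) (sym (m+[n∸m]≡n W≤m))) (reorder (m ∸ W) rest)))) (m+n∸m≡n h _)))
          (m+n∸m≡n w _))
        where
        reorder : ∀ g r → h + (10 * w + g) + 10 * w + r ≡ h + (w + (w + (2 * w + (16 * w + (g + r)))))
        reorder g r = solve (h ∷ w ∷ g ∷ r ∷ [])
      M≤ : M ≤ 2 ^ (F ∸ h ∸ w)
      M≤ = begin
        M ≡⟨ *-identityˡ _ ⟩
        2 ^ w * (2 ^ (2 * w) * (3 ^ W * (2 ^ (m ∸ W) * 2 ^ rest)))
          ≤⟨ *-monoʳ-≤ (2 ^ w) (*-monoʳ-≤ (2 ^ (2 * w)) (*-monoˡ-≤ _ 3^≤2^)) ⟩
        2 ^ w * (2 ^ (2 * w) * (2 ^ (16 * w) * (2 ^ (m ∸ W) * 2 ^ rest)))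
          ≡⟨ cong (λ x → 2 ^ w * (2 ^ (2 * w) * (2 ^ (16 * w) * x))) (sym (^-distribˡ-+-* 2 (m ∸ W) rest)) ⟩
        2 ^ w * (2 ^ (2 * w) * (2 ^ (16 * w) * 2 ^ (m ∸ W + rest)))
          ≡⟨ cong (λ x → 2 ^ w * (2 ^ (2 * w) * x)) (sym (^-distribˡ-+-* 2 (16 * w) _)) ⟩
        2 ^ w * (2 ^ (2 * w) * 2 ^ (16 * w + (m ∸ W + rest)))
          ≡⟨ cong (2 ^ w *_) (sym (^-distribˡ-+-* 2 (2 * w) _)) ⟩
        2 ^ w * 2 ^ (2 * w + (16 * w + (m ∸ W + rest)))  ≡⟨ sym (^-distribˡ-+-* 2 w _) ⟩
        2 ^ (w + (2 * w + (16 * w + (m ∸ W + rest))))    ≡⟨ cong (2 ^_) total ⟩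
        2 ^ (F ∸ h ∸ w) ∎
      exponent : w + (F ∸ h ∸ w + (F ∸ h ∸ w)) ≤ suc F
      exponent = ≤-trans (+-monoˡ-≤ _ (m≤n+m w w)) (≤-trans (≤-reflexive (trans (reorder (F ∸ h ∸ w))
          (cong (2 *_) (m+[n∸m]≡n w≤F∸h)))) (F∸h≤ {F} {h} F≤h+h h+h≤F))
        where
        reorder : ∀ g → w + w + (g + g) ≡ 2 * (w + g)
        reorder g = solve (w ∷ g ∷ [])
      Known : Pred ℕ 0ℓ
      Known x = x ≡ 0 ⊎ (0 < x × x < m) ⊎ (m + w ≤ x × 2 * x + 4 * w ≤ F)
      known : ∀ {s s′} → Confined F w m s → Confined F w m s′ → ∀ {x} → Known x → s x ≡ s′ x
      known p p′ (inj₁ refl) = T⇒≡ (0∈ (semigroup (isLeast p))) (0∈ (semigroup (isLeast p′)))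
      known p p′ (inj₂ (inj₁ (0<x , x<m))) = ¬T⇒≡ (least (isLeast p) 0<x x<m) (least (isLeast p′) 0<x x<m)
      known p p′ (inj₂ (inj₂ (a , b))) = ¬T⇒≡ (gap p a b) (gap p′ a b)
      linkedPair : ∀ i → i < W → Code ((_≡ h + i) ∪ (_≡ h + i + m)) (Confined F w m) 3
      linkedPair i _ = Code-if (h + i)
        (Code-full λ where
          (p , x∈) (inj₁ refl) → x∈
          (p , x∈) (inj₂ refl) → closed (semigroup (isLeast p)) (h + i) m x∈ (m∈ (isLeast p)))
        (Code-× (Code-empty λ where (_ , x∉) refl → x∉) (Code-free _))
      Rest : Pred ℕ 0ℓ
      Rest = Interval m w ∪ (Interval (h ∸ 2 * w) (2 * w) ∪ (⋃ W (λ i → (_≡ h + i) ∪ (_≡ h + i + m))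
               ∪ (Interval (h + W) (m ∸ W) ∪ Interval (h + m + W) rest)))
      2w≤h : 2 * w ≤ h
      2w≤h = ≤-trans (*-monoˡ-≤ w (m≤m+n 2 8)) (≤-trans W≤m (≤-trans (m≤m+n m W) m+W≤h))
      classify : (_< F) ⊆ Known ∪ Rest
      classify {zero} _ = inj₁ (inj₁ refl)
      classify {x@(suc _)} x<F with x <? m | x <? m + w | x <? h ∸ 2 * w | x <? h | x <? h + W | x <? h + m | x <? h + m + W
      ... | yes a | _ | _ | _ | _ | _ | _ = inj₁ (inj₂ (inj₁ (s≤s z≤n , a)))
      ... | no a | yes b | _ | _ | _ | _ | _ = inj₂ (inj₁ (∈-Interval (≮⇒≥ a) b))
      ... | no _ | no b | yes c | _ | _ | _ | _ = inj₁ (inj₂ (inj₂ (≮⇒≥ b , (begin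
              2 * x + 4 * w                ≡⟨ reorder x ⟩
              (x + 2 * w) + (x + 2 * w)    ≤⟨ +-mono-≤ x+2w≤h x+2w≤h ⟩
              h + h                        ≤⟨ h+h≤F ⟩
              F                            ∎))))
        where
        x+2w≤h : x + 2 * w ≤ h
        x+2w≤h = ≤-trans (+-monoˡ-≤ (2 * w) (<⇒≤ c)) (≤-reflexive (m∸n+n≡m 2w≤h))
        reorder : ∀ x → 2 * x + 4 * w ≡ (x + 2 * w) + (x + 2 * w)
        reorder x = solve (x ∷ w ∷ [])
      ... | no _ | no _ | no c | yes d | _ | _ | _ = inj₂ (inj₂ (inj₁ (∈-Interval (≮⇒≥ c)
              (<-≤-trans d (≤-reflexive (sym (m∸n+n≡m 2w≤h)))))))
      ... | no _ | no _ | no _ | no d | yes e | _ | _ with ∈-Interval (≮⇒≥ d) e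
      ...   | i , i< , x≡ = inj₂ (inj₂ (inj₂ (inj₁ (i , i< , inj₁ x≡))))
      classify {x@(suc _)} x<F | no _ | no _ | no _ | no _ | no e | yes f | _ = inj₂ (inj₂ (inj₂ (inj₂ (inj₁ (∈-Interval (≮⇒≥ e)
              (<-≤-trans f (≤-reflexive (trans (cong (h +_) (sym (m+[n∸m]≡n W≤m))) (sym (+-assoc h W (m ∸ W)))))))))))
      classify {x@(suc _)} x<F | no _ | no _ | no _ | no _ | no _ | no f | yes g with ∈-Interval (≮⇒≥ f) g
      ...   | i , i< , x≡ = inj₂ (inj₂ (inj₂ (inj₁ (i , i< , inj₂ (trans x≡ (swap i))))))
        where
        swap : ∀ i → h + m + i ≡ h + i + m
        swap i = solve (h ∷ m ∷ i ∷ [])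
      classify {x@(suc _)} x<F | no _ | no _ | no _ | no _ | no _ | no _ | no g = inj₂ (inj₂ (inj₂ (inj₂ (inj₂
              (∈-Interval (≮⇒≥ g) (<-≤-trans x<F (≤-reflexive (sym (m+[n∸m]≡n h+m+W≤F)))))))))

  -- Large deviations

  bernoulli : ∀ k j → (k + j) * k ^ j ≤ k * suc k ^ j
  bernoulli k zero    = ≤-reflexive (cong (_* 1) (+-identityʳ k))
  bernoulli k (suc j) = begin
    (k + suc j) * (k * k ^ j)         ≡⟨ sym (*-assoc (k + suc j) k (k ^ j)) ⟩
    (k + suc j) * k * k ^ j           ≤⟨ *-monoˡ-≤ (k ^ j) (linear j (≤-refl {0}) (poly k j)) ⟩
    suc k * (k + j) * k ^ j           ≡⟨ *-assoc (suc k) (k + j) (k ^ j) ⟩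
    suc k * ((k + j) * k ^ j)         ≤⟨ *-monoʳ-≤ (suc k) (bernoulli k j) ⟩
    suc k * (k * suc k ^ j)           ≡⟨ swap (suc k) k (suc k ^ j) ⟩
    k * (suc k * suc k ^ j)           ∎
    where
    open ≤-Reasoning
    poly : ∀ k j → (k + suc j) * k + 0 + j ≡ suc k * (k + j) + 0
    poly k j = solve (k ∷ j ∷ [])
    swap : ∀ a b c → a * (b * c) ≡ b * (a * c)
    swap a b c = solve (a ∷ b ∷ c ∷ [])

  -- With `b = j + c` this is `(1 + 1 / b) ^ j ≤ b / (b - j)`, the upper estimate that complements
  -- `bernoulli`. For `b = κ₄` and `j = 4 k` the right side becomes `(k + 1) / k`.
  bernoulli′ : ∀ c j → suc (j + c) ^ j * c ≤ (j + c) ^ j * (j + c)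
  bernoulli′ c zero    = ≤-refl
  bernoulli′ c (suc j) = begin
    suc b * suc b ^ j * c            ≡⟨ swap (suc b) (suc b ^ j) c ⟩
    suc b ^ j * (suc b * c)          ≤⟨ *-monoʳ-≤ (suc b ^ j) (linear (suc j) (≤-refl {0}) poly) ⟩
    suc b ^ j * (suc c * b)          ≡⟨ sym (*-assoc (suc b ^ j) (suc c) b) ⟩
    suc b ^ j * suc c * b
      ≤⟨ *-monoˡ-≤ b (subst (λ n → suc n ^ j * suc c ≤ n ^ j * n) (+-suc j c) (bernoulli′ (suc c) j)) ⟩
    b ^ j * b * b                    ≡⟨ cong (_* b) (*-comm (b ^ j) b) ⟩
    b * b ^ j * b                    ∎
    where
    open ≤-Reasoning
    b = suc (j + c)
    poly : suc (suc (j + c)) * c + 0 + suc j ≡ suc c * suc (j + c) + 0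
    poly = solve (j ∷ c ∷ [])
    swap : ∀ a b c → a * b * c ≡ b * (a * c)
    swap a b c = solve (a ∷ b ∷ c ∷ [])

  module _ (k : ℕ) .{{_ : NonZero k}} where

    private
      κ₄ = 4 * (k * suc k)

      0<κ₄ : 0 < κ₄
      0<κ₄ = ≤-trans (>-nonZero⁻¹ k) (≤-trans (m≤m*n k (suc k)) (m≤n*m (k * suc k) 4))

      -- (1 + 1 / 4 k (k + 1)) ^ (4 k) ≤ 1 + 1 / k
      spread : suc κ₄ ^ (4 * k) * k ≤ κ₄ ^ (4 * k) * suc k
      spread = *-cancelˡ-≤ (4 * k) {{m*n≢0 4 k}} (begin
        4 * k * (suc κ₄ ^ (4 * k) * k)      ≡⟨ swap (suc κ₄ ^ (4 * k)) ⟩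
        suc κ₄ ^ (4 * k) * (4 * k * k)
          ≤⟨ subst (λ b → suc b ^ (4 * k) * (4 * k * k) ≤ b ^ (4 * k) * b) κ₄≡ (bernoulli′ (4 * k * k) (4 * k)) ⟩
        κ₄ ^ (4 * k) * κ₄                   ≡⟨ swap′ (κ₄ ^ (4 * k)) ⟩
        4 * k * (κ₄ ^ (4 * k) * suc k)      ∎)
        where
        open ≤-Reasoning
        swap : ∀ x → 4 * k * (x * k) ≡ x * (4 * k * k)
        swap x = solve (k ∷ x ∷ [])
        swap′ : ∀ x → x * (4 * (k * suc k)) ≡ 4 * k * (x * suc k)
        swap′ x = solve (k ∷ x ∷ [])
        κ₄≡ : 4 * k + 4 * k * k ≡ 4 * (k * suc k)
        κ₄≡ = solve (k ∷ [])

      spread-^ : ∀ {N t} → N ≤ 4 * k * t → suc κ₄ ^ N * k ^ t ≤ κ₄ ^ N * suc k ^ t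
      spread-^ {N} {t} N≤ with m≤n⇒∃[o]m+o≡n N≤
      ... | r , N+r≡ = *-cancelˡ-≤ (κ₄ ^ r) {{m^n≢0 κ₄ r {{>-nonZero 0<κ₄}}}} (begin
        κ₄ ^ r * (suc κ₄ ^ N * k ^ t)          ≤⟨ *-monoˡ-≤ _ (^-monoˡ-≤ r (n≤1+n κ₄)) ⟩
        suc κ₄ ^ r * (suc κ₄ ^ N * k ^ t)      ≡⟨ merge (suc κ₄) k ⟩
        (suc κ₄ ^ (4 * k) * k) ^ t             ≤⟨ ^-monoˡ-≤ t spread ⟩
        (κ₄ ^ (4 * k) * suc k) ^ t             ≡⟨ sym (merge κ₄ (suc k)) ⟩
        κ₄ ^ r * (κ₄ ^ N * suc k ^ t)          ∎)
        where
        open ≤-Reasoning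
        merge : ∀ x y → x ^ r * (x ^ N * y ^ t) ≡ (x ^ (4 * k) * y) ^ t
        merge x y = trans (sym (*-assoc (x ^ r) (x ^ N) (y ^ t))) (trans (cong (_* y ^ t)
          (trans (*-comm (x ^ r) (x ^ N)) (trans (sym (^-distribˡ-+-* x N r)) (trans (cong (x ^_) N+r≡) (sym (^-*-assoc x (4 * k) t))))))
          (sym (^-distribʳ-* t (x ^ (4 * k)) y)))

    2*k^k≤ : 2 * k ^ k ≤ suc k ^ k
    2*k^k≤ = *-cancelˡ-≤ k (≤-trans (≤-reflexive (reorder (k ^ k))) (bernoulli k k))
      where
      reorder : ∀ x → k * (2 * x) ≡ (k + k) * x
      reorder x = solve (k ∷ x ∷ [])

    -- As `(1 + 1 / k) ^ k ≥ 2`, every `k` units of gain pay for one factor 2 in the square of the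
    -- count.
    Gain-trade : ∀ {w j M n} → Gain k (w + k * j) M (j + n) → Gain k w M n
    Gain-trade {w} {j} {M} {n} (gain g) = gain (*-cancelˡ-≤ (2 ^ j * (k ^ k) ^ j) {{m*n≢0 _ _ {{m^n≢0 2 j}} {{m^n≢0 (k ^ k) j {{m^n≢0 k k}}}}}} (begin
      2 ^ j * (k ^ k) ^ j * (suc k ^ w * (M * M))    ≡⟨ cong (_* (suc k ^ w * (M * M))) (sym (^-distribʳ-* j 2 (k ^ k))) ⟩
      (2 * k ^ k) ^ j * (suc k ^ w * (M * M))        ≤⟨ *-monoˡ-≤ _ (^-monoˡ-≤ j 2*k^k≤) ⟩
      (suc k ^ k) ^ j * (suc k ^ w * (M * M))        ≡⟨ merge (suc k) (M * M) ⟩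
      suc k ^ (w + k * j) * (M * M)                  ≤⟨ g ⟩
      k ^ (w + k * j) * 2 ^ (j + n)                  ≡⟨ cong (k ^ (w + k * j) *_) (^-distribˡ-+-* 2 j n) ⟩
      k ^ (w + k * j) * (2 ^ j * 2 ^ n)              ≡⟨ sym (merge k (2 ^ j * 2 ^ n)) ⟩
      (k ^ k) ^ j * (k ^ w * (2 ^ j * 2 ^ n))        ≡⟨ reorder ((k ^ k) ^ j) (k ^ w) (2 ^ j) (2 ^ n) ⟩
      2 ^ j * (k ^ k) ^ j * (k ^ w * 2 ^ n)          ∎))
      where
      open ≤-Reasoning
      merge : ∀ x y → (x ^ k) ^ j * (x ^ w * y) ≡ x ^ (w + k * j) * y
      merge x y = trans (sym (*-assoc ((x ^ k) ^ j) (x ^ w) y)) (cong (_* y) (trans (*-comm ((x ^ k) ^ j) (x ^ w))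
        (trans (cong (x ^ w *_) (^-*-assoc x k j)) (sym (^-distribˡ-+-* x w (k * j))))))
      reorder : ∀ a b c d → a * (b * (c * d)) ≡ c * a * (b * d)
      reorder a b c d = solve (a ∷ b ∷ c ∷ d ∷ [])

    -- The Chernoff estimate for the number `D` of words with at least `q` hits. After squaring, the
    -- base on the right is `(2 k + 1) ^ 2 = κ₄ + 1`. Division by `(k (k + 1)) ^ N` bounds
    -- `D ^ 2 ((k + 1) / k) ^ (2 q - N)` by `4 ^ N (1 + 1 / κ₄) ^ N`. By `spread-^` the last factor
    -- uses up `t` of the `2 q - N ≥ t + e` powers, and at least `e` are left as gain.
    Gain-deviation : ∀ {D N q t e} → D * (suc k ^ q * k ^ (N ∸ q)) ≤ suc (2 * k) ^ N →
                     q ≤ N → N + (t + e) ≤ 2 * q → N ≤ 4 * k * t → Gain k e D (2 * N)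
    Gain-deviation {D} {N} {q} {t} {e} D≤ q≤N N+≤ N≤ with m≤n⇒∃[o]m+o≡n q≤N | m≤n⇒∃[o]m+o≡n N+≤
    ... | z , refl | o , 2q≡ = Gain-e k (m≤m+n e o) (gain (*-cancelˡ-≤ (κ₄ ^ N * suc k ^ t) {{m*n≢0 _ _ {{m^n≢0 κ₄ N {{>-nonZero 0<κ₄}}}} {{m^n≢0 (suc k) t}}}} (begin
      κ₄ ^ N * suc k ^ t * (suc k ^ r * (D * D))
        ≡⟨ cong (λ x → x * suc k ^ t * (suc k ^ r * (D * D))) (trans (^-distribʳ-* N 4 (k * suc k)) (cong (4 ^ N *_) (^-distribʳ-* N k (suc k)))) ⟩
      4 ^ N * (k ^ N * suc k ^ N) * suc k ^ t * (suc k ^ r * (D * D))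
        ≡⟨ regroup (4 ^ N) (k ^ N) (suc k ^ N) (suc k ^ t) (suc k ^ r) D ⟩
      4 ^ N * (D * D * (suc k ^ N * (suc k ^ t * suc k ^ r) * k ^ N))
        ≡⟨ cong (λ x → 4 ^ N * (D * D * x)) (cong₂ _*_ up (trans (cong (k ^_) N≡) (^-distribˡ-+-* k (z + z) (t + r)))) ⟩
      4 ^ N * (D * D * (suc k ^ q * suc k ^ q * (k ^ (z + z) * k ^ (t + r))))
        ≡⟨ cong (λ x → 4 ^ N * (D * D * (suc k ^ q * suc k ^ q * (x * k ^ (t + r))))) (^-distribˡ-+-* k z z) ⟩
      4 ^ N * (D * D * (suc k ^ q * suc k ^ q * (k ^ z * k ^ z * k ^ (t + r))))
        ≡⟨ squares (4 ^ N) D (suc k ^ q) (k ^ z) (k ^ (t + r)) ⟩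
      4 ^ N * (D * (suc k ^ q * k ^ z) * (D * (suc k ^ q * k ^ z)) * k ^ (t + r))
        ≤⟨ *-monoʳ-≤ (4 ^ N) (*-monoˡ-≤ (k ^ (t + r)) (*-mono-≤ D≤′ D≤′)) ⟩
      4 ^ N * (suc (2 * k) ^ N * suc (2 * k) ^ N * k ^ (t + r))
        ≡⟨ cong₂ (λ x y → 4 ^ N * (x * y)) (trans (sq-^ (suc (2 * k)) N) (cong (_^ N) poly)) (^-distribˡ-+-* k t r) ⟩
      4 ^ N * (suc κ₄ ^ N * (k ^ t * k ^ r))        ≡⟨ regroup₂ (4 ^ N) (suc κ₄ ^ N) (k ^ t) (k ^ r) ⟩
      suc κ₄ ^ N * k ^ t * (k ^ r * 4 ^ N)          ≤⟨ *-monoˡ-≤ _ (spread-^ N≤) ⟩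
      κ₄ ^ N * suc k ^ t * (k ^ r * 4 ^ N)          ≡⟨ cong (λ x → κ₄ ^ N * suc k ^ t * (k ^ r * x)) (^-*-assoc 2 2 N) ⟩
      κ₄ ^ N * suc k ^ t * (k ^ r * 2 ^ (2 * N))    ∎)))
      where
      open ≤-Reasoning
      r = e + o
      D≤′ : D * (suc k ^ q * k ^ z) ≤ suc (2 * k) ^ N
      D≤′ = subst (λ n → D * (suc k ^ q * k ^ n) ≤ suc (2 * k) ^ N) (m+n∸m≡n q z) D≤
      N+r≡ : N + (t + r) ≡ q + q
      N+r≡ = trans (reorder N t e o) (trans 2q≡ (cong (q +_) (+-identityʳ q)))
        where
        reorder : ∀ n t e o → n + (t + (e + o)) ≡ n + (t + e) + o
        reorder n t e o = solve (n ∷ t ∷ e ∷ o ∷ [])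
      N≡ : q + z ≡ z + z + (t + r)
      N≡ = +-cancelˡ-≡ q _ _ (trans (sym (+-assoc q q z)) (trans (cong (_+ z) (sym N+r≡)) (reorder q z (t + r))))
        where
        reorder : ∀ q z x → q + z + x + z ≡ q + (z + z + x)
        reorder q z x = solve (q ∷ z ∷ x ∷ [])
      up : suc k ^ N * (suc k ^ t * suc k ^ r) ≡ suc k ^ q * suc k ^ q
      up = trans (cong (suc k ^ N *_) (sym (^-distribˡ-+-* (suc k) t r))) (trans (sym (^-distribˡ-+-* (suc k) N (t + r)))
        (trans (cong (suc k ^_) N+r≡) (^-distribˡ-+-* (suc k) q q)))
      poly : suc (2 * k) * suc (2 * k) ≡ suc (4 * (k * suc k))
      poly = solve (k ∷ [])
      regroup : ∀ a b c d e f → a * (b * c) * d * (e * (f * f)) ≡ a * (f * f * (c * (d * e) * b))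
      regroup a b c d e f = solve (a ∷ b ∷ c ∷ d ∷ e ∷ f ∷ [])
      squares : ∀ a d x y z → a * (d * d * (x * x * (y * y * z))) ≡ a * (d * (x * y) * (d * (x * y)) * z)
      squares a d x y z = solve (a ∷ d ∷ x ∷ y ∷ z ∷ [])
      regroup₂ : ∀ a b c d → a * (b * (c * d)) ≡ b * c * (d * a)
      regroup₂ a b c d = solve (a ∷ b ∷ c ∷ d ∷ [])

  hit : Bool → Bool → ℕ
  hit true  true  = 1
  hit false false = 1
  hit _     _     = 0

  tally : Bool → Subset → ℕ → ℕ → ℕ
  tally b s a zero    = 0
  tally b s a (suc n) = hit b (s a) + tally b s (suc a) n

  tally-sum : ∀ s a n → tally true s a n + tally false s a n ≡ n
  tally-sum s a zero    = refl
  tally-sum s a (suc n) with s a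
  ... | true  = cong suc (tally-sum s (suc a) n)
  ... | false = trans (+-suc _ _) (cong suc (tally-sum s (suc a) n))

  tally≤ : ∀ b s a n → tally b s a n ≤ n
  tally≤ true  s a n = ≤-trans (m≤m+n _ _) (≤-reflexive (tally-sum s a n))
  tally≤ false s a n = ≤-trans (m≤n+m _ _) (≤-reflexive (tally-sum s a n))

  occurrences : Bool → ∀ {n} → Vec Bool n → ℕ
  occurrences b Vec.[]      = 0
  occurrences b (c Vec.∷ v) = hit b c + occurrences b v

  positions : ℕ → ∀ n → Vec ℕ n
  positions a zero    = Vec.[]
  positions a (suc n) = a Vec.∷ positions (suc a) n

  occurrences-positions : ∀ b s a n → occurrences b (Vec.map s (positions a n)) ≡ tally b s a n
  occurrences-positions b s a zero    = refl
  occurrences-positions b s a (suc n) = cong (hit b (s a) +_) (occurrences-positions b s (suc a) n)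

  ∈-positions : ∀ {a} n {x} → Interval a n x → x Vec.∈ positions a n
  ∈-positions {a} (suc n) (zero  , _ , refl) = VecAny.here (+-identityʳ a)
  ∈-positions {a} (suc n) (suc i , s≤s i<n , refl) = VecAny.there (∈-positions n (i , i<n , +-suc a i))

  markov : ∀ {A : Set} {P : A → Set} (P? : Decidable P) (f : A → ℕ) c → (∀ {x} → P x → c ≤ f x) →
           ∀ xs → length (filter P? xs) * c ≤ sum (map f xs)
  markov P? f c h []       = z≤n
  markov P? f c h (x ∷ xs) with P? x
  ... | yes p = +-mono-≤ (h p) (markov P? f c h xs)
  ... | no  _ = ≤-trans (markov P? f c h xs) (m≤n+m _ (f x))

  -- Exponential tilting: the letter b is given the weight k + 1, the other one k.
  weight : ℕ → Bool → ∀ {n} → Vec Bool n → ℕ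
  weight k b Vec.[]      = 1
  weight k b (c Vec.∷ v) = (hit b c + k) * weight k b v

  sum-weight : ∀ k b n → sum (map (weight k b) (words n)) ≡ suc (2 * k) ^ n
  sum-weight k b zero    = refl
  sum-weight k b (suc n) = begin
    sum (map (weight k b) (map (true Vec.∷_) (words n) ++ map (false Vec.∷_) (words n) ++ []))
      ≡⟨ cong sum (map-++ (weight k b) (map (true Vec.∷_) (words n)) _) ⟩
    sum (map (weight k b) (map (true Vec.∷_) (words n)) ++ map (weight k b) (map (false Vec.∷_) (words n) ++ []))
      ≡⟨ sum-++ (map (weight k b) (map (true Vec.∷_) (words n))) _ ⟩
    sum (map (weight k b) (map (true Vec.∷_) (words n))) + sum (map (weight k b) (map (false Vec.∷_) (words n) ++ []))
      ≡⟨ cong (λ x → sum (map (weight k b) (map (true Vec.∷_) (words n))) + sum x) (map-++ (weight k b) (map (false Vec.∷_) (words n)) []) ⟩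
    sum (map (weight k b) (map (true Vec.∷_) (words n))) + sum (map (weight k b) (map (false Vec.∷_) (words n)) ++ [])
      ≡⟨ cong (sum (map (weight k b) (map (true Vec.∷_) (words n))) +_)
           (trans (sum-++ (map (weight k b) (map (false Vec.∷_) (words n))) []) (+-identityʳ _)) ⟩
    sum (map (weight k b) (map (true Vec.∷_) (words n))) + sum (map (weight k b) (map (false Vec.∷_) (words n)))
      ≡⟨ cong₂ _+_ (first true (words n)) (first false (words n)) ⟩
    (hit b true + k) * Σ + (hit b false + k) * Σ
      ≡⟨ both b Σ ⟩
    suc (2 * k) * Σ
      ≡⟨ cong (suc (2 * k) *_) (sum-weight k b n) ⟩
    suc (2 * k) * suc (2 * k) ^ n ∎
    where
    open ≡-Reasoning
    Σ = sum (map (weight k b) (words n))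
    first : ∀ c (vs : List (Vec Bool n)) → sum (map (weight k b) (map (c Vec.∷_) vs)) ≡ (hit b c + k) * sum (map (weight k b) vs)
    first c []       = sym (*-zeroʳ (hit b c + k))
    first c (v ∷ vs) = trans (cong (weight k b (c Vec.∷ v) +_) (first c vs)) (sym (*-distribˡ-+ (hit b c + k) (weight k b v) _))
    both : ∀ b x → (hit b true + k) * x + (hit b false + k) * x ≡ suc (2 * k) * x
    both true  x = solve (k ∷ x ∷ [])
    both false x = solve (k ∷ x ∷ [])

  weight≥ : ∀ k b {n} q (v : Vec Bool n) → q ≤ occurrences b v → suc k ^ q * k ^ (n ∸ q) ≤ weight k b v
  weight≥ k b zero    Vec.[]      _ = ≤-refl
  weight≥ k b {suc n} zero (c Vec.∷ v) _ = ≤-trans (≤-reflexive (*-identityˡ (k * k ^ n)))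
    (*-mono-≤ (m≤n+m k (hit b c)) (≤-trans (≤-reflexive (sym (*-identityˡ (k ^ n)))) (weight≥ k b zero v z≤n)))
  weight≥ k b {suc n} (suc q) (c Vec.∷ v) h with hit b c in e
  ... | suc m = ≤-trans (≤-reflexive (*-assoc (suc k) (suc k ^ q) _))
      (*-mono-≤ (s≤s (m≤n+m k m)) (weight≥ k b q v (≤-trans (s≤s⁻¹ (≤-trans h (+-monoˡ-≤ _ (hit≤1 e)))) ≤-refl)))
    where
    hit≤1 : ∀ {b c m} → hit b c ≡ suc m → suc m ≤ 1
    hit≤1 {true}  {true}  refl = ≤-refl
    hit≤1 {false} {false} refl = ≤-refl
  ... | zero = ≤-trans (≤-reflexive (trans (cong (λ x → suc k ^ suc q * k ^ x) (+-∸-assoc 1 {n} {suc q} (≤-trans h (occurrences≤ v))))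
          (swap (suc k ^ suc q) k (k ^ (n ∸ suc q)))))
        (*-monoʳ-≤ k (weight≥ k b (suc q) v h))
    where
    swap : ∀ a b c → a * (b * c) ≡ b * (a * c)
    swap a b c = solve (a ∷ b ∷ c ∷ [])
    hit≤1 : ∀ b c → hit b c ≤ 1
    hit≤1 true  true  = ≤-refl
    hit≤1 false false = ≤-refl
    hit≤1 true  false = z≤n
    hit≤1 false true  = z≤n
    occurrences≤ : ∀ {n} (v : Vec Bool n) → occurrences b v ≤ n
    occurrences≤ Vec.[]      = z≤n
    occurrences≤ (c Vec.∷ v) = +-mono-≤ (hit≤1 b c) (occurrences≤ v)

  -- A shortage of elements is expressed as an excess of the letter `false`, so that one upper tail
  -- estimate serves both directions.
  record Deviant (F l h N t : ℕ) (b : Bool) (s : Subset) : Set where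
    field
      zero∈     : T (s 0)
      gap       : ∀ {x} → 0 < x → x < l → ¬ T (s x)
      deviation : N + t ≤ 2 * tally b s h N

  module _ {k w F h N t₁ : ℕ} .{{_ : NonZero k}} (h+h≤F : h + h ≤ F) (F≤h+h : F ≤ suc (h + h)) where

    private
      W = 10 * w
      t = t₁ + (w + k * (2 * W))

    Rare-deviant : ∀ b → W ≤ h → h + N ≤ F → N ≤ 4 * k * t₁ → t ≤ N → Rare k w F (Deviant F (h ∸ W) h N t b) 2
    Rare-deviant b W≤h h+N≤F N≤ t≤N = Rare-gain
      (Code-⊆ classify (Code-× (Code-known known) (Code-× (Code-interval (h ∸ W) W)
        (Code-× (Code-⊆ (∈-positions N) (Code-table (positions h N) table in-table))
                (Code-interval (h + N) (F ∸ (h + N)))))))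
      (Gain-trade k {w} {2 * W} (Gain-mono k (≤-reflexive (*-identityˡ _)) total
        (Gain-* k (Gain-2^ k W) (Gain-e k (m≤m+n (w + k * (2 * W)) 0)
          (Gain-* k (Gain-deviation k {length table} {N} {q} {t₁} D≤ q≤N N+t≤2q N≤) (Gain-2^ k (F ∸ (h + N))))))))
      where
      q = ⌈ N + t /2⌉
      q≤? : ∀ (v : Vec Bool N) → _
      q≤? v = q ≤? occurrences b v
      table : List (Vec Bool N)
      table = filter q≤? (words N)
      q≤N : q ≤ N
      q≤N = ≤-trans (⌈n/2⌉-mono (+-monoʳ-≤ N t≤N)) (≤-reflexive (sym (n≡⌈n+n/2⌉ N)))
      N+t≤2q : N + t ≤ 2 * q
      N+t≤2q = ≤-trans (≤-reflexive (sym (⌊n/2⌋+⌈n/2⌉≡n (N + t)))) (≤-trans (+-monoˡ-≤ q (⌊n/2⌋≤⌈n/2⌉ (N + t)))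
        (≤-reflexive (cong (q +_) (sym (+-identityʳ q)))))
      D≤ : length table * (suc k ^ q * k ^ (N ∸ q)) ≤ suc (2 * k) ^ N
      D≤ = ≤-trans (markov q≤? (weight k b) _ (λ {v} → weight≥ k b q v) (words N)) (≤-reflexive (sum-weight k b N))
      in-table : ∀ {s} → Deviant F (h ∸ W) h N t b s → Vec.map s (positions h N) ∈ table
      in-table {s} p = ∈-filter⁺ q≤? (∈-words _) (subst (q ≤_) (sym (occurrences-positions b s h N))
        (≤-trans (⌈n/2⌉-mono (Deviant.deviation p)) (≤-reflexive (trans (cong (λ x → ⌈ tally b s h N + x /2⌉) (+-identityʳ _)) (sym (n≡⌈n+n/2⌉ _))))))
      total : 2 * W + (2 * N + 2 * (F ∸ (h + N))) ≤ 2 * W + suc F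
      total = ≤-trans (≤-reflexive (reorder W N (F ∸ (h + N)))) (+-monoʳ-≤ (2 * W)
        (≤-trans (≤-reflexive (cong (2 *_) (trans (cong (N +_) (sym (∸-+-assoc F h N)))
          (m+[n∸m]≡n (≤-trans (≤-reflexive (sym (m+n∸m≡n h N))) (∸-monoˡ-≤ h h+N≤F)))))) (F∸h≤ {F} {h} F≤h+h h+h≤F)))
        where
        reorder : ∀ a b c → 2 * a + (2 * b + 2 * c) ≡ 2 * a + 2 * (b + c)
        reorder a b c = solve (a ∷ b ∷ c ∷ [])
      Known : Pred ℕ 0ℓ
      Known x = x ≡ 0 ⊎ (0 < x × x < h ∸ W)
      known : ∀ {s s′} → Deviant F (h ∸ W) h N t b s → Deviant F (h ∸ W) h N t b s′ → ∀ {x} → Known x → s x ≡ s′ x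
      known p p′ (inj₁ refl)          = T⇒≡ (Deviant.zero∈ p) (Deviant.zero∈ p′)
      known p p′ (inj₂ (0<x , x<))    = ¬T⇒≡ (Deviant.gap p 0<x x<) (Deviant.gap p′ 0<x x<)
      classify : (_< F) ⊆ Known ∪ (Interval (h ∸ W) W ∪ (Interval h N ∪ Interval (h + N) (F ∸ (h + N))))
      classify {zero} _ = inj₁ (inj₁ refl)
      classify {x@(suc _)} x<F with x <? h ∸ W | x <? h | x <? h + N
      ... | yes a | _     | _     = inj₁ (inj₂ (s≤s z≤n , a))
      ... | no a  | yes c | _     = inj₂ (inj₁ (∈-Interval (≮⇒≥ a) (<-≤-trans c (≤-reflexive (sym (m∸n+n≡m W≤h))))))
      ... | no _  | no c  | yes d = inj₂ (inj₂ (inj₁ (∈-Interval (≮⇒≥ c) d)))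
      ... | no _  | no _  | no d  = inj₂ (inj₂ (inj₂ (∈-Interval (≮⇒≥ d) (<-≤-trans x<F (≤-reflexive (sym (m+[n∸m]≡n h+N≤F)))))))

  -- Atypical semigroups

  sq-cancel-≤ : ∀ {x y} → x * x ≤ y * y → x ≤ y
  sq-cancel-≤ {x} {y} h with x ≤? y
  ... | yes x≤y = x≤y
  ... | no  x≰y = contradiction h (<⇒≱ (*-mono-< (≰⇒> x≰y) (≰⇒> x≰y)))

  module _ {k w F : ℕ} where

    open Rare

    Rare-mono : ∀ {P Q c} → Q ⊆ P → Rare k w F P c → Rare k w F Q c
    Rare-mono Q⊆P r = record { coding = Code-P Q⊆P (coding r) ; small = small r }

    Rare-∅ : ∀ {P} → (∀ {s} → ¬ P s) → ∀ {c} → Rare k w F P c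
    Rare-∅ ¬P = record
      { M      = 0
      ; coding = record { code = λ p → contradiction p ¬P ; injective = λ p → contradiction p ¬P }
      ; small  = ≤-trans (≤-reflexive (*-zeroʳ (suc k ^ w))) z≤n
      }

    Rare-guard : ∀ {C : Set} {P c} → Dec C → (C → Rare k w F P c) → Rare k w F (λ s → C × P s) c
    Rare-guard (yes c) r = Rare-mono proj₂ (r c)
    Rare-guard (no ¬c) r = Rare-∅ (λ (c , _) → ¬c c)

    -- The constants add as they would without the squares: the cross term is bounded by multiplying
    -- the two squared bounds and extracting a square root.
    Rare-∪ : ∀ {P Q c d} → Rare k w F P c → Rare k w F Q d → Rare k w F (P ∪ Q) (c + d)
    Rare-∪ {P} {Q} {c} {d} r r′ = record { coding = Code-⊎ (coding r) (coding r′) ; small = begin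
        q * ((m + n) * (m + n))                          ≡⟨ expand q m n ⟩
        q * (m * m) + q * (n * n) + 2 * (q * (m * n))    ≤⟨ +-mono-≤ (+-mono-≤ (small r) (small r′)) (*-monoʳ-≤ 2 mixed) ⟩
        c * c * z + d * d * z + 2 * (c * d * z)          ≡⟨ collect c d z ⟩
        (c + d) * (c + d) * z                            ∎ }
      where
      open ≤-Reasoning
      q = suc k ^ w
      z = k ^ w * 2 ^ F
      m = M r
      n = M r′
      expand : ∀ q m n → q * ((m + n) * (m + n)) ≡ q * (m * m) + q * (n * n) + 2 * (q * (m * n))
      expand q m n = solve (q ∷ m ∷ n ∷ [])
      collect : ∀ c d z → c * c * z + d * d * z + 2 * (c * d * z) ≡ (c + d) * (c + d) * z
      collect c d z = solve (c ∷ d ∷ z ∷ [])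
      mixed : q * (m * n) ≤ c * d * z
      mixed = sq-cancel-≤ (begin
        q * (m * n) * (q * (m * n))   ≡⟨ pair q m n ⟩
        q * (m * m) * (q * (n * n))   ≤⟨ *-mono-≤ (small r) (small r′) ⟩
        c * c * z * (d * d * z)       ≡⟨ pair′ c d z ⟩
        c * d * z * (c * d * z)       ∎)
        where
        pair : ∀ q m n → q * (m * n) * (q * (m * n)) ≡ q * (m * m) * (q * (n * n))
        pair q m n = solve (q ∷ m ∷ n ∷ [])
        pair′ : ∀ c d z → c * c * z * (d * d * z) ≡ c * d * z * (c * d * z)
        pair′ c d z = solve (c ∷ d ∷ z ∷ [])

    Rare-⋃ : ∀ {P : ℕ → Pred Subset 0ℓ} {c} n → (∀ i → Rare k w F (P i) c) →
             Rare k w F (λ s → ∃[ i ] i < n × P i s) (n * c)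
    Rare-⋃ zero    r = Rare-∅ λ where (_ , () , _)
    Rare-⋃ (suc n) r = Rare-mono (λ where
        (zero  , _       , p) → inj₁ p
        (suc i , s≤s i<n , p) → inj₂ (i , i<n , p))
      (Rare-∪ (r 0) (Rare-⋃ n (λ i → r (suc i))))

  least-positive : ∀ (s : Subset) n → (∃[ m ] 0 < m × m ≤ n × T (s m) × (∀ {x} → 0 < x → x < m → ¬ T (s x)))
                                    ⊎ (∀ {x} → 0 < x → x ≤ n → ¬ T (s x))
  least-positive s zero = inj₂ λ where (s≤s _) ()
  least-positive s (suc n) with least-positive s n
  ... | inj₁ (m , 0<m , m≤n , rest) = inj₁ (m , 0<m , m≤n⇒m≤1+n m≤n , rest)
  ... | inj₂ none with T? (s (suc n))
  ...   | yes n∈ = inj₁ (suc n , s≤s z≤n , ≤-refl , n∈ , λ 0<x x< → none 0<x (s≤s⁻¹ x<))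
  ...   | no  n∉ = inj₂ go
    where
    go : ∀ {x} → 0 < x → x ≤ suc n → ¬ T (s x)
    go 0<x x≤ with m≤n⇒m<n∨m≡n x≤
    ... | inj₁ x<   = none 0<x (s≤s⁻¹ x<)
    ... | inj₂ refl = n∉

  ≤⌊/2⌋ : ∀ {x n} → x + x ≤ n → x ≤ ⌊ n /2⌋
  ≤⌊/2⌋ {x} h = ≤-trans (≤-reflexive (n≡⌊n+n/2⌋ x)) (⌊n/2⌋-mono h)

  -- The saving of `Rare-small` is exponential in the element only, so a small one is first doubled
  -- into the range from `F / 8` to `F / 4`. The argument `n` is fuel: `x` grows by at least 1
  -- whenever `n` drops.
  doubling : ∀ {F s} → Semigroup F s → ∀ n x → F < x + n → 0 < x → 4 * x ≤ F → T (s x) →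
             ∃[ m ] T (s m) × 4 * m ≤ F × F < 8 * m
  doubling S zero    x F< 0<x 4x≤F x∈ = contradiction
    (≤-trans F< (≤-trans (≤-reflexive (+-identityʳ x)) (≤-trans (m≤n*m x 4) 4x≤F))) (<-irrefl refl)
  doubling {F} S (suc n) x F< 0<x 4x≤F x∈ with F <? 8 * x
  ... | yes F<8x = x , x∈ , 4x≤F , F<8x
  ... | no  F≮8x = doubling S n (x + x) (linear 0 (F< ⊞ 0<x) (shift₁ x n)) (≤-trans 0<x (m≤m+n x x))
          (≤-trans (≤-reflexive (shift₂ x)) (≮⇒≥ F≮8x)) (closed S x x x∈ x∈)
    where
    shift₁ : ∀ x n → suc F + (x + suc n + x) + 0 ≡ x + x + n + (suc F + 1)
    shift₁ x n = solve (F ∷ x ∷ n ∷ [])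
    shift₂ : ∀ x → 4 * (x + x) ≡ 8 * x
    shift₂ x = solve (x ∷ [])

  module Classification (k : ℕ) .{{_ : NonZero k}} (15≤k : 15 ≤ k) (F h w : ℕ)
    (h+h≤F : h + h ≤ F) (F≤h+h : F ≤ suc (h + h)) (40w≤F : 40 * w ≤ F)
    (F≤ : F ≤ 4 * k * ((20 * k + 41) * w)) where

    -- t₁ absorbs the variance in the Chernoff bound, since F ≤ 4 k t₁; the rest of
    -- t compensates for the 2 ^ W possible sets of elements in [h - W, h).
    W t₁ t : ℕ
    W  = 10 * w
    t₁ = (20 * k + 41) * w
    t  = t₁ + (w + k * (2 * W))

    W≤h : W ≤ h
    W≤h = ≮⇒≥ λ h<W → 1+n≰n {0} (linear (20 * w) (40w≤F ⊞ F≤h+h ⊞ h<W ⊞ h<W) e)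
      where
      e : 1 + (F + suc (h + h) + 10 * w + 10 * w) + 20 * w ≡ 0 + (40 * w + F + suc h + suc h)
      e = solve (F ∷ h ∷ w ∷ [])

    Small Third Confined′ : ℕ → Set
    Small m     = 4 * m ≤ F × 0 < m × w ≤ m
    Third m     = 3 * m ≤ F × F < 4 * m × w ≤ F ∸ 3 * m
    Confined′ m = W ≤ m × m + W ≤ h

    Two₃ Two₂ : ℕ → ℕ → Set
    Two₃ m d = 3 * m ≤ F × F < 4 * m × w ≤ d × d + w ≤ ⌊ m ∸ (F ∸ 3 * m) /2⌋
    Two₂ m d = 2 * m ≤ F × F < 3 * m × w ≤ d × d + w ≤ ⌊ F ∸ 2 * m /2⌋

    Bounded : ℕ → Set
    Bounded N = h + N ≤ F × t ≤ N

    ∃< : ℕ → (ℕ → Pred Subset 0ℓ) → Pred Subset 0ℓ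
    ∃< n P s = ∃[ i ] i < n × P i s

    Bad : Pred Subset 0ℓ
    Bad = ∃< (suc F) (λ m s → Small m × Semigroup F s × T (s m))
        ∪ ∃< (suc F) (λ m s → Third m × Least F m s)
        ∪ ∃< (suc F) (λ m → ∃< (suc F) (λ d s → Two₃ m d × Least F m s × T (s (m + d))))
        ∪ ∃< (suc F) (λ m → ∃< (suc F) (λ d s → Two₂ m d × Least F m s × T (s (m + d))))
        ∪ ∃< (suc F) (λ m s → Confined′ m × Confined F w m s)
        ∪ ∃< (suc F) (λ N s → Bounded N × Deviant F (h ∸ W) h N t true s)
        ∪ ∃< (suc F) (λ N s → Bounded N × Deviant F (h ∸ W) h N t false s)

    cost : ℕ
    cost = n * 2 + (n * 2 + (n * (n * 2) + (n * (n * 2) + (n * 2 + (n * 2 + n * 2)))))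
      where n = suc F

    Rare-bad : Rare k w F Bad cost
    Rare-bad = Rare-∪ (Rare-⋃ (suc F) λ m → Rare-guard (4 * m ≤? F ×-dec 0 <? m ×-dec w ≤? m)
                        λ (4m≤F , 0<m , w≤m) → Rare-small 15≤k 4m≤F 0<m w≤m)
      (Rare-∪ (Rare-⋃ (suc F) λ m → Rare-guard (3 * m ≤? F ×-dec F <? 4 * m ×-dec w ≤? F ∸ 3 * m)
                λ (3m≤F , F<4m , w≤f) → Rare-third 15≤k (sym (m∸n+n≡m 3m≤F)) (rem₃ 3m≤F F<4m) w≤f)
      (Rare-∪ (Rare-⋃ (suc F) λ m → Rare-⋃ (suc F) λ d →
                Rare-guard (3 * m ≤? F ×-dec F <? 4 * m ×-dec w ≤? d ×-dec d + w ≤? ⌊ m ∸ (F ∸ 3 * m) /2⌋)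
                λ (3m≤F , F<4m , w≤d , d+w≤) → Rare-two₃ 15≤k (sym (m∸n+n≡m 3m≤F)) (rem₃ 3m≤F F<4m) w≤d d+w≤)
      (Rare-∪ (Rare-⋃ (suc F) λ m → Rare-⋃ (suc F) λ d →
                Rare-guard (2 * m ≤? F ×-dec F <? 3 * m ×-dec w ≤? d ×-dec d + w ≤? ⌊ F ∸ 2 * m /2⌋)
                λ (2m≤F , F<3m , w≤d , d+w≤) → Rare-two₂ 15≤k (sym (m∸n+n≡m 2m≤F)) (rem₂ 2m≤F F<3m) w≤d d+w≤)
      (Rare-∪ (Rare-⋃ (suc F) λ m → Rare-guard (W ≤? m ×-dec m + W ≤? h)
                λ (W≤m , m+W≤h) → Rare-confined h+h≤F F≤h+h (>-nonZero⁻¹ k) W≤m m+W≤h)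
      (Rare-∪ (deviant true) (deviant false))))))
      where
      rem₃ : ∀ {m} → 3 * m ≤ F → F < 4 * m → F ∸ 3 * m < m
      rem₃ {m} 3m≤F F<4m = +-cancelʳ-< (3 * m) _ _ (subst (_< m + 3 * m) (sym (m∸n+n≡m 3m≤F)) F<4m)
      rem₂ : ∀ {m} → 2 * m ≤ F → F < 3 * m → F ∸ 2 * m < m
      rem₂ {m} 2m≤F F<3m = +-cancelʳ-< (2 * m) _ _ (subst (_< m + 2 * m) (sym (m∸n+n≡m 2m≤F)) F<3m)
      deviant : ∀ b → Rare k w F (∃< (suc F) (λ N s → Bounded N × Deviant F (h ∸ W) h N t b s)) (suc F * 2)
      deviant b = Rare-⋃ (suc F) λ N → Rare-guard (h + N ≤? F ×-dec t ≤? N)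
        λ (h+N≤F , t≤N) → Rare-deviant h+h≤F F≤h+h b W≤h h+N≤F
          (≤-trans (≤-trans (m≤n+m N h) h+N≤F) F≤) t≤N

    Typical : Pred Subset 0ℓ
    Typical s = (∀ {x} → 0 < x → x < h ∸ W → ¬ T (s x))
              × (∀ b N → h + N ≤ F → 2 * tally b s h N < N + t)

    module _ {s : Subset} (S : Semigroup F s) (top : ∀ {x} → F < x → T (s x)) where

      private
        deviant? : ∀ b → Dec (∃[ N ] N < suc F × h + N ≤ F × N + t ≤ 2 * tally b s h N)
        deviant? b = anyUpTo? (λ N → h + N ≤? F ×-dec N + t ≤? 2 * tally b s h N) (suc F)

        small-element : ∀ m → 0 < m → 4 * m ≤ F → T (s m) → Bad s
        small-element m 0<m 4m≤F x∈ with doubling S F m (m<n+m F 0<m) 0<m 4m≤F x∈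
        ... | m′ , m′∈ , 4m′≤F , F<8m′ = inj₁ (m′ , s≤s (≤-trans (m≤n*m m′ 4) 4m′≤F)
              , (4m′≤F , 0<m′ , w≤m′) , S , m′∈)
          where
          0<m′ : 0 < m′
          0<m′ = *-cancelˡ-< 8 0 m′ (≤-<-trans z≤n F<8m′)
          w≤m′ : w ≤ m′
          w≤m′ = *-cancelˡ-≤ 8 (≤-trans (≤-trans (*-monoˡ-≤ w (m≤m+n 8 32)) 40w≤F) (<⇒≤ F<8m′))

        t≤N : ∀ b N → N + t ≤ 2 * tally b s h N → t ≤ N
        t≤N b N dev = +-cancelˡ-≤ N t N (≤-trans dev (≤-trans (*-monoʳ-≤ 2 (tally≤ b s h N)) (≤-reflexive (cong (N +_) (+-identityʳ N)))))

        tall : (∀ {x} → 0 < x → x < h ∸ W → ¬ T (s x)) → Bad s ⊎ Typical s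
        tall low with deviant? true | deviant? false
        ... | yes (N , N< , h+N≤F , dev) | _ = inj₁ (inj₂ (inj₂ (inj₂ (inj₂ (inj₂ (inj₁
                (N , N< , (h+N≤F , t≤N true N dev) , record { zero∈ = 0∈ S ; gap = low ; deviation = dev })))))))
        ... | no _ | yes (N , N< , h+N≤F , dev) = inj₁ (inj₂ (inj₂ (inj₂ (inj₂ (inj₂ (inj₂
                (N , N< , (h+N≤F , t≤N false N dev) , record { zero∈ = 0∈ S ; gap = low ; deviation = dev })))))))
        ... | no ¬d | no ¬d′ = inj₂ (low , typical)
          where
          typical : ∀ b N → h + N ≤ F → 2 * tally b s h N < N + t
          typical true  N h+N≤F = ≰⇒> λ dev → ¬d  (N , s≤s (≤-trans (m≤n+m N h) h+N≤F) , h+N≤F , dev)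
          typical false N h+N≤F = ≰⇒> λ dev → ¬d′ (N , s≤s (≤-trans (m≤n+m N h) h+N≤F) , h+N≤F , dev)

        W≤m : ∀ {m} → F < 4 * m → W ≤ m
        W≤m {m} F<4m = *-cancelˡ-≤ 4 (≤-trans (≤-reflexive (sym (*-assoc 4 10 w))) (≤-trans 40w≤F (<⇒≤ F<4m)))

        second? : ∀ m → Dec (∃[ n ] n < suc F × T (s n) × m + w ≤ n × 2 * n + 4 * w ≤ F)
        second? m = anyUpTo? (λ n → T? (s n) ×-dec m + w ≤? n ×-dec 2 * n + 4 * w ≤? F) (suc F)

        -- If no element lies in the range of `second?`, the semigroup is confined. Otherwise there
        -- is an element `m + d` with `d ≥ w`, and the number of whole steps of `m` in `F` decides:
        -- two steps lead to `Two₂`, three to `Third` or `Two₃` according to the size of the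
        -- remainder.
        spaced : ∀ m → m + W ≤ h → F < 4 * m → Least F m s → Bad s
        spaced m m+W≤h F<4m l with second? m
        ... | no ¬n = inj₂ (inj₂ (inj₂ (inj₂ (inj₁ (m , s≤s m≤F , (W≤m F<4m , m+W≤h)
                , record { isLeast = l ; gap = λ {x} a b x∈ → ¬n (x , s≤s (≤-trans (m≤m+n x (x + 0)) (≤-trans (m≤m+n (2 * x) (4 * w)) b)) , x∈ , a , b) })))))
          where
          m≤F : m ≤ F
          m≤F = ≤-trans (≤-trans (m≤m+n m W) m+W≤h) (≤-trans (m≤m+n h h) h+h≤F)
        ... | yes (n , _ , n∈ , m+w≤n , n≤) with m≤n⇒∃[o]m+o≡n (≤-trans (m≤m+n m w) m+w≤n)
        ...   | d , refl with 3 * m ≤? F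
        ...     | no  3m≰F = inj₂ (inj₂ (inj₂ (inj₁ (m , s≤s m≤F , d , s≤s d≤F
                  , (2m≤F , ≰⇒> 3m≰F , +-cancelˡ-≤ m w d m+w≤n , ≤⌊/2⌋ (m+n≤o⇒m≤o∸n _ (linear (2 * w) n≤ e))) , l , n∈))))
          where
          m≤F : m ≤ F
          m≤F = ≤-trans (≤-trans (m≤m+n m W) m+W≤h) (≤-trans (m≤m+n h h) h+h≤F)
          d≤F : d ≤ F
          d≤F = ≤-trans (≤-trans (m≤n+m d m) (m≤m+n (m + d) _)) (≤-trans (m≤m+n _ (4 * w)) n≤)
          2m≤F : 2 * m ≤ F
          2m≤F = ≤-trans (*-monoʳ-≤ 2 (m≤m+n m d)) (≤-trans (m≤m+n _ (4 * w)) n≤)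
          e : d + w + (d + w) + 2 * m + F + 2 * w ≡ F + (2 * (m + d) + 4 * w)
          e = solve (d ∷ w ∷ m ∷ F ∷ [])
        ...     | yes 3m≤F with w ≤? F ∸ 3 * m
        ...       | yes w≤f = inj₂ (inj₁ (m , s≤s (≤-trans (m≤n*m m 3) 3m≤F) , (3m≤F , F<4m , w≤f) , l))
        -- With remainder `f`, the inequality `2 (m + d) + 4 w ≤ F = f + 3 m` gives
        -- `2 (d + w) + f ≤ m` once `f < w` is used twice, for the two copies of `f` that have to be
        -- absorbed.
        ...       | no  w≰f = inj₂ (inj₂ (inj₁ (m , s≤s (≤-trans (m≤n*m m 3) 3m≤F) , d , s≤s d≤F
                  , (3m≤F , F<4m , +-cancelˡ-≤ m w d m+w≤n , ≤⌊/2⌋ (m+n≤o⇒m≤o∸n _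
                      (linear 2 (n≤ ⊞ ≤-reflexive (sym (m∸n+n≡m 3m≤F)) ⊞ ≰⇒> w≰f ⊞ ≰⇒> w≰f) (e (F ∸ 3 * m))))) , l , n∈)))
          where
          d≤F : d ≤ F
          d≤F = ≤-trans (≤-trans (m≤n+m d m) (m≤m+n (m + d) _)) (≤-trans (m≤m+n _ (4 * w)) n≤)
          e : ∀ f → d + w + (d + w) + f + (F + (f + 3 * m) + w + w) + 2 ≡ m + (2 * (m + d) + 4 * w + F + suc f + suc f)
          e f = solve (d ∷ w ∷ m ∷ F ∷ f ∷ [])

      classify : Bad s ⊎ Typical s
      classify with least-positive s (suc F)
      ... | inj₂ none = contradiction (top ≤-refl) (none (s≤s z≤n) ≤-refl)
      ... | inj₁ (m , 0<m , _ , m∈′ , least′) with 4 * m ≤? F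
      ...   | yes 4m≤F = inj₁ (small-element m 0<m 4m≤F m∈′)
      ...   | no  4m≰F with m + W ≤? h
      ...     | yes m+W≤h = inj₁ (spaced m m+W≤h (≰⇒> 4m≰F) (record { semigroup = S ; m∈ = m∈′ ; least = least′ }))
      -- Here `m` exceeds `h ∸ W`, so nothing positive lies below `h ∸ W`.
      ...     | no  m+W≰h = tall (λ {x} 0<x x< → least′ 0<x (≰⇒> λ m≤x →
                  m+W≰h (≤-trans (+-monoˡ-≤ W (≤-trans m≤x (<⇒≤ x<))) (≤-reflexive (m∸n+n≡m W≤h)))))

  -- The enumeration of a typical semigroup

  tally-+ : ∀ b s a m n → tally b s a (m + n) ≡ tally b s a m + tally b s (a + m) n
  tally-+ b s a zero    n = cong (λ x → tally b s x n) (sym (+-identityʳ a))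
  tally-+ b s a (suc m) n = trans (cong (hit b (s a) +_)
      (trans (tally-+ b s (suc a) m n) (cong (λ x → tally b s (suc a) m + tally b s x n) (sym (+-suc a m)))))
    (sym (+-assoc (hit b (s a)) _ _))

  tally-none : ∀ s a n → (∀ {x} → a ≤ x → x < a + n → ¬ T (s x)) → tally true s a n ≡ 0
  tally-none s a zero    h = refl
  tally-none s a (suc n) h with s a in e
  ... | true  = contradiction (subst T (sym e) _) (h ≤-refl (m<m+n a (s≤s z≤n)))
  ... | false = tally-none s (suc a) n λ a<x x< → h (<⇒≤ a<x) (<-≤-trans x< (≤-reflexive (sym (+-suc a n))))

  tally-all : ∀ s a n → (∀ {x} → a ≤ x → T (s x)) → tally true s a n ≡ n
  tally-all s a zero    h = refl
  tally-all s a (suc n) h with s a | h ≤-refl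
  ... | true | _ = cong suc (tally-all s (suc a) n (h ∘ <⇒≤))

  tally-suc : ∀ {s a} → T (s a) → tally true s a 1 ≡ 1
  tally-suc {s} {a} a∈ with s a
  ... | true = refl

  tally-mono : ∀ b s a {m n} → m ≤ n → tally b s a m ≤ tally b s a n
  tally-mono b s a {m} m≤n with m≤n⇒∃[o]m+o≡n m≤n
  ... | o , refl = ≤-trans (m≤m+n _ _) (≤-reflexive (sym (tally-+ b s a m o)))

  -- y is close to min (F / 2 + 2 j , 3 F / 4 + j).
  record Near (F j y D : ℕ) : Set where
    field
      upper₁ : 2 * y ≤ F + 4 * j + D
      upper₂ : 4 * y ≤ 3 * F + 4 * j + D
      lower  : F + 4 * j ≤ 2 * y + D ⊎ 3 * F + 4 * j ≤ 4 * y + D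

  module _ {F h W t : ℕ} (h+h≤F : h + h ≤ F) (F≤h+h : F ≤ suc (h + h)) where

    near-below : ∀ {l y j} → j ≤ W → l ≤ y → h ≤ l + W → y ≤ h → Near F j y (6 * W + 2 * t + 3)
    near-below {l} {y} {j} j≤W l≤y h≤ y≤h = record
      { upper₁ = linear (4 * j + (6 * W + 2 * t + 3)) (y≤h ⊞ y≤h ⊞ h+h≤F) e₁
      ; upper₂ = linear (F + 4 * j + (6 * W + 2 * t + 3)) (scale 4 y≤h ⊞ h+h≤F ⊞ h+h≤F) e₂
      ; lower  = inj₁ (linear (2 * t + 2) (F≤h+h ⊞ scale 4 j≤W ⊞ h≤ ⊞ h≤ ⊞ l≤y ⊞ l≤y) e₃)
      }
      where
      e₁ : 2 * y + (h + h + F) + (4 * j + (6 * W + 2 * t + 3)) ≡ F + 4 * j + (6 * W + 2 * t + 3) + (y + y + (h + h))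
      e₁ = solve (F ∷ h ∷ W ∷ t ∷ y ∷ j ∷ [])
      e₂ : 4 * y + (4 * h + F + F) + (F + 4 * j + (6 * W + 2 * t + 3))
         ≡ 3 * F + 4 * j + (6 * W + 2 * t + 3) + (4 * y + (h + h) + (h + h))
      e₂ = solve (F ∷ h ∷ W ∷ t ∷ y ∷ j ∷ [])
      e₃ : F + 4 * j + (suc (h + h) + 4 * W + (l + W) + (l + W) + y + y) + (2 * t + 2)
         ≡ 2 * y + (6 * W + 2 * t + 3) + (F + 4 * j + h + h + l + l)
      e₃ = solve (F ∷ h ∷ W ∷ t ∷ y ∷ j ∷ l ∷ [])

    module _ {e τ N : ℕ} (e≤W : e ≤ W) (τ≤ : 2 * τ ≤ N + t) (≤τ : N ≤ 2 * τ + t) where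

      -- With `e` positive elements below `h` and `τ` in `[h , y]`, the index of `y` is `e + τ`. As
      -- `τ` differs from `N / 2` by at most `t / 2` and `e` is at most `W`, `y` is close to
      -- `h + 2 (e + τ)`. The bound `upper₂` comes from `y ≤ F`, where the other line is the higher
      -- one up to the error.
      near-middle : ∀ {y} → suc y ≡ h + N → y ≤ F → Near F (e + τ) y (6 * W + 2 * t + 3)
      near-middle {y} y≡ y≤F = record
        { upper₁ = linear (4 * e + 6 * W + 5) (y≤ ⊞ y≤ ⊞ ≤τ ⊞ ≤τ ⊞ h+h≤F) e₁
        ; upper₂ = linear (4 * e + 6 * W + 5) (y≤ ⊞ y≤ ⊞ ≤τ ⊞ ≤τ ⊞ h+h≤F ⊞ y≤F ⊞ y≤F) e₂
        ; lower  = inj₁ (linear (2 * W) (F≤h+h ⊞ τ≤ ⊞ τ≤ ⊞ scale 4 e≤W ⊞ ≤y ⊞ ≤y) e₃)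
        }
        where
        y≤ : suc y ≤ h + N
        y≤ = ≤-reflexive y≡
        ≤y : h + N ≤ suc y
        ≤y = ≤-reflexive (sym y≡)
        e₁ : 2 * y + (h + N + (h + N) + (2 * τ + t) + (2 * τ + t) + F) + (4 * e + 6 * W + 5)
           ≡ F + 4 * (e + τ) + (6 * W + 2 * t + 3) + (suc y + suc y + N + N + (h + h))
        e₁ = solve (F ∷ h ∷ W ∷ t ∷ e ∷ τ ∷ N ∷ y ∷ [])
        e₂ : 4 * y + (h + N + (h + N) + (2 * τ + t) + (2 * τ + t) + F + F + F) + (4 * e + 6 * W + 5)
           ≡ 3 * F + 4 * (e + τ) + (6 * W + 2 * t + 3) + (suc y + suc y + N + N + (h + h) + y + y)
        e₂ = solve (F ∷ h ∷ W ∷ t ∷ e ∷ τ ∷ N ∷ y ∷ [])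
        e₃ : F + 4 * (e + τ) + (suc (h + h) + (N + t) + (N + t) + 4 * W + suc y + suc y) + 2 * W
           ≡ 2 * y + (6 * W + 2 * t + 3) + (F + 2 * τ + 2 * τ + 4 * e + (h + N) + (h + N))
        e₃ = solve (F ∷ h ∷ W ∷ t ∷ e ∷ τ ∷ N ∷ y ∷ [])

      -- Past `F` no number is missing, so the index is `e + τ + (y - F)`, where `τ` is about half
      -- of `F - h`, that is, about `F / 4`.
      near-above : ∀ {y j} → h + N ≡ F → F ≤ y → j + F ≡ e + τ + y → Near F j y (6 * W + 2 * t + 3)
      near-above {y} {j} N≡ F≤y j≡ = record
        { upper₁ = linear (4 * e + 6 * W + 3) (scale 4 ≤j ⊞ ≤τ ⊞ ≤τ ⊞ F≤ ⊞ F≤ ⊞ h+h≤F ⊞ F≤y ⊞ F≤y) e₁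
        ; upper₂ = linear (4 * e + 6 * W + 3) (scale 4 ≤j ⊞ ≤τ ⊞ ≤τ ⊞ F≤ ⊞ F≤ ⊞ h+h≤F) e₂
        ; lower  = inj₂ (linear (2 * W + 2) (scale 4 j≤ ⊞ scale 4 e≤W ⊞ τ≤ ⊞ τ≤ ⊞ ≤F ⊞ ≤F ⊞ F≤h+h) e₃)
        }
        where
        j≤ : j + F ≤ e + τ + y
        j≤ = ≤-reflexive j≡
        ≤j : e + τ + y ≤ j + F
        ≤j = ≤-reflexive (sym j≡)
        F≤ : F ≤ h + N
        F≤ = ≤-reflexive (sym N≡)
        ≤F : h + N ≤ F
        ≤F = ≤-reflexive N≡
        e₁ : 2 * y + (4 * (j + F) + (2 * τ + t) + (2 * τ + t) + (h + N) + (h + N) + F + y + y) + (4 * e + 6 * W + 3)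
           ≡ F + 4 * j + (6 * W + 2 * t + 3) + (4 * (e + τ + y) + N + N + F + F + (h + h) + F + F)
        e₁ = solve (F ∷ h ∷ W ∷ t ∷ e ∷ τ ∷ N ∷ y ∷ j ∷ [])
        e₂ : 4 * y + (4 * (j + F) + (2 * τ + t) + (2 * τ + t) + (h + N) + (h + N) + F) + (4 * e + 6 * W + 3)
           ≡ 3 * F + 4 * j + (6 * W + 2 * t + 3) + (4 * (e + τ + y) + N + N + F + F + (h + h))
        e₂ = solve (F ∷ h ∷ W ∷ t ∷ e ∷ τ ∷ N ∷ y ∷ j ∷ [])
        e₃ : 3 * F + 4 * j + (4 * (e + τ + y) + 4 * W + (N + t) + (N + t) + F + F + suc (h + h)) + (2 * W + 2)
           ≡ 4 * y + (6 * W + 2 * t + 3) + (4 * (j + F) + 4 * e + 2 * τ + 2 * τ + (h + N) + (h + N) + F)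
        e₃ = solve (F ∷ h ∷ W ∷ t ∷ e ∷ τ ∷ N ∷ y ∷ j ∷ [])

  module Enumeration {F : ℕ} {s : Subset} (S : Semigroup F s) (top : ∀ {x} → F < x → T (s x))
    (a : ℕ → ℕ) (a₀ : a 0 ≡ 0) (a∈ : ∀ j → T (s (a j))) (increasing : ∀ j → a j < a (suc j))
    (consecutive : ∀ j x → T (s x) → a j < x → a (suc j) ≤ x) where

    -- This inverts the enumeration: the index of an element is recovered by counting the elements
    -- up to it. The count is `suc j` because it includes 0.
    tally-a : ∀ j → tally true s 0 (suc (a j)) ≡ suc j
    tally-a zero rewrite a₀ = tally-suc {s} (0∈ S)
    tally-a (suc j) with m≤n⇒∃[o]m+o≡n (increasing j)
    ... | o , e = begin
      tally true s 0 (suc (a (suc j)))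
        ≡⟨ cong (tally true s 0) (trans (sym (+-comm (a (suc j)) 1)) (cong (_+ 1) (sym e))) ⟩
      tally true s 0 (suc (a j) + o + 1)                                 ≡⟨ tally-+ true s 0 (suc (a j) + o) 1 ⟩
      tally true s 0 (suc (a j) + o) + tally true s (suc (a j) + o) 1
        ≡⟨ cong₂ _+_ (tally-+ true s 0 (suc (a j)) o) (tally-suc {s} (subst (T ∘ s) (sym e) (a∈ (suc j)))) ⟩
      tally true s 0 (suc (a j)) + tally true s (suc (a j)) o + 1
        ≡⟨ cong₂ (λ x y → x + y + 1) (tally-a j) (tally-none s (suc (a j)) o
                                                                              λ a<x x< x∈ → <⇒≱ (<-≤-trans x< (≤-reflexive e)) (consecutive j _ x∈ a<x)) ⟩
      suc j + 0 + 1
        ≡⟨ trans (cong (_+ 1) (+-identityʳ (suc j))) (+-comm (suc j) 1) ⟩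
      suc (suc j)                                                        ∎
      where open ≡-Reasoning

    module _ (k : ℕ) .{{_ : NonZero k}} (15≤k : 15 ≤ k) (h w : ℕ)
      (h+h≤F : h + h ≤ F) (F≤h+h : F ≤ suc (h + h)) (40w≤F : 40 * w ≤ F)
      (F≤ : F ≤ 4 * k * ((20 * k + 41) * w)) (0<h : 0 < h) where

      open Classification k 15≤k F h w h+h≤F F≤h+h 40w≤F F≤

      near : Typical s → ∀ {D} → 6 * W + 2 * t + 3 ≡ D → ∀ j → Near F (suc j) (a (suc j)) D
      near (low , dev) refl j = go (a (suc j)) (tally-a (suc j)) (a∈ (suc j)) l≤y
        where
        l = h ∸ W
        l+W≡h : l + W ≡ h
        l+W≡h = m∸n+n≡m W≤h
        l≤y : l ≤ a (suc j)
        l≤y = ≮⇒≥ λ y<l → low (≤-trans (s≤s z≤n) (increasing j)) y<l (a∈ (suc j))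
        c : ℕ → ℕ
        c = tally true s 0
        c[l]≤1 : ∀ l → l ≤ h ∸ W → c l ≤ 1
        c[l]≤1 zero    _   = z≤n
        c[l]≤1 (suc l) l≤ = ≤-trans (≤-reflexive (cong (hit true (s 0) +_) (tally-none s 1 l λ 0<x x< → low 0<x (<-≤-trans x< l≤))))
          (≤-trans (≤-reflexive (+-identityʳ _)) (hit≤1 (s 0)))
          where
          hit≤1 : ∀ b → hit true b ≤ 1
          hit≤1 true  = ≤-refl
          hit≤1 false = z≤n
        c[h]≤ : c h ≤ suc W
        c[h]≤ = ≤-trans (≤-reflexive (trans (cong c (sym l+W≡h)) (tally-+ true s 0 l W)))
          (+-mono-≤ (c[l]≤1 l ≤-refl) (tally≤ true s l W))
        τ-upper : ∀ N → h + N ≤ F → 2 * tally true s h N ≤ N + t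
        τ-upper N h+N≤F = <⇒≤ (dev true N h+N≤F)
        τ-lower : ∀ N → h + N ≤ F → N ≤ 2 * tally true s h N + t
        τ-lower N h+N≤F = bound (tally true s h N) (tally false s h N) N (tally-sum s h N) (<⇒≤ (dev false N h+N≤F))
          where
          bound : ∀ x y N → x + y ≡ N → 2 * y ≤ N + t → N ≤ 2 * x + t
          bound x y N refl h = linear 0 h (e t)
            where
            e : ∀ t → x + y + (x + y + t) + 0 ≡ 2 * x + t + 2 * y
            e t = solve (x ∷ y ∷ t ∷ [])

        1≤c[h] : 1 ≤ c h
        1≤c[h] = ≤-trans (≤-reflexive (sym (tally-suc {s} (0∈ S)))) (tally-mono true s 0 0<h)
        -- The count `c h` includes 0, which is not among the elements indexed from 1.
        e = pred (c h)
        e≡ : suc e ≡ c h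
        e≡ = suc-pred (c h) {{>-nonZero 1≤c[h]}}
        e≤W : e ≤ W
        e≤W = s≤s⁻¹ (≤-trans (≤-reflexive e≡) c[h]≤)
        c[h+] : ∀ N → c (h + N) ≡ suc (e + tally true s h N)
        c[h+] N = trans (tally-+ true s 0 h N) (cong (_+ tally true s h N) (sym e≡))

        go : ∀ y → c (suc y) ≡ suc (suc j) → T (s y) → l ≤ y → Near F (suc j) y (6 * W + 2 * t + 3)
        go y cy y∈ l≤y with y <? h
        ... | yes y<h = near-below {W = W} {t} h+h≤F F≤h+h (s≤s⁻¹ (≤-trans (≤-reflexive (sym cy)) (≤-trans (tally-mono true s 0 y<h) c[h]≤)))
                          l≤y (≤-reflexive (sym l+W≡h)) (<⇒≤ y<h)
        ... | no  y≮h with <-cmp y F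
        ...   | tri≈ _ refl _ = contradiction y∈ (F∉ S)
        ...   | tri< y<F _ _ with m≤n⇒∃[o]m+o≡n (m≤n⇒m≤1+n (≮⇒≥ y≮h))
        ...     | N , h+N≡ = subst (λ i → Near F i y (6 * W + 2 * t + 3)) (suc-injective (trans (sym (c[h+] N)) (trans (cong c h+N≡) cy)))
                  (near-middle {W = W} {t} h+h≤F F≤h+h {τ = tally true s h N} e≤W (τ-upper N h+N≤F) (τ-lower N h+N≤F) (sym h+N≡) (<⇒≤ y<F))
          where
          h+N≤F : h + N ≤ F
          h+N≤F = ≤-trans (≤-reflexive h+N≡) y<F
        go y cy y∈ l≤y | no y≮h | tri> _ _ F<y with m≤n⇒∃[o]m+o≡n F<y | m≤n⇒∃[o]m+o≡n (≤-trans (m≤m+n h h) h+h≤F)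
        ...     | o , refl | N , h+N≡ = near-above {W = W} {t} h+h≤F F≤h+h {τ = τ} e≤W (τ-upper N (≤-reflexive h+N≡)) (τ-lower N (≤-reflexive h+N≡))
                  h+N≡ (<⇒≤ F<y) (trans (cong (_+ F) (suc-injective count)) (shuffle (e + τ) o F))
          where
          τ = tally true s h N
          shuffle : ∀ x o F → x + suc o + F ≡ x + (suc F + o)
          shuffle x o F = solve (x ∷ o ∷ F ∷ [])
          shuffle′ : ∀ F o → suc (suc (F + o)) ≡ F + 1 + suc o
          shuffle′ F o = solve (F ∷ o ∷ [])
          count : suc (suc j) ≡ suc (e + τ + suc o)
          count = begin
            suc (suc j)                                      ≡⟨ sym cy ⟩
            c (suc (suc (F + o)))                            ≡⟨ cong c (shuffle′ F o) ⟩
            c (F + 1 + suc o)                                ≡⟨ tally-+ true s 0 (F + 1) (suc o) ⟩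
            c (F + 1) + tally true s (F + 1) (suc o)         ≡⟨ cong₂ _+_ (tally-+ true s 0 F 1)
                                                                  (tally-all s (F + 1) (suc o) λ F<x → top (≤-trans (≤-reflexive (+-comm 1 F)) F<x)) ⟩
            c F + tally true s F 1 + suc o                   ≡⟨ cong (λ x → c F + x + suc o) (tally-none s F 1 λ F≤x x< x∈ →
                                                                  F∉ S (subst (T ∘ s) (≤-antisym (s≤s⁻¹ (≤-trans x< (≤-reflexive (+-comm F 1)))) F≤x) x∈)) ⟩
            c F + 0 + suc o
              ≡⟨ cong (_+ suc o) (trans (+-identityʳ _) (trans (cong c (sym h+N≡)) (c[h+] N))) ⟩
            suc (e + τ + suc o)                              ∎
            where open ≡-Reasoning

  -- Asymptotics

  -- For `w = 5 v + r`, Bernoulli gives `(1 + 1 / k) ^ v ≥ v / k`, whose fifth power has one factor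
  -- `v` more than the polynomial of degree 4. That factor outgrows `C 10 ^ 4 k ^ 5`, where the 10
  -- stems from `suc w ≤ 10 * v`.
  exp-beats-poly′ : ∀ C k .{{_ : NonZero k}} → ∃[ w₀ ] ∀ w → w₀ ≤ w → C * suc w ^ 4 * k ^ w ≤ suc k ^ w
  exp-beats-poly′ C k = 5 * suc (B * k ^ 5) , bound
    where
    B = C * 10 ^ 4
    bound : ∀ w → 5 * suc (B * k ^ 5) ≤ w → C * suc w ^ 4 * k ^ w ≤ suc k ^ w
    bound w w₀≤w = *-cancelˡ-≤ (k ^ 5) {{m^n≢0 k 5}} (begin
      k ^ 5 * (C * suc w ^ 4 * k ^ w)               ≤⟨ *-monoʳ-≤ (k ^ 5) (*-monoˡ-≤ (k ^ w) (*-monoʳ-≤ C (^-monoˡ-≤ 4 w≤10v))) ⟩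
      k ^ 5 * (C * (10 * v) ^ 4 * k ^ w)            ≡⟨ cong (λ x → k ^ 5 * (C * x * k ^ w)) (^-distribʳ-* 4 10 v) ⟩
      k ^ 5 * (C * (10 ^ 4 * v ^ 4) * k ^ w)        ≡⟨ cong (λ x → k ^ 5 * (x * k ^ w)) (sym (*-assoc C (10 ^ 4) (v ^ 4))) ⟩
      k ^ 5 * (B * v ^ 4 * k ^ w)                   ≡⟨ regroup (k ^ 5) B (v ^ 4) (k ^ w) ⟩
      B * k ^ 5 * v ^ 4 * k ^ w                     ≤⟨ *-monoˡ-≤ (k ^ w) (*-monoˡ-≤ (v ^ 4) (≤-trans (n≤1+n _) v₀≤v)) ⟩
      v ^ 5 * k ^ w                                 ≡⟨ cong (v ^ 5 *_) (split k) ⟩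
      v ^ 5 * ((k ^ v) ^ 5 * k ^ r)
        ≡⟨ trans (sym (*-assoc (v ^ 5) _ _)) (cong (_* k ^ r) (sym (^-distribʳ-* 5 v (k ^ v)))) ⟩
      (v * k ^ v) ^ 5 * k ^ r
        ≤⟨ *-mono-≤ (^-monoˡ-≤ 5 (≤-trans (*-monoˡ-≤ (k ^ v) (m≤n+m v k)) (bernoulli k v))) (^-monoˡ-≤ r (n≤1+n k)) ⟩
      (k * suc k ^ v) ^ 5 * suc k ^ r
        ≡⟨ trans (cong (_* suc k ^ r) (^-distribʳ-* 5 k (suc k ^ v))) (*-assoc (k ^ 5) _ _) ⟩
      k ^ 5 * ((suc k ^ v) ^ 5 * suc k ^ r)         ≡⟨ cong (k ^ 5 *_) (sym (split (suc k))) ⟩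
      k ^ 5 * suc k ^ w                             ∎)
      where
      open ≤-Reasoning
      v = w / 5
      r = w % 5
      w≡ : w ≡ r + v * 5
      w≡ = m≡m%n+[m/n]*n w 5
      v₀≤v : suc (B * k ^ 5) ≤ v
      v₀≤v = ≤-trans (≤-reflexive (sym (trans (cong (_/ 5) (*-comm 5 (suc (B * k ^ 5)))) (m*n/n≡m (suc (B * k ^ 5)) 5)))) (/-monoˡ-≤ 5 w₀≤w)
      w≤10v : suc w ≤ 10 * v
      w≤10v = ≤-trans (s≤s (≤-reflexive w≡)) (linear 0 (m%n<n w 5 ⊞ scale 5 (≤-trans (s≤s z≤n) v₀≤v)) (e r v))
        where
        e : ∀ r v → suc (r + v * 5) + (5 + 5 * v) + 0 ≡ 10 * v + (suc r + 5 * 1)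
        e r v = solve (r ∷ v ∷ [])
      split : ∀ x → x ^ w ≡ (x ^ v) ^ 5 * x ^ r
      split x = trans (cong (x ^_) (trans w≡ (+-comm r (v * 5)))) (trans (^-distribˡ-+-* x (v * 5) r) (cong (_* x ^ r) (sym (^-*-assoc x v 5))))
      regroup : ∀ a b c d → a * (b * c * d) ≡ b * a * c * d
      regroup a b c d = solve (a ∷ b ∷ c ∷ d ∷ [])

  abstract
    exp-beats-poly : ∀ C k .{{_ : NonZero k}} → ∃[ w₀ ] ∀ w → w₀ ≤ w → C * suc w ^ 4 * k ^ w ≤ suc k ^ w
    exp-beats-poly = exp-beats-poly′

  module _ (k K : ℕ) .{{_ : NonZero k}} .{{_ : NonZero K}} where

    width : ℕ → ℕ
    width F = F / K

    width-lower : ∀ F → width F * K ≤ F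
    width-lower F = ≤-trans (m≤n+m _ (F % K)) (≤-reflexive (sym (m≡m%n+[m/n]*n F K)))

    width-upper : ∀ F → suc F ≤ K * suc (width F)
    width-upper F = ≤-trans (s≤s (≤-reflexive (m≡m%n+[m/n]*n F K)))
      (≤-trans (+-monoˡ-≤ _ (m%n<n F K)) (≤-reflexive (*-comm (suc (width F)) K)))

    width-mono : ∀ {w F} → w * K ≤ F → w ≤ width F
    width-mono {w} h = ≤-trans (≤-reflexive (sym (m*n/n≡m w K))) (/-monoˡ-≤ K h)

    -- The constant `c` is of order `F ^ 2` and enters squared, whence the fourth power in
    -- `exp-beats-poly`. The comparison is made between squares, with a factor 2 on both sides that
    -- makes up for the rounding: `F` is at most twice `suc ⌊ F ∸ 1 /2⌋`.
    negligible : ∀ g D → ∃[ w₀ ] ∀ F M c → w₀ ≤ width F → c ≤ g * (suc F * suc F) →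
      suc k ^ width F * (M * M) ≤ c * c * (k ^ width F * 2 ^ F) → D * M ≤ 2 ^ ⌊ F ∸ 1 /2⌋
    negligible g D = proj₁ asymptotics , λ F M c w₀≤ c≤ small →
      halve F (D * M) (sq-cancel-≤ {2 * (D * M)} {2 * 2 ^ ⌊ F ∸ 1 /2⌋} (≤-trans (core F M c w₀≤ c≤ small) (2^F≤ F)))
      where
      open ≤-Reasoning
      asymptotics : ∃[ w₀ ] ∀ w → w₀ ≤ w → 2 * D * (2 * D) * (g * g) * K ^ 4 * suc w ^ 4 * k ^ w ≤ suc k ^ w
      asymptotics = exp-beats-poly (2 * D * (2 * D) * (g * g) * K ^ 4) k
      halve : ∀ F x → 2 * x ≤ 2 * 2 ^ ⌊ F ∸ 1 /2⌋ → x ≤ 2 ^ ⌊ F ∸ 1 /2⌋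
      halve F x h = *-cancelˡ-≤ 2 h
      2^F≤ : ∀ F → 2 ^ F ≤ 2 * 2 ^ ⌊ F ∸ 1 /2⌋ * (2 * 2 ^ ⌊ F ∸ 1 /2⌋)
      2^F≤ F = ≤-trans (^-monoʳ-≤ 2 (le F)) (≤-reflexive (^-distribˡ-+-* 2 (suc ⌊ F ∸ 1 /2⌋) (suc ⌊ F ∸ 1 /2⌋)))
        where
        le : ∀ F → F ≤ suc ⌊ F ∸ 1 /2⌋ + suc ⌊ F ∸ 1 /2⌋
        le zero    = z≤n
        le (suc F) = s≤s (≤-trans (≤-reflexive (sym (⌊n/2⌋+⌈n/2⌉≡n F)))
          (+-monoʳ-≤ ⌊ F /2⌋ (⌈n/2⌉≤ F)))
          where
          ⌈n/2⌉≤ : ∀ n → ⌈ n /2⌉ ≤ suc ⌊ n /2⌋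
          ⌈n/2⌉≤ zero          = z≤n
          ⌈n/2⌉≤ (suc zero)    = ≤-refl
          ⌈n/2⌉≤ (suc (suc n)) = s≤s (⌈n/2⌉≤ n)
      core : ∀ F M c → proj₁ asymptotics ≤ width F → c ≤ g * (suc F * suc F) →
        suc k ^ width F * (M * M) ≤ c * c * (k ^ width F * 2 ^ F) → 2 * (D * M) * (2 * (D * M)) ≤ 2 ^ F
      core F M c w₀≤ c≤ small = *-cancelˡ-≤ (suc k ^ w) {{m^n≢0 (suc k) w}} (begin
        suc k ^ w * (2 * (D * M) * (2 * (D * M)))       ≡⟨ regroup₁ (suc k ^ w) D M ⟩
        2 * D * (2 * D) * (suc k ^ w * (M * M))             ≤⟨ *-monoʳ-≤ (2 * D * (2 * D)) small ⟩
        2 * D * (2 * D) * (c * c * (k ^ w * 2 ^ F))         ≤⟨ *-monoʳ-≤ (2 * D * (2 * D)) (*-monoˡ-≤ _ (*-mono-≤ c≤′ c≤′)) ⟩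
        2 * D * (2 * D) * (g * (z * z) * (g * (z * z)) * (k ^ w * 2 ^ F))  ≡⟨ regroup₂ D z (k ^ w) (2 ^ F) ⟩
        2 * D * (2 * D) * (g * g) * (z * (z * (z * (z * 1)))) * k ^ w * 2 ^ F
          ≡⟨ cong (λ x → 2 * D * (2 * D) * (g * g) * x * k ^ w * 2 ^ F) (^-distribʳ-* 4 K (suc w)) ⟩
        2 * D * (2 * D) * (g * g) * (K ^ 4 * suc w ^ 4) * k ^ w * 2 ^ F
          ≡⟨ cong (λ x → x * k ^ w * 2 ^ F) (sym (*-assoc (2 * D * (2 * D) * (g * g)) (K ^ 4) (suc w ^ 4))) ⟩
        2 * D * (2 * D) * (g * g) * K ^ 4 * suc w ^ 4 * k ^ w * 2 ^ F  ≤⟨ *-monoˡ-≤ (2 ^ F) (proj₂ asymptotics w w₀≤) ⟩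
        suc k ^ w * 2 ^ F                               ∎)
        where
        w = width F
        z = K * suc w
        c≤′ : c ≤ g * (z * z)
        c≤′ = ≤-trans c≤ (*-monoʳ-≤ g (*-mono-≤ (width-upper F) (width-upper F)))
        regroup₁ : ∀ q d m → q * (2 * (d * m) * (2 * (d * m))) ≡ 2 * d * (2 * d) * (q * (m * m))
        regroup₁ q d m = solve (q ∷ d ∷ m ∷ [])
        regroup₂ : ∀ d z x y → 2 * d * (2 * d) * (g * (z * z) * (g * (z * z)) * (x * y)) ≡ 2 * d * (2 * d) * (g * g) * (z * (z * (z * (z * 1)))) * x * y
        regroup₂ d z x y = solve (g ∷ d ∷ z ∷ x ∷ y ∷ [])

-- Counting 𝒮 F

module _ where

  open import Data.Bool.Base using (T)
  open import Data.Bool.Properties using (T?)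
  open import Data.Fin.Base as Fin using (Fin; toℕ; finToFun; funToFin)
  import Data.Fin.Properties as Fin
  open import Data.List.Base using (List; []; _∷_; length; filter; lookup; upTo)
  open import Data.List.Membership.Propositional.Properties using (∈-lookup; ∈-upTo⁺)
  open import Data.List.Relation.Unary.All as All using (All)
  open import Data.List.Relation.Unary.All.Properties using (all-filter)
  import Data.List.Relation.Unary.AllPairs as AllPairs
  import Data.List.Relation.Unary.Any as Any
  open import Data.List.Relation.Unary.Any.Properties using (lookup-index)
  import Data.List.Relation.Unary.Unique.Setoid as SetoidUnique
  import Data.List.Relation.Unary.Unique.Setoid.Properties as Unique
  open import Data.Nat.Base
  open import Data.Nat.Properties
  open import Data.Nat.Tactic.RingSolver using (solve)
  open import Data.Product.Base using (∃-syntax; _×_; _,_; proj₁; proj₂)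
  open import Data.Sum.Base using (_⊎_; inj₁; inj₂)
  open import Defs using (NumericalSemigroup; 𝒮; 𝒮-setoid; Ω; Ω-complete; Ω-unique)
  open import Function.Base using (_∘_)
  open import Level using (0ℓ)
  open import Relation.Binary.Bundles using (Setoid)
  open import Relation.Binary.Definitions using (tri<; tri≈; tri>)
  open import Relation.Binary.PropositionalEquality
  open import Relation.Nullary using (¬_; Dec; yes; no; contradiction)
  open import Relation.Nullary.Decidable using (⌊_⌋; toWitness; fromWitness; _⊎-dec_; _×-dec_)
  open import Relation.Unary using (Pred; Decidable)

  open Semigroup

  open 𝒮 using (semigroup; isFrobenius; _∋_)

  Unique⇒injective : ∀ {c ℓ} (S : Setoid c ℓ) {xs : List (Setoid.Carrier S)} → SetoidUnique.Unique S xs →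
                     ∀ i j → Setoid._≈_ S (lookup xs i) (lookup xs j) → i ≡ j
  Unique⇒injective S {x ∷ xs} (x≉ AllPairs.∷ u) Fin.zero    Fin.zero    _ = refl
  Unique⇒injective S {x ∷ xs} (x≉ AllPairs.∷ u) Fin.zero    (Fin.suc j) e = contradiction e (All.lookup x≉ (∈-lookup {xs = xs} j))
  Unique⇒injective S {x ∷ xs} (x≉ AllPairs.∷ u) (Fin.suc i) Fin.zero    e = contradiction (Setoid.sym S e) (All.lookup x≉ (∈-lookup {xs = xs} i))
  Unique⇒injective S {x ∷ xs} (x≉ AllPairs.∷ u) (Fin.suc i) (Fin.suc j) e = cong Fin.suc (Unique⇒injective S u i j e)

  funToFin-cong : ∀ {m n} {f g : Fin m → Fin n} → f ≗ g → funToFin f ≡ funToFin g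
  funToFin-cong {zero}  e = refl
  funToFin-cong {suc m} e = cong₂ Fin.combine (e Fin.zero) (funToFin-cong (e ∘ Fin.suc))

  module _ {F : ℕ} where

    above : ∀ (S : 𝒮 F) {x} → F < x → T (S ∋ x)
    above S {x} F<x with T? (S ∋ x)
    ... | yes x∈ = x∈
    ... | no  x∉ = contradiction F<x (≤⇒≯ (proj₂ (isFrobenius S) x x∉))

    isSemigroup : (S : 𝒮 F) → Semigroup F (S ∋_)
    isSemigroup S = record
      { 0∈     = NumericalSemigroup.0∈ (semigroup S)
      ; closed = NumericalSemigroup.+-closed (semigroup S)
      ; F∉     = proj₁ (isFrobenius S)
      }

    -- Only the elements below F distinguish two members of 𝒮 F.
    Code⇒≤ : ∀ {P : Pred Subset 0ℓ} {D : Pred (𝒮 F) 0ℓ} {k} (D? : Decidable D) → (∀ {S} → D S → P (S ∋_)) →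
             Code (_< F) P k → length (filter D? (Ω F)) ≤ k
    Code⇒≤ {P} {D} {k} D? D⇒P c = Fin.injective⇒≤ {f = number} λ {i} {j} e →
      Unique⇒injective (𝒮-setoid F) (Unique.filter⁺ (𝒮-setoid F) D? (Ω-unique F)) i j (same (lookup xs i) (lookup xs j)
        (Code.injective c (D⇒P (holds i)) (D⇒P (holds j)) e))
      where
      xs = filter D? (Ω F)
      holds : ∀ i → D (lookup xs i)
      holds i = All.lookup (all-filter D? (Ω F)) (∈-lookup {xs = xs} i)
      number : Fin (length xs) → Fin k
      number i = Code.code c (D⇒P (holds i))
      same : ∀ S S′ → (∀ {x} → x < F → (S ∋ x) ≡ (S′ ∋ x)) → Setoid._≈_ (𝒮-setoid F) S S′
      same S S′ below x with <-cmp x F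
      ... | tri< x<F _ _  = below x<F
      ... | tri≈ _ refl _ = ¬T⇒≡ (proj₁ (isFrobenius S)) (proj₁ (isFrobenius S′))
      ... | tri> _ _ F<x  = T⇒≡ (above S F<x) (above S′ F<x)

  module _ (F : ℕ) .{{_ : NonZero F}} where

    private
      H = ⌊ F ∸ 1 /2⌋

      -- Any set of numbers strictly between F / 2 and F extends to a semigroup.
      In : (Fin H → Fin 2) → ℕ → Set
      In g n = n ≡ 0 ⊎ F < n ⊎ ∃[ i ] n + suc (toℕ i) ≡ F × g i ≡ Fin.suc Fin.zero

      in? : ∀ g n → Dec (In g n)
      in? g n = (n ≟ 0) ⊎-dec (F <? n) ⊎-dec Fin.any? (λ i → (n + suc (toℕ i) ≟ F) ×-dec (g i Fin.≟ Fin.suc Fin.zero))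

      H+H<F : H + H < F
      H+H<F = <-≤-trans (s≤s (⌊/2⌋+⌊/2⌋≤ (F ∸ 1))) (≤-reflexive (suc-pred F))

      In-+ : ∀ g m n → In g m → In g n → In g (m + n)
      In-+ g m n (inj₁ refl)       n∈                 = n∈
      In-+ g m n (inj₂ (inj₁ F<m)) _                  = inj₂ (inj₁ (<-≤-trans F<m (m≤m+n m n)))
      In-+ g m n m∈@(inj₂ (inj₂ _)) (inj₁ refl)       = subst (In g) (sym (+-identityʳ m)) m∈
      In-+ g m n (inj₂ (inj₂ _))   (inj₂ (inj₁ F<n))  = inj₂ (inj₁ (<-≤-trans F<n (m≤n+m n m)))
      In-+ g m n (inj₂ (inj₂ (i , m+i≡ , _))) (inj₂ (inj₂ (j , n+j≡ , _))) = inj₂ (inj₁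
        (linear 0 (≤-reflexive (sym m+i≡) ⊞ ≤-reflexive (sym n+j≡) ⊞ Fin.toℕ<n i ⊞ Fin.toℕ<n j ⊞ H+H<F) (e (toℕ i) (toℕ j) H)))
        where
        e : ∀ i j h → suc F + (m + suc i + (n + suc j) + h + h + F) + 0 ≡ m + n + (F + F + suc i + suc j + suc (h + h))
        e i j h = solve (F ∷ m ∷ n ∷ i ∷ j ∷ h ∷ [])

      fromChoice : (Fin H → Fin 2) → 𝒮 F
      fromChoice g = record
        { semigroup = record
          { member      = λ n → ⌊ in? g n ⌋
          ; 0∈          = fromWitness {a? = in? g 0} (inj₁ refl)
          ; +-closed    = λ m n m∈ n∈ → fromWitness {a? = in? g (m + n)} (In-+ g m n (toWitness {a? = in? g m} m∈) (toWitness {a? = in? g n} n∈))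
          ; finite-gaps = upTo (suc F) , λ n n∉ → ∈-upTo⁺ (s≤s (gaps n n∉))
          }
        ; isFrobenius = (λ F∈ → notIn (toWitness {a? = in? g F} F∈)) , gaps
        }
        where
        notIn : ¬ In g F
        notIn (inj₁ F≡0)                   = contradiction F≡0 (≢-nonZero⁻¹ F)
        notIn (inj₂ (inj₁ F<F))            = <-irrefl refl F<F
        notIn (inj₂ (inj₂ (i , F+i≡F , _))) = m≢1+m+n F (trans (sym F+i≡F) (+-suc F (toℕ i)))
        gaps : ∀ n → ¬ T ⌊ in? g n ⌋ → n ≤ F
        gaps n n∉ = ≮⇒≥ λ F<n → n∉ (fromWitness {a? = in? g n} (inj₂ (inj₁ F<n)))

      choice-≡ : ∀ g g′ i → (fromChoice g ∋ (F ∸ suc (toℕ i))) ≡ (fromChoice g′ ∋ (F ∸ suc (toℕ i))) →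
                 g i ≡ Fin.suc Fin.zero → g′ i ≡ Fin.suc Fin.zero
      choice-≡ g g′ i e gi with toWitness {a? = in? g′ x} (subst T e (fromWitness {a? = in? g x} (inj₂ (inj₂ (i , x+i≡F , gi)))))
        where
        x = F ∸ suc (toℕ i)
        x+i≡F : x + suc (toℕ i) ≡ F
        x+i≡F = m∸n+n≡m (≤-trans (Fin.toℕ<n i) (≤-trans (m≤m+n H H) (<⇒≤ H+H<F)))
      ... | inj₁ x≡0 = contradiction (≤-trans (s≤s (Fin.toℕ<n i)) (≤-trans (s≤s (m≤m+n H H)) H+H<F)) (≤⇒≯ (m∸n≡0⇒m≤n x≡0))
      ... | inj₂ (inj₁ F<x) = contradiction F<x (≤⇒≯ (m∸n≤m F (suc (toℕ i))))
      ... | inj₂ (inj₂ (j , x+j≡F , g′j)) = subst (λ l → g′ l ≡ Fin.suc Fin.zero)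
            (Fin.toℕ-injective (suc-injective (+-cancelˡ-≡ (F ∸ suc (toℕ i)) _ _ (trans x+j≡F
              (sym (m∸n+n≡m (≤-trans (Fin.toℕ<n i) (≤-trans (m≤m+n H H) (<⇒≤ H+H<F)))))))))  g′j

      Fin2-≡ : ∀ {i j : Fin 2} → (i ≡ Fin.suc Fin.zero → j ≡ Fin.suc Fin.zero) → (j ≡ Fin.suc Fin.zero → i ≡ Fin.suc Fin.zero) → i ≡ j
      Fin2-≡ {Fin.zero}          {Fin.zero}          _ _ = refl
      Fin2-≡ {Fin.suc Fin.zero}  {j}                 h _ = sym (h refl)
      Fin2-≡ {Fin.zero}          {Fin.suc Fin.zero}  _ h = h refl

    2^⌊[F-1]/2⌋≤∣Ω∣ : 2 ^ H ≤ length (Ω F)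
    2^⌊[F-1]/2⌋≤∣Ω∣ = Fin.injective⇒≤ {f = index} λ {x} {y} e →
      trans (sym (Fin.funToFin-finToFin {H} {2} x)) (trans (funToFin-cong (agree x y e)) (Fin.funToFin-finToFin {H} {2} y))
      where
      S : Fin (2 ^ H) → 𝒮 F
      S x = fromChoice (finToFun x)
      index : Fin (2 ^ H) → Fin (length (Ω F))
      index x = Any.index (Ω-complete F (S x))
      agree : ∀ x y → index x ≡ index y → finToFun {2} {H} x ≗ finToFun y
      agree x y e i = Fin2-≡ (choice-≡ (finToFun x) (finToFun y) i (S≡ _)) (choice-≡ (finToFun y) (finToFun x) i (sym (S≡ _)))
        where
        S≡ : ∀ n → (S x ∋ n) ≡ (S y ∋ n)
        S≡ n = trans (lookup-index (Ω-complete F (S x)) n) (trans (cong (λ l → lookup (Ω F) l ∋ n) e)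
          (sym (lookup-index (Ω-complete F (S y)) n)))

-- Rational estimates

module _ where

  open import Data.Integer.Base using (+_; -[1+_])
  import Data.Integer.Base as ℤ
  open import Data.Nat.Base using (ℕ; zero; suc; NonZero)
  import Data.Nat.Base as ℕ
  import Data.Nat.Properties as ℕ
  open import Data.Product.Base using (∃-syntax; _×_; _,_; proj₁; proj₂)
  open import Data.Rational.Base using (ℚ; mkℚ; 0ℚ; 1ℚ; ½; _/_; _+_; _*_; _-_; -_)
  import Data.Rational.Base as ℚ
  import Data.Rational.Properties as ℚ
  open import Data.Rational.Solver using (module +-*-Solver)
  open import Data.Sum.Base using (_⊎_; inj₁; inj₂)
  open import Relation.Binary.PropositionalEquality hiding (J)
  open import Relation.Nullary using (¬_; yes; no; contradiction)
  open import Defs hiding (_≤_; _<_; ∣_∣)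

  open Near
  open +-*-Solver using (solve; _:=_; _:+_; _:-_; _:*_; :-_; con)

  fromℕ-+ : ∀ m n → fromℕ (m ℕ.+ n) ≡ fromℕ m + fromℕ n
  fromℕ-+ zero    n = sym (ℚ.+-identityˡ (fromℕ n))
  fromℕ-+ (suc m) n = begin
    fromℕ (suc (m ℕ.+ n))        ≡⟨ fromℕ-suc (m ℕ.+ n) ⟩
    fromℕ (m ℕ.+ n) + 1ℚ         ≡⟨ cong (_+ 1ℚ) (fromℕ-+ m n) ⟩
    fromℕ m + fromℕ n + 1ℚ       ≡⟨ solve 2 (λ x y → x :+ y :+ con 1ℚ := x :+ con 1ℚ :+ y) refl (fromℕ m) (fromℕ n) ⟩
    fromℕ m + 1ℚ + fromℕ n       ≡⟨ cong (_+ fromℕ n) (sym (fromℕ-suc m)) ⟩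
    fromℕ (suc m) + fromℕ n      ∎
    where open ≡-Reasoning

  fromℕ-* : ∀ m n → fromℕ (m ℕ.* n) ≡ fromℕ m * fromℕ n
  fromℕ-* zero    n = sym (ℚ.*-zeroˡ (fromℕ n))
  fromℕ-* (suc m) n = begin
    fromℕ (n ℕ.+ m ℕ.* n)             ≡⟨ fromℕ-+ n (m ℕ.* n) ⟩
    fromℕ n + fromℕ (m ℕ.* n)         ≡⟨ cong (λ z → fromℕ n + z) (fromℕ-* m n) ⟩
    fromℕ n + fromℕ m * fromℕ n       ≡⟨ solve 2 (λ x y → y :+ x :* y := (x :+ con 1ℚ) :* y) refl (fromℕ m) (fromℕ n) ⟩
    (fromℕ m + 1ℚ) * fromℕ n          ≡⟨ cong (_* fromℕ n) (sym (fromℕ-suc m)) ⟩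
    fromℕ (suc m) * fromℕ n           ∎
    where open ≡-Reasoning

  -- The denominator of `η` serves as `E`, since the numerator is at least 1.
  archimedean : ∀ η → 0ℚ ℚ.< η → ∃[ E ] 1ℚ ℚ.≤ fromℕ E * η
  archimedean η 0<η = go η (ℚ.positive 0<η)
    where
    go : ∀ η → ℚ.Positive η → ∃[ E ] 1ℚ ℚ.≤ fromℕ E * η
    go η@(mkℚ (+ suc m) d _) _ = suc d , subst (λ x → 1ℚ ℚ.≤ fromℕ (suc d) * x) (ℚ.↥p/↧p≡p η)
      (subst (1ℚ ℚ.≤_) (sym (*-/ d (suc m))) (fromℕ-mono {1} {suc m} (ℕ.s≤s ℕ.z≤n)))
    go (mkℚ (+ zero) _ _)   ()
    go (mkℚ -[1+ _ ] _ _)   ()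

  fromℕ-/ : ∀ d .{{_ : NonZero d}} n → fromℕ d * (+ n / d) ≡ fromℕ n
  fromℕ-/ (suc k) n = *-/ k n

  fromℕ-positive : ∀ d .{{_ : NonZero d}} → ℚ.Positive (fromℕ d)
  fromℕ-positive (suc k) = fromℕ-pos k

  /-≤ : ∀ {n d η} .{{_ : NonZero d}} → fromℕ n ℚ.≤ η * fromℕ d → + n / d ℚ.≤ η
  /-≤ {n} {d} {η} h = ℚ.*-cancelˡ-≤-pos (fromℕ d) {{fromℕ-positive d}}
    (subst₂ ℚ._≤_ (sym (fromℕ-/ d n)) (ℚ.*-comm η (fromℕ d)) h)

  ratio-≤ : ∀ {D n d η} .{{_ : NonZero d}} → 0ℚ ℚ.≤ η → 1ℚ ℚ.≤ fromℕ D * η → D ℕ.* n ℕ.≤ d → + n / d ℚ.≤ η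
  ratio-≤ {D} {n} {d} {η} 0≤η 1≤Dη Dn≤d = /-≤ {n} {d} (begin
    fromℕ n                    ≡⟨ sym (ℚ.*-identityˡ (fromℕ n)) ⟩
    1ℚ * fromℕ n               ≤⟨ ℚ.*-monoʳ-≤-nonNeg (fromℕ n) {{fromℕ-nonNeg n}} 1≤Dη ⟩
    fromℕ D * η * fromℕ n      ≡⟨ solve 3 (λ D η n → D :* η :* n := η :* (D :* n)) refl (fromℕ D) η (fromℕ n) ⟩
    η * (fromℕ D * fromℕ n)    ≡⟨ cong (η *_) (sym (fromℕ-* D n)) ⟩
    η * fromℕ (D ℕ.* n)        ≤⟨ ℚ.*-monoˡ-≤-nonNeg η {{ℚ.nonNegative 0≤η}} (fromℕ-mono {D ℕ.* n} {d} Dn≤d) ⟩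
    η * fromℕ d                ∎)
    where open ℚ.≤-Reasoning

  -- The two branches cross at `1 / 4`, so `ξ` is their minimum. Hence it lies below both lines and
  -- equals one of them, which matches the conjunction of upper bounds and the disjunction of lower
  -- bounds in `Near`.
  ξ≤₁ : ∀ x → ξ x ℚ.≤ ½ + + 2 / 1 * x
  ξ≤₁ x with x ℚ.≤? + 1 / 4
  ... | yes _   = ℚ.≤-refl
  ... | no  x≰¼ = comb (ℚ.<⇒≤ (ℚ.≰⇒> x≰¼))
    (solve 1 (λ x → con (+ 3 / 4) :+ x :+ x := con ½ :+ con (+ 2 / 1) :* x :+ con (+ 1 / 4)) refl x)

  ξ≤₂ : ∀ x → ξ x ℚ.≤ + 3 / 4 + x
  ξ≤₂ x with x ℚ.≤? + 1 / 4
  ... | yes x≤¼ = comb x≤¼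
    (solve 1 (λ x → con ½ :+ con (+ 2 / 1) :* x :+ con (+ 1 / 4) := con (+ 3 / 4) :+ x :+ x) refl x)
  ... | no  _   = ℚ.≤-refl

  ξ-cases : ∀ x → ξ x ≡ ½ + + 2 / 1 * x ⊎ ξ x ≡ + 3 / 4 + x
  ξ-cases x with x ℚ.≤? + 1 / 4
  ... | yes _ = inj₁ refl
  ... | no  _ = inj₂ refl

  module _ {F j y D : ℕ} .{{_ : NonZero F}} (n : Near F j y D) {x η : ℚ}
    (lower-x : fromℕ j ℚ.≤ fromℕ (F ℕ.∸ 1) * x + + 2 / 1) (upper-x : fromℕ (F ℕ.∸ 1) * x ℚ.≤ fromℕ j)
    (-1≤x : - 1ℚ ℚ.≤ x) (x≤2 : x ℚ.≤ + 2 / 1) (tolerance : ½ * fromℕ D + + 6 / 1 ℚ.≤ fromℕ F * η) where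

    private
      f g J Y d c : ℚ
      f = fromℕ F
      g = fromℕ (F ℕ.∸ 1)
      J = fromℕ j
      Y = fromℕ y
      d = fromℕ D
      c = + y / F

      f≡ : f ≡ g + 1ℚ
      f≡ = trans (cong fromℕ (sym (ℕ.suc-pred F))) (fromℕ-suc (F ℕ.∸ 1))

      0≤d : 0ℚ ℚ.≤ d
      0≤d = fromℕ-mono {0} {D} ℕ.z≤n

      scaled : ∀ q .{{_ : ℚ.NonNegative q}} {a b} → a ℚ.≤ b → q * a ℚ.≤ q * b
      scaled q = ℚ.*-monoˡ-≤-nonNeg q

      u₁ : + 2 / 1 * Y ℚ.≤ f + + 4 / 1 * J + d
      u₁ = subst₂ ℚ._≤_ (fromℕ-* 2 y) (trans (fromℕ-+ (F ℕ.+ 4 ℕ.* j) D) (cong (_+ d)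
        (trans (fromℕ-+ F (4 ℕ.* j)) (cong (λ z → f + z) (fromℕ-* 4 j))))) (fromℕ-mono {2 ℕ.* y} {F ℕ.+ 4 ℕ.* j ℕ.+ D} (upper₁ n))

      u₂ : + 4 / 1 * Y ℚ.≤ + 3 / 1 * f + + 4 / 1 * J + d
      u₂ = subst₂ ℚ._≤_ (fromℕ-* 4 y) (trans (fromℕ-+ (3 ℕ.* F ℕ.+ 4 ℕ.* j) D) (cong (_+ d)
        (trans (fromℕ-+ (3 ℕ.* F) (4 ℕ.* j)) (cong₂ _+_ (fromℕ-* 3 F) (fromℕ-* 4 j))))) (fromℕ-mono {4 ℕ.* y} {3 ℕ.* F ℕ.+ 4 ℕ.* j ℕ.+ D} (upper₂ n))

      cancel : ∀ {a b} → f * a ℚ.≤ f * b → a ℚ.≤ b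
      cancel = ℚ.*-cancelˡ-≤-pos f {{fromℕ-positive F}}

      f*c : f * c ≡ Y
      f*c = fromℕ-/ F y

      above₁ : c ℚ.≤ ½ + + 2 / 1 * x + η
      above₁ = cancel (subst (ℚ._≤ f * (½ + + 2 / 1 * x + η)) (sym f*c) (comb
        (scaled ½ u₁ ⊕ lower-x ⊕ lower-x ⊕ -1≤x ⊕ -1≤x ⊕ tolerance)
        (subst (λ f → Y + (½ * (f + + 4 / 1 * J + d) + (g * x + + 2 / 1) + (g * x + + 2 / 1) + x + x + f * η)
                    ≡ f * (½ + + 2 / 1 * x + η) + (½ * (+ 2 / 1 * Y) + J + J + - 1ℚ + - 1ℚ + (½ * d + + 6 / 1))) (sym f≡)
          (solve 6 (λ Y g J d x η →
            Y :+ (con ½ :* ((g :+ con 1ℚ) :+ con (+ 4 / 1) :* J :+ d) :+ (g :* x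
              :+ con (+ 2 / 1)) :+ (g :* x :+ con (+ 2 / 1)) :+ x :+ x :+ (g :+ con 1ℚ) :* η)
            := (g :+ con 1ℚ) :* (con ½ :+ con (+ 2 / 1) :* x :+ η) :+ (con ½ :* (con (+ 2 / 1) :* Y)
              :+ J :+ J :+ con (- 1ℚ) :+ con (- 1ℚ) :+ (con ½ :* d :+ con (+ 6 / 1))))
            refl Y g J d x η))))

      above₂ : c ℚ.≤ + 3 / 4 + x + η
      above₂ = cancel (subst (ℚ._≤ f * (+ 3 / 4 + x + η)) (sym f*c) (comb
        (scaled (+ 1 / 4) u₂ ⊕ lower-x ⊕ -1≤x ⊕ tolerance ⊕ scaled (+ 1 / 4) 0≤d ⊕ ℚ.≤ᵇ⇒≤ {0ℚ} {+ 3 / 1} _)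
        (subst (λ f → Y + (+ 1 / 4 * (+ 3 / 1 * f + + 4 / 1 * J + d) + (g * x + + 2 / 1) + x + f * η + + 1 / 4 * d + + 3 / 1)
                    ≡ f * (+ 3 / 4 + x + η) + (+ 1 / 4 * (+ 4 / 1 * Y) + J + - 1ℚ + (½ * d + + 6 / 1) + + 1 / 4 * 0ℚ + 0ℚ)) (sym f≡)
          (solve 6 (λ Y g J d x η →
            Y :+ (con (+ 1 / 4) :* (con (+ 3 / 1) :* (g :+ con 1ℚ) :+ con (+ 4 / 1) :* J :+ d)
              :+ (g :* x :+ con (+ 2 / 1)) :+ x :+ (g :+ con 1ℚ) :* η :+ con (+ 1 / 4) :* d :+ con (+ 3 / 1))
            := (g :+ con 1ℚ) :* (con (+ 3 / 4) :+ x :+ η) :+ (con (+ 1 / 4) :* (con (+ 4 / 1) :* Y)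
              :+ J :+ con (- 1ℚ) :+ (con ½ :* d :+ con (+ 6 / 1)) :+ con (+ 1 / 4) :* con 0ℚ :+ con 0ℚ))
            refl Y g J d x η))))

      below₁ : F ℕ.+ 4 ℕ.* j ℕ.≤ 2 ℕ.* y ℕ.+ D → ½ + + 2 / 1 * x ℚ.≤ c + η
      below₁ l = cancel (subst (f * (½ + + 2 / 1 * x) ℚ.≤_) (sym (trans (ℚ.*-distribˡ-+ f c η) (cong (_+ f * η) f*c))) (comb
        (scaled ½ l′ ⊕ upper-x ⊕ upper-x ⊕ x≤2 ⊕ x≤2 ⊕ tolerance ⊕ ℚ.≤ᵇ⇒≤ {0ℚ} {+ 2 / 1} _)
        (subst (λ f → f * (½ + + 2 / 1 * x) + (½ * (+ 2 / 1 * Y + d) + J + J + + 2 / 1 + + 2 / 1 + f * η + + 2 / 1)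
                    ≡ Y + f * η + (½ * (f + + 4 / 1 * J) + g * x + g * x + x + x + (½ * d + + 6 / 1) + 0ℚ)) (sym f≡)
          (solve 6 (λ Y g J d x η →
            (g :+ con 1ℚ) :* (con ½ :+ con (+ 2 / 1) :* x) :+ (con ½ :* (con (+ 2 / 1) :* Y
              :+ d) :+ J :+ J :+ con (+ 2 / 1) :+ con (+ 2 / 1) :+ (g :+ con 1ℚ) :* η :+ con (+ 2 / 1))
            := Y :+ (g :+ con 1ℚ) :* η :+ (con ½ :* ((g :+ con 1ℚ) :+ con (+ 4 / 1) :* J)
              :+ g :* x :+ g :* x :+ x :+ x :+ (con ½ :* d :+ con (+ 6 / 1)) :+ con 0ℚ))
            refl Y g J d x η))))
        where
        l′ : f + + 4 / 1 * J ℚ.≤ + 2 / 1 * Y + d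
        l′ = subst₂ ℚ._≤_ (trans (fromℕ-+ F (4 ℕ.* j)) (cong (λ z → f + z) (fromℕ-* 4 j)))
          (trans (fromℕ-+ (2 ℕ.* y) D) (cong (_+ d) (fromℕ-* 2 y))) (fromℕ-mono {F ℕ.+ 4 ℕ.* j} {2 ℕ.* y ℕ.+ D} l)

      below₂ : 3 ℕ.* F ℕ.+ 4 ℕ.* j ℕ.≤ 4 ℕ.* y ℕ.+ D → + 3 / 4 + x ℚ.≤ c + η
      below₂ l = cancel (subst (f * (+ 3 / 4 + x) ℚ.≤_) (sym (trans (ℚ.*-distribˡ-+ f c η) (cong (_+ f * η) f*c))) (comb
        (scaled (+ 1 / 4) l′ ⊕ upper-x ⊕ x≤2 ⊕ tolerance ⊕ scaled (+ 1 / 4) 0≤d ⊕ ℚ.≤ᵇ⇒≤ {0ℚ} {+ 4 / 1} _)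
        (subst (λ f → f * (+ 3 / 4 + x) + (+ 1 / 4 * (+ 4 / 1 * Y + d) + J + + 2 / 1 + f * η + + 1 / 4 * d + + 4 / 1)
                    ≡ Y + f * η + (+ 1 / 4 * (+ 3 / 1 * f + + 4 / 1 * J) + g * x + x + (½ * d + + 6 / 1) + + 1 / 4 * 0ℚ + 0ℚ)) (sym f≡)
          (solve 6 (λ Y g J d x η →
            (g :+ con 1ℚ) :* (con (+ 3 / 4) :+ x) :+ (con (+ 1 / 4) :* (con (+ 4 / 1) :* Y
              :+ d) :+ J :+ con (+ 2 / 1) :+ (g :+ con 1ℚ) :* η :+ con (+ 1 / 4) :* d :+ con (+ 4 / 1))
            := Y :+ (g :+ con 1ℚ) :* η :+ (con (+ 1 / 4) :* (con (+ 3 / 1) :* (g :+ con 1ℚ)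
              :+ con (+ 4 / 1) :* J) :+ g :* x :+ x :+ (con ½ :* d :+ con (+ 6 / 1)) :+ con (+ 1 / 4) :* con 0ℚ :+ con 0ℚ))
            refl Y g J d x η))))
        where
        l′ : + 3 / 1 * f + + 4 / 1 * J ℚ.≤ + 4 / 1 * Y + d
        l′ = subst₂ ℚ._≤_ (trans (fromℕ-+ (3 ℕ.* F) (4 ℕ.* j)) (cong₂ _+_ (fromℕ-* 3 F) (fromℕ-* 4 j)))
          (trans (fromℕ-+ (4 ℕ.* y) D) (cong (_+ d) (fromℕ-* 4 y))) (fromℕ-mono {3 ℕ.* F ℕ.+ 4 ℕ.* j} {4 ℕ.* y ℕ.+ D} l)

      c≤ξ+η : c ℚ.≤ ξ x + η
      c≤ξ+η with ξ-cases x
      ... | inj₁ e = subst (λ z → c ℚ.≤ z + η) (sym e) above₁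
      ... | inj₂ e = subst (λ z → c ℚ.≤ z + η) (sym e) above₂

      ξ≤c+η : ξ x ℚ.≤ c + η
      ξ≤c+η with lower n
      ... | inj₁ l = ℚ.≤-trans (ξ≤₁ x) (below₁ l)
      ... | inj₂ l = ℚ.≤-trans (ξ≤₂ x) (below₂ l)

    -- The constant 6 in `tolerance` is exact for the steeper line: twice the 2 of `lower-x`, and
    -- twice the 1 of `-1≤x` for passing from `F ∸ 1` to `F` as the factor of `x`.
    Near⇒∣-∣≤ : ℚ.∣ + y / F - ξ x ∣ ℚ.≤ η
    Near⇒∣-∣≤ = ≤⇒∣-∣ c≤ξ+η ξ≤c+η

-- From typical semigroups to the supremum, and the resulting count

module _ where

  open import Data.Empty using (⊥)
  import Data.Integer.Base as ℤ
  open import Data.List.Base using ([]; _∷_; length; filter)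
  open import Data.Nat.Base
  open import Data.Nat.Properties
  open import Data.Nat.Tactic.RingSolver using (solve)
  open import Data.Product.Base using (∃-syntax; _×_; _,_; proj₁; proj₂)
  open import Data.Rational.Base as ℚ using (ℚ; 0ℚ; 1ℚ; ½)
  import Data.Rational.Properties as ℚ
  open import Data.Sum.Base using (_⊎_; inj₁; inj₂)
  open import Defs hiding (_≤_; _<_; ∣_∣; <⇒≤; ≤-trans)
  import Defs
  open import Relation.Binary.PropositionalEquality
  open import Relation.Nullary using (¬_; contradiction)
  open import Relation.Unary using (Decidable)

  open 𝒮 using (_∋_)
  open ℝ using (seq)
  open Argument

  abstract
    -- Rationality of the supremum makes `Large` decidable, as a bound on `ℙ` demands. Being
    -- abstract, this exposes the equation alone and hides the maximum over the end points.
    sup-rational : ∀ {F} .{{_ : NonZero F}} (S : 𝒮 F) → ∃[ q ] sup∣Ξₛ-Ξ∣ S ≡ fromℚ q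
    sup-rational S = _ , refl

  Large : ∀ (η : ℚ) {F} .{{_ : NonZero F}} → 𝒮 F → Set
  Large η S = η ℚ.< proj₁ (sup-rational S)

  large? : ∀ (η : ℚ) {F} .{{_ : NonZero F}} → Decidable (Large η {F})
  large? η S = η ℚ.<? proj₁ (sup-rational S)

  private
    0<1 : 0ℚ ℚ.< 1ℚ
    0<1 = ℚ.positive⁻¹ 1ℚ

  -- The bounds on `α` and its floor hold only for late terms of the Cauchy sequence. A slack of 1
  -- suffices in those that need one, at a common index `n`: this is why the rational estimate
  -- admits `x` in `[-1 , 2]` and a floor that is off by one.
  Near⇒¬Exceeds : ∀ {F D η} .{{_ : NonZero F}} (S : 𝒮 F) (i : Argument F) → Near F (suc (floor i)) (a S (suc (floor i))) D →
                  ½ ℚ.* fromℕ D ℚ.+ fromℕ 6 ℚ.≤ fromℕ F ℚ.* η → ¬ (fromℚ η Defs.< Defs.∣ Ξₛ S i -ℝ Ξ (α i) ∣)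
  Near⇒¬Exceeds {F} {D} {η} S i near tolerance (μ , 0<μ , N , exceeds) =
    at (proj₁ (isFloor i) 1ℚ 0<1) (proj₂ (isFloor i)) (0≤α i 1ℚ 0<1) (α≤1 i 1ℚ 0<1)
    where
    j = suc (floor i)
    y = a S j
    g = fromℕ (F ∸ 1)
    x = seq (α i)
    at : (∃[ N₁ ] ∀ n → N₁ ≤ n → fromℕ (floor i) ℚ.≤ g ℚ.* x n ℚ.+ 1ℚ) →
         (∃[ ν ] 0ℚ ℚ.< ν × ∃[ N₂ ] ∀ n → N₂ ≤ n → g ℚ.* x n ℚ.+ ν ℚ.≤ fromℕ j) →
         (∃[ N₃ ] ∀ n → N₃ ≤ n → 0ℚ ℚ.≤ x n ℚ.+ 1ℚ) → (∃[ N₄ ] ∀ n → N₄ ≤ n → x n ℚ.≤ 1ℚ ℚ.+ 1ℚ) → ⊥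
    at (N₁ , h₁) (ν , 0<ν , N₂ , h₂) (N₃ , h₃) (N₄ , h₄) =
      ℚ.<-irrefl refl (ℚ.<-≤-trans η<η+μ (ℚ.≤-trans (exceeds n (m≤m+n N _)) close))
      where
      n = N + (N₁ + (N₂ + (N₃ + N₄)))
      N₁≤ : N₁ ≤ n
      N₁≤ = ≤-trans (m≤m+n N₁ _) (m≤n+m _ N)
      N₂≤ : N₂ ≤ n
      N₂≤ = ≤-trans (m≤m+n N₂ _) (≤-trans (m≤n+m _ N₁) (m≤n+m _ N))
      N₃≤ : N₃ ≤ n
      N₃≤ = ≤-trans (m≤m+n N₃ _) (≤-trans (m≤n+m _ N₂) (≤-trans (m≤n+m _ N₁) (m≤n+m _ N)))
      N₄≤ : N₄ ≤ n
      N₄≤ = ≤-trans (m≤n+m N₄ N₃) (≤-trans (m≤n+m _ N₂) (≤-trans (m≤n+m _ N₁) (m≤n+m _ N)))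
      η<η+μ : η ℚ.< η ℚ.+ μ
      η<η+μ = subst (ℚ._< η ℚ.+ μ) (ℚ.+-identityʳ η) (ℚ.+-monoʳ-< η 0<μ)
      lower-x : fromℕ j ℚ.≤ g ℚ.* x n ℚ.+ fromℕ 2
      lower-x = subst₂ ℚ._≤_ (sym (fromℕ-suc (floor i))) (ℚ.+-assoc (g ℚ.* x n) 1ℚ 1ℚ) (ℚ.+-monoˡ-≤ 1ℚ (h₁ n N₁≤))
      upper-x : g ℚ.* x n ℚ.≤ fromℕ j
      upper-x = ℚ.≤-trans (subst (ℚ._≤ g ℚ.* x n ℚ.+ ν) (ℚ.+-identityʳ (g ℚ.* x n)) (ℚ.+-monoʳ-≤ (g ℚ.* x n) (ℚ.<⇒≤ 0<ν))) (h₂ n N₂≤)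
      -1≤x : ℚ.- 1ℚ ℚ.≤ x n
      -1≤x = subst₂ ℚ._≤_ (ℚ.+-identityˡ (ℚ.- 1ℚ)) (trans (ℚ.+-assoc (x n) 1ℚ (ℚ.- 1ℚ)) (ℚ.+-identityʳ (x n))) (ℚ.+-monoˡ-≤ (ℚ.- 1ℚ) (h₃ n N₃≤))
      close : ℚ.∣ ℤ.+ y ℚ./ F ℚ.- ξ (x n) ∣ ℚ.≤ η
      close = Near⇒∣-∣≤ {F} {j} {y} {D} near {x n} {η} lower-x upper-x -1≤x (h₄ n N₄≤) tolerance

  -- If the supremum exceeded `η`, so would the value at some argument; thus no uniform estimate
  -- over all arguments has to be assembled.
  Near⇒¬Large : ∀ {F D η} .{{_ : NonZero F}} (S : 𝒮 F) → (∀ j → Near F (suc j) (a S (suc j)) D) →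
                ½ ℚ.* fromℕ D ℚ.+ fromℕ 6 ℚ.≤ fromℕ F ℚ.* η → ¬ Large η S
  Near⇒¬Large {η = η} S near tolerance large =
    refute (proj₂ (sup∣Ξₛ-Ξ∣-isSupremum S) (fromℚ η) (subst (fromℚ η Defs.<_) (sym (proj₂ (sup-rational S))) (fromℚ-< large)))
    where
    refute : ¬ (∃[ i ] fromℚ η Defs.< Defs.∣ Ξₛ S i -ℝ Ξ (α i) ∣)
    refute (i , exceeds) = Near⇒¬Exceeds S i (near (floor i)) tolerance exceeds

  module Estimate (k E : ℕ) .{{_ : NonZero k}} (15≤k : 15 ≤ k) (E≤k : E ≤ k) (η : ℚ) (0<η : 0ℚ ℚ.< η) (1≤Eη : 1ℚ ℚ.≤ fromℕ E ℚ.* η) where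

    -- With w = F / K, both F ≤ 4 k t₁ and 6 W + 2 t + 3 ≤ 2 F / k + 3 hold.
    K : ℕ
    K = 2 * k * (20 * k + 41)

    instance
      K≢0 : NonZero K
      K≢0 = m*n≢0 (2 * k) (20 * k + 41) {{m*n≢0 2 k}} {{>-nonZero (≤-trans (s≤s z≤n) (m≤n+m 41 (20 * k)))}}

    module _ (F : ℕ) .{{_ : NonZero F}} (1≤w : 1 ≤ width k K F) where

      private
        w h : ℕ
        w = width k K F
        h = ⌊ F /2⌋

        wK≤F : w * K ≤ F
        wK≤F = width-lower k K F

        40w≤F : 40 * w ≤ F
        40w≤F = ≤-trans (≤-reflexive (*-comm 40 w)) (≤-trans (*-monoʳ-≤ w 40≤K) wK≤F)
          where
          40≤K : 40 ≤ K
          40≤K = ≤-trans (≤-trans (m≤n+m 40 1) (m≤n+m 41 (20 * k))) (m≤n*m (20 * k + 41) (2 * k) {{m*n≢0 2 k}})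

        F≤ : F ≤ 4 * k * ((20 * k + 41) * w)
        F≤ = ≤-trans (n≤1+n F) (≤-trans (width-upper k K F) (≤-trans (*-monoʳ-≤ K (+-monoˡ-≤ w 1≤w)) (≤-reflexive (e k (20 * k + 41) w))))
          where
          e : ∀ k c w → 2 * k * c * (w + w) ≡ 4 * k * (c * w)
          e k c w = solve (k ∷ c ∷ w ∷ [])

        h+h≤F : h + h ≤ F
        h+h≤F = ⌊/2⌋+⌊/2⌋≤ F

        F≤h+h : F ≤ suc (h + h)
        F≤h+h = go F
          where
          go : ∀ n → n ≤ suc (⌊ n /2⌋ + ⌊ n /2⌋)
          go zero          = z≤n
          go (suc zero)    = s≤s z≤n
          go (suc (suc n)) = s≤s (s≤s (≤-trans (go n) (≤-reflexive (sym (+-suc ⌊ n /2⌋ ⌊ n /2⌋)))))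

        0<h : 0 < h
        0<h = ⌊n/2⌋-mono {2} {F} (≤-trans (≤-trans (m≤m*n 2 w {{>-nonZero 1≤w}}) (*-monoˡ-≤ w (m≤m+n 2 38))) 40w≤F)

        open Classification k 15≤k F h w h+h≤F F≤h+h 40w≤F F≤

        -- Write `c` for `20 * k + 41`. The error is `(62 + 2 c + 40 k) w + 3`, while `w * K ≤ F`
        -- gives `2 F ≥ k (4 c w)`. So `2 c` has to exceed `62 + 40 k` by at least `3 + 12`, as
        -- `w ≥ 1`; it does so by 20. The factor `2 * k` in `K` comes from `F≤`: rounding loses a
        -- factor 2, as `suc w ≤ w + w`, and `2 K = 4 k c`.
        small-error : ∀ {D} → 6 * W + 2 * t + 3 ≡ D → E * (D + 12) ≤ 2 * F
        small-error refl = ≤-trans (*-monoˡ-≤ _ E≤k) (linear (5 * k * w) (scale (15 * k) 1≤w ⊞ scale 2 wK≤F) (e k w F))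
          where
          e : ∀ k w F → k * (6 * (10 * w) + 2 * ((20 * k + 41) * w + (w + k * (2 * (10 * w)))) + 3 + 12)
                          + (15 * k * w + 2 * F) + 5 * k * w
                        ≡ 2 * F + (15 * k * 1 + 2 * (w * (2 * k * (20 * k + 41))))
          e k w F = solve (k ∷ w ∷ F ∷ [])

        tolerance : ∀ {D} → E * (D + 12) ≤ 2 * F → ½ ℚ.* fromℕ D ℚ.+ fromℕ 6 ℚ.≤ fromℕ F ℚ.* η
        tolerance {D} = bound D
          where
          open ℚ.≤-Reasoning
          bound : ∀ D → E * (D + 12) ≤ 2 * F → ½ ℚ.* fromℕ D ℚ.+ fromℕ 6 ℚ.≤ fromℕ F ℚ.* η
          bound D le = begin
            ½ ℚ.* fromℕ D ℚ.+ ½ ℚ.* fromℕ 12                     ≡⟨ sym (ℚ.*-distribˡ-+ ½ (fromℕ D) (fromℕ 12)) ⟩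
            ½ ℚ.* (fromℕ D ℚ.+ fromℕ 12)                         ≡⟨ cong (½ ℚ.*_) (sym (fromℕ-+ D 12)) ⟩
            ½ ℚ.* fromℕ (D + 12)                                 ≡⟨ cong (½ ℚ.*_) (sym (ℚ.*-identityʳ (fromℕ (D + 12)))) ⟩
            ½ ℚ.* (fromℕ (D + 12) ℚ.* 1ℚ)
              ≤⟨ ℚ.*-monoˡ-≤-nonNeg ½ (ℚ.*-monoˡ-≤-nonNeg (fromℕ (D + 12)) {{fromℕ-nonNeg (D + 12)}} 1≤Eη) ⟩
            ½ ℚ.* (fromℕ (D + 12) ℚ.* (fromℕ E ℚ.* η))
              ≡⟨ cong (½ ℚ.*_) (trans (sym (ℚ.*-assoc (fromℕ (D + 12)) (fromℕ E) η))
                                                                      (cong (ℚ._* η) (trans (ℚ.*-comm (fromℕ (D + 12)) (fromℕ E)) (sym (fromℕ-* E (D + 12)))))) ⟩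
            ½ ℚ.* (fromℕ (E * (D + 12)) ℚ.* η)
              ≤⟨ ℚ.*-monoˡ-≤-nonNeg ½ (ℚ.*-monoʳ-≤-nonNeg η {{ℚ.nonNegative (ℚ.<⇒≤ 0<η)}} (fromℕ-mono {E * (D + 12)} {2 * F} le)) ⟩
            ½ ℚ.* (fromℕ (2 * F) ℚ.* η)                          ≡⟨ cong (λ z → ½ ℚ.* (z ℚ.* η)) (fromℕ-* 2 F) ⟩
            ½ ℚ.* (fromℕ 2 ℚ.* fromℕ F ℚ.* η)                    ≡⟨ cong (½ ℚ.*_) (ℚ.*-assoc (fromℕ 2) (fromℕ F) η) ⟩
            ½ ℚ.* (fromℕ 2 ℚ.* (fromℕ F ℚ.* η))                  ≡⟨ sym (ℚ.*-assoc ½ (fromℕ 2) (fromℕ F ℚ.* η)) ⟩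
            1ℚ ℚ.* (fromℕ F ℚ.* η)                               ≡⟨ ℚ.*-identityˡ (fromℕ F ℚ.* η) ⟩
            fromℕ F ℚ.* η                                        ∎

      Typical⇒¬Large : ∀ {S : 𝒮 F} {D} → 6 * W + 2 * t + 3 ≡ D → Typical (S ∋_) → ¬ Large η S
      Typical⇒¬Large {S} D≡ typical = Near⇒¬Large S
        (Enumeration.near (isSemigroup S) (above S) (a S) refl (a-∈ S) (a-increasing S) (a-consecutive S)
          k 15≤k h w h+h≤F F≤h+h 40w≤F F≤ 0<h typical D≡)
        (tolerance (small-error D≡))

      Large⇒Bad : ∀ {S : 𝒮 F} → Large η S → Bad (S ∋_)
      Large⇒Bad {S} large = choose (classify (isSemigroup S) (above S))
        where
        choose : Bad (S ∋_) ⊎ Typical (S ∋_) → Bad (S ∋_)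
        choose (inj₁ bad)     = bad
        choose (inj₂ typical) = contradiction large (Typical⇒¬Large {S} refl typical)

      rare : Rare k w F Bad cost
      rare = Rare-bad

      cost≤ : cost ≤ 14 * (suc F * suc F)
      cost≤ = go (suc F) (s≤s z≤n)
        where
        go : ∀ n → 0 < n → n * 2 + (n * 2 + (n * (n * 2) + (n * (n * 2) + (n * 2 + (n * 2 + n * 2))))) ≤ 14 * (n * n)
        go n 0<n = linear 0 (scale (10 * n) 0<n) (e n)
          where
          e : ∀ n → n * 2 + (n * 2 + (n * (n * 2) + (n * (n * 2) + (n * 2 + (n * 2 + n * 2))))) + 10 * n * n + 0 ≡ 14 * (n * n) + 10 * n * 1
          e n = solve (n ∷ [])

      count : ∀ D → proj₁ (negligible k K 14 D) ≤ w → D * length (filter (large? η) (Ω F)) ≤ length (Ω F)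
      count D w₀≤ = ≤-trans (*-monoʳ-≤ D (Code⇒≤ (large? η) Large⇒Bad (Rare.coding rare)))
        (≤-trans (proj₂ (negligible k K 14 D) F (Rare.M rare) cost w₀≤ cost≤ (Rare.small rare)) (2^⌊[F-1]/2⌋≤∣Ω∣ F))

    eventually : ∀ D → ∃[ N ] ∀ F .{{_ : NonZero F}} → N ≤ F → D * length (filter (large? η) (Ω F)) ≤ length (Ω F)
    eventually D = suc w₀ * K , λ F N≤F → let w₀<w = width-mono k K {suc w₀} N≤F in
      count F (≤-trans (s≤s z≤n) w₀<w) D (<⇒≤ w₀<w)
      where
      w₀ = proj₁ (negligible k K 14 D)

  mostly-small : ∀ η → 0ℚ ℚ.< η → ∀ D → ∃[ N ] ∀ F .{{_ : NonZero F}} → N ≤ F →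
                 D * length (filter (large? η) (Ω F)) ≤ length (Ω F)
  mostly-small η 0<η with archimedean η 0<η
  -- `k = 15 + E` meets both demands on `k`: at least 15 for the combinatorial savings, at least `E`
  -- for the error to be below `η`.
  ... | E , 1≤Eη = Estimate.eventually (15 + E) E (m≤m+n 15 E) (m≤n+m E 15) η 0<η 1≤Eη

-- Passage from rational to real tolerances

open import Data.Nat.Base using (ℕ; NonZero)
open import Data.Nat.Base as ℕ using ()
open import Data.Product.Base using (∃-syntax)
open import Defs
open import Data.List.Base using (length; filter)
import Data.Nat.Properties as ℕ
open import Data.Product.Base using (_×_; _,_; proj₁; proj₂)
open import Data.Rational.Base as ℚ using (ℚ; 0ℚ; ½)
import Data.Rational.Properties as ℚ
open import Relation.Binary.PropositionalEquality using (_≡_; sym; trans; cong; subst)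

-- A positive real is eventually above a positive rational `η`, so the undecidable event for `ε`
-- lies in the decidable one for `η`.
<⇒Large : ∀ (ε : ℝ) η N {F} .{{_ : NonZero F}} (S : 𝒮 F) → (∀ n → N ℕ.≤ n → 0ℚ ℚ.+ η ℚ.≤ ℝ.seq ε n) →
          ε < sup∣Ξₛ-Ξ∣ S → Large η S
<⇒Large ε η N S η≤ε ε<sup = go (subst (ε <_) (proj₂ (sup-rational S)) ε<sup)
  where
  go : ε < fromℚ (proj₁ (sup-rational S)) → Large η S
  go (μ , 0<μ , M , h) = begin-strict
    η                           ≡⟨ sym (ℚ.+-identityˡ η) ⟩
    0ℚ ℚ.+ η                    ≤⟨ η≤ε n (ℕ.m≤m+n N M) ⟩
    ℝ.seq ε n                   ≡⟨ sym (ℚ.+-identityʳ (ℝ.seq ε n)) ⟩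
    ℝ.seq ε n ℚ.+ 0ℚ            <⟨ ℚ.+-monoʳ-< (ℝ.seq ε n) 0<μ ⟩
    ℝ.seq ε n ℚ.+ μ             ≤⟨ h n (ℕ.m≤n+m M N) ⟩
    proj₁ (sup-rational S)      ∎
    where
    n = N ℕ.+ M
    open ℚ.≤-Reasoning

-- Half of the rational lower bound `ρ` of `δ` is given to the probability; the other half witnesses
-- the strict inequality.
≤½⇒< : ∀ (δ : ℝ) ρ N p → 0ℚ ℚ.< ρ → (∀ n → N ℕ.≤ n → 0ℚ ℚ.+ ρ ℚ.≤ ℝ.seq δ n) → p ℚ.≤ ½ ℚ.* ρ → fromℚ p < δ
≤½⇒< δ ρ N p 0<ρ ρ≤δ p≤ = ½ ℚ.* ρ , ½-pos 0<ρ , N , λ n N≤n → begin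
  p ℚ.+ ½ ℚ.* ρ             ≤⟨ ℚ.+-monoˡ-≤ (½ ℚ.* ρ) p≤ ⟩
  ½ ℚ.* ρ ℚ.+ ½ ℚ.* ρ       ≡⟨ trans (halves ρ) (sym (ℚ.+-identityˡ ρ)) ⟩
  0ℚ ℚ.+ ρ                  ≤⟨ ρ≤δ n N≤n ⟩
  ℝ.seq δ n                 ∎
  where open ℚ.≤-Reasoning

theorem2 : (ε : ℝ) → 0ℝ < ε →
    (δ : ℝ) → 0ℝ < δ →
    ∃[ N ] ((F : ℕ) .{{_ : NonZero F}} → N ℕ.≤ F →
    ℙ[ (λ (S : 𝒮 F) → ε < sup∣Ξₛ-Ξ∣ S) ]< δ)
theorem2 ε (η , 0<η , N₀ , η≤ε) δ (ρ , 0<ρ , N₁ , ρ≤δ) = N , λ F N≤F →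
    Large η , large? η , (λ {S} → <⇒Large ε η N₀ S η≤ε) ,
    ≤½⇒< δ ρ N₁ (ℙ (large? η)) 0<ρ ρ≤δ
      (ratio-≤ {D} {length (filter (large? η) (Ω F))} {{Ω-nonEmpty F}} (ℚ.<⇒≤ (½-pos 0<ρ)) 1≤D (bound F N≤F))
  where
  D = proj₁ (archimedean (½ ℚ.* ρ) (½-pos 0<ρ))
  1≤D = proj₂ (archimedean (½ ℚ.* ρ) (½-pos 0<ρ))
  N = proj₁ (mostly-small η 0<η D)
  bound = proj₂ (mostly-small η 0<η D)
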